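{- Let $\mathfrak g$ be a simple Lie algebra endowed with the invariant scalar product $\langle\cdot,\cdot\rangle=\lambda\cdot(\text{Killing form})$, $\lambda\neq 0$, and let $w_{\mathfrak g}$ be the associated Lie algebra weight system and $\bar w_{\mathfrak g}=w_{\mathfrak g}\circ\pi$. Then for all integers $i\ge 1$, $j\ge 0$, $$\bar w_{\mathfrak g}(J_{i,j})=\bar w_{\mathfrak g}(J_{i-1,j+1})+\frac{1}{\lambda}\,\bar w_{\mathfrak g}(J_{i-1,j}).$$
   Context: A closed Jacobi diagram is a connected graph consisting of a distinguished oriented circle (the Wilson loop) together with vertices on the loop (each incident to exactly one edge off the loop, called a leg) and internal trivalent vertices off the loop, each with a fixed cyclic order of its three half-edges; its degree is half its number of vertices. Chord diagrams are those closed diagrams with no internal vertices. The internal graph is obtained by deleting the Wilson loop; its connected components are the components of the diagram. Let $\mathcal C$ be the vector space spanned by closed diagrams modulo the STU relations $S=T-U$, where $S$ has an internal vertex joined to the loop by a leg and to two further half-edges $x,y$ (in the vertex's cyclic order), and $T$, $U$ are obtained by deleting that vertex and attaching $x,y$ directly to two adjacent points of the loop, in the order $x,y$ along the loop orientation for $T$ and $y,x$ for $U$. $\mathcal C$ is isomorphic to the space $\mathcal A^{fr}$ of chord diagrams modulo 4-term relations, and is a commutative cocommutative connected graded Hopf algebra: the product glues two Wilson loops by cutting them, and the coproduct is $\delta(D)=\sum_{J\subseteq [D]}D_J\otimes D_{\bar J}$ over subsets $J$ of the set $[D]$ of components. The projection $\pi$ onto primitive elements along the subspace of decomposable elements (products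 of elements of positive degree) is $$\pi(D)=D-\sum_{i\ge 2}(-1)^i(i-1)!\sum_{[D_1]\sqcup\dots\sqcup[D_i]=[D],\ [D_j]\ne\emptyset}D_1\cdots D_i,$$ the inner sum over unordered splittings of the set of components into nonempty parts, $D_j$ the subdiagram formed by the components in $[D_j]$. For a Lie algebra $\mathfrak g$ with a nondegenerate invariant form, basis $e_1,\dots,e_m$ and dual basis $e_1^*,\dots,e_m^*$, the weight system $w_{\mathfrak g}$ sends a chord diagram $D$ with $n$ chords to the element of $ZU(\mathfrak g)$ obtained by choosing a base point on the loop, labelling the first endpoint of each chord $a$ by $e_{i_a}$ and the second by $e_{i_a}^*$, multiplying the labels in the order along the loop and summing over all $i_a\in\{1,\dots,m\}$; it satisfies the 4-term relations and extends linearly to $\mathcal C$ via the STU relations. Write $\bar w_{\mathfrak g}=w_{\mathfrak g}\circ\pi$. The diagram $J_{i,j}$ ($i,j\ge0$), of degree $i+j+2$, is drawn in the plane inside its Wilson loop (loop oriented counterclockwise, internal vertices oriented counterclockwise by the planar drawing). Counterclockwise along the loop take points $p_1$, then $a_1,\dots,a_j$, then $p_2$, $p_3$, then $b_j,\dots,b_1$, then $p_4$ (so $p_1,p_2$ lie on the upper arc, $p_3,p_4$ on the lower arc, $p_2,p_3$ on the left and $p_4,p_1$ on the right), with chords $a_kb_k$, $k=1,\dots,j$ (mutually parallel, each separating $\{p_2,p_3\}$ from $\{p_1,p_4\}$). If $i=0$, the remaining part consists of the two chords $p_1p_2$ and $p_3p_4$, so $J_{0,j}$ is a chord diagram whose intersection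 graph is the complete bipartite graph $K_{2,j}$. If $i\ge1$, the remaining part is a planar ladder: internal vertices $u_1,\dots,u_i$ (upper rail) and $v_1,\dots,v_i$ (lower rail), edges $u_ku_{k+1}$, $v_kv_{k+1}$ ($1\le k<i$), rungs $u_kv_k$ ($1\le k\le i$), and legs $u_1p_2$, $v_1p_3$, $u_ip_1$, $v_ip_4$ (thus $i-1$ square cells, and the $j$ chords cross both rails). In particular $J_{i,0}$ is the ladder with $i$ rungs and four legs. -}

module Defs where

open import Algebra.Apartness.Bundles using (HeytingCommutativeRing; HeytingField)
open import Algebra.Bundles using (CommutativeMonoid; CommutativeRing; Ring; Semiring)
open import Algebra.Module.Bundles using (LeftModule)
open import Algebra.Module.Morphism.Structures using (module LeftModuleMorphisms)
import Algebra.Apartness.Properties.HeytingCommutativeRing as HeytingProperties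
import Algebra.Definitions.RawMonoid as RawMonoidDefs
import Algebra.Definitions.RawSemiring as RawSemiringDefs
import Algebra.Properties.CommutativeSemigroup as CommutativeSemigroupProperties
import Algebra.Solver.CommutativeMonoid as CommutativeMonoidSolver
open import Data.Bool.Base using (true; false; if_then_else_; _∨_)
open import Data.Bool.Properties using (∨-zeroʳ)
open import Data.Fin.Base using (Fin)
import Data.Fin.Properties as Fin
open import Data.List.Base
  using (List; []; _∷_; [_]; _++_; map; concatMap; filter; deduplicate; foldr; length; upTo; downFrom)
open import Data.List.Membership.Propositional using (_∈_; find; lose)
open import Data.List.Membership.Propositional.Properties
  using (∈-filter⁺; ∈-filter⁻; ∈-map⁺; ∈-map⁻; ∈-++⁺ˡ; ∈-++⁺ʳ; ∈-++⁻)
open import Data.List.Properties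
  using (≡-dec; filter-++; filter-accept; filter-reject; map-++; concatMap-map; map-concatMap; concatMap-++; reverse-upTo; ∷-injectiveˡ; ∷-injectiveʳ)
open import Data.List.Relation.Binary.Disjoint.Propositional using (Disjoint)
open import Data.List.Relation.Binary.Permutation.Homogeneous using (Permutation)
open import Data.List.Relation.Binary.Permutation.Propositional
  using (_↭_; ↭-refl; ↭-sym; ↭-trans; ↭-reflexive; module PermutationReasoning)
open import Data.List.Relation.Binary.Permutation.Propositional.Properties
  using (filter-↭; map⁺; ++⁺; ++⁺ˡ; ↭-reverse; ++-commutativeMonoid)
open import Data.List.Relation.Unary.All as All using (All; tabulate; lookup)
import Data.List.Relation.Unary.All.Properties as All
open import Data.List.Relation.Unary.AllPairs using ([]; _∷_)
open import Data.List.Relation.Unary.Any as Any using (Any; here; there)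
import Data.List.Relation.Unary.Any.Properties as Any
open import Data.List.Relation.Unary.Unique.Propositional using (Unique)
import Data.List.Relation.Unary.Unique.Propositional.Properties as Unique
open import Data.Maybe.Base using (Maybe; just; nothing)
open import Data.Nat.Base using (ℕ; zero; suc; _∸_; _!)
import Data.Nat.Properties as ℕ
open import Data.Product.Base using (_×_; _,_; proj₁; proj₂)
open import Data.Sum.Base using (inj₁; inj₂)
open import Function.Base using (_∘_)
open import Level using (0ℓ; _⊔_) renaming (suc to lsuc)
open import Relation.Binary.Construct.Closure.Equivalence as EqClosure using (EqClosure)
open import Relation.Binary.Construct.Closure.ReflexiveTransitive using (ε; _◅_; _◅◅_)
open import Relation.Binary.Construct.Closure.Symmetric using (fwd; bwd)
open import Relation.Binary.Definitions using (DecidableEquality)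
open import Relation.Binary.PropositionalEquality
  using (_≡_; refl; sym; trans; cong; cong₂; subst; module ≡-Reasoning)
open import Relation.Nullary.Decidable using (Dec; yes; no; does; dec-true)
open import Relation.Nullary.Negation using (¬_)
open import Relation.Unary using (Pred; Decidable)

------------------------------------------------------------------------
-- Closed Jacobi diagrams

-- Edges are named by lists so that any list of diagrams can be made
-- edge-disjoint by prefixing tags.
Edge : Set
Edge = List ℕ

_≟ᵉ_ : DecidableEquality Edge
_≟ᵉ_ = ≡-dec ℕ._≟_

open import Data.List.Membership.DecPropositional _≟ᵉ_ using (_∈?_)

-- The three edges at an internal vertex, in its cyclic order.
Vertex : Set
Vertex = Edge × Edge × Edge

halves : Vertex → List Edge
halves (x , y , z) = x ∷ y ∷ z ∷ []

mapᵛ : (Edge → Edge) → Vertex → Vertex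
mapᵛ f (x , y , z) = f x , f y , f z

-- Two edges of the internal graph meet at one of the given vertices.
Meet : List Vertex → Edge → Edge → Set
Meet vs e e′ = Any (λ v → e ∈ halves v × e′ ∈ halves v) vs

-- Two edges belong to the same component of the internal graph.
Linked : List Vertex → Edge → Edge → Set
Linked vs = EqClosure (Meet vs)

-- The Wilson loop is read off, along its orientation and from some base
-- point, as the word of the edges ending on it.  Every edge has two ends,
-- each on the loop or at an internal vertex.  Since the loop belongs to
-- the diagram, connectedness means that each component reaches the loop.
record Diagram : Set where
  field
    word      : List Edge
    vertices  : List Vertex
    edges     : List Edge
    unique    : Unique edges
    twoEnds   : word ++ concatMap halves vertices ↭ edges ++ edges
    connected : All (λ e → Any (Linked vertices e) word) edges

open Diagram

IsChordDiagram : Diagram → Set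
IsChordDiagram D = vertices D ≡ []

data _↻_ : Vertex → Vertex → Set where
  rot₀ : ∀ {x y z} → (x , y , z) ↻ (x , y , z)
  rot₁ : ∀ {x y z} → (x , y , z) ↻ (y , z , x)
  rot₂ : ∀ {x y z} → (x , y , z) ↻ (z , x , y)

-- Isomorphism: the edges are renamed, the base point moved, the internal
-- vertices listed in another order and their cyclic orders started
-- elsewhere.  The renaming is automatically injective on the edges of D,
-- since an edge of D′ has only two ends.
record _≅_ (D D′ : Diagram) : Set where
  field
    rename        : Edge → Edge
    before after  : List Edge
    word-split    : word D ≡ before ++ after
    word-rotated  : word D′ ≡ map rename (after ++ before)
    same-vertices : Permutation _↻_ (map (mapᵛ rename) (vertices D)) (vertices D′)

-- The leg of the vertex (leg , x , y) is removed and x , y are attached to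
-- the loop in its place, in this order in T and in the opposite order in U.
record STU (S T U : Diagram) : Set where
  field
    leg x y     : Edge
    left right  : List Edge
    rest        : List Vertex
    word-S      : word S ≡ left ++ leg ∷ right
    vertices-S  : vertices S ≡ (leg , x , y) ∷ rest
    word-T      : word T ≡ left ++ x ∷ y ∷ right
    vertices-T  : vertices T ≡ rest
    word-U      : word U ≡ left ++ y ∷ x ∷ right
    vertices-U  : vertices U ≡ rest

------------------------------------------------------------------------
-- Components and subdiagrams

merge : Edge → Edge → Edge → Edge → Edge
merge a b c r = if does (r ≟ᵉ b) ∨ does (r ≟ᵉ c) then a else r

-- A chosen edge in the component of each edge: starting from the discrete
-- partition, the classes of the three edges at each vertex are united.
rep : List Vertex → Edge → Edge
rep []                 e = e
rep ((x , y , z) ∷ vs) e = merge (rep vs x) (rep vs y) (rep vs z) (rep vs e)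

-- Components are represented by their chosen edges.
components : Diagram → List Edge
components D = deduplicate _≟ᵉ_ (map (rep (vertices D)) (edges D))

merge-b : ∀ a b c → merge a b c b ≡ a
merge-b a b c rewrite dec-true (b ≟ᵉ b) refl = refl

merge-c : ∀ a b c → merge a b c c ≡ a
merge-c a b c rewrite dec-true (c ≟ᵉ c) refl | ∨-zeroʳ (does (c ≟ᵉ b)) = refl

merge-a : ∀ a b c → merge a b c a ≡ a
merge-a a b c with does (a ≟ᵉ b) ∨ does (a ≟ᵉ c)
... | true  = refl
... | false = refl

rep-first : ∀ {vs v} → v ∈ vs → ∀ {e} → e ∈ halves v → rep vs e ≡ rep vs (proj₁ v)
rep-first (here refl) (here refl)                 = refl
rep-first {(x , y , z) ∷ vs} (here refl) (there (here refl)) =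
  trans (merge-b (rep vs x) (rep vs y) (rep vs z)) (sym (merge-a (rep vs x) (rep vs y) (rep vs z)))
rep-first {(x , y , z) ∷ vs} (here refl) (there (there (here refl))) =
  trans (merge-c (rep vs x) (rep vs y) (rep vs z)) (sym (merge-a (rep vs x) (rep vs y) (rep vs z)))
rep-first {(x , y , z) ∷ vs} (there v∈vs) e∈v =
  cong (merge (rep vs x) (rep vs y) (rep vs z)) (rep-first v∈vs e∈v)

meet⇒rep : ∀ {vs e e′} → Meet vs e e′ → rep vs e ≡ rep vs e′
meet⇒rep m with find m
... | v , v∈vs , e∈v , e′∈v = trans (rep-first v∈vs e∈v) (sym (rep-first v∈vs e′∈v))

linked⇒rep : ∀ {vs e e′} → Linked vs e e′ → rep vs e ≡ rep vs e′
linked⇒rep ε           = refl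
linked⇒rep (fwd m ◅ p) = trans (meet⇒rep m) (linked⇒rep p)
linked⇒rep (bwd m ◅ p) = trans (sym (meet⇒rep m)) (linked⇒rep p)

linked-weaken : ∀ {v vs e e′} → Linked vs e e′ → Linked (v ∷ vs) e e′
linked-weaken = EqClosure.map there

rep-linked : ∀ vs e → Linked vs e (rep vs e)
rep-linked []                 e = ε
rep-linked ((x , y , z) ∷ vs) e with rep vs e ≟ᵉ rep vs y | rep vs e ≟ᵉ rep vs z
... | no _   | no _   = linked-weaken (rep-linked vs e)
... | yes eq | _      =
  linked-weaken (subst (Linked vs e) eq (rep-linked vs e))
  ◅◅ linked-weaken (EqClosure.symmetric _ (rep-linked vs y))
  ◅◅ fwd (here (there (here refl) , here refl)) ◅ linked-weaken (rep-linked vs x)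
... | no _   | yes eq =
  linked-weaken (subst (Linked vs e) eq (rep-linked vs e))
  ◅◅ linked-weaken (EqClosure.symmetric _ (rep-linked vs z))
  ◅◅ fwd (here (there (there (here refl)) , here refl)) ◅ linked-weaken (rep-linked vs x)

rep⇒linked : ∀ vs {e e′} → rep vs e ≡ rep vs e′ → Linked vs e e′
rep⇒linked vs {e} {e′} eq =
  subst (Linked vs e) eq (rep-linked vs e) ◅◅ EqClosure.symmetric _ (rep-linked vs e′)

module _ (D : Diagram) (J : List Edge) where

  private
    vs = vertices D

  Kept : Pred Edge 0ℓ
  Kept e = rep vs e ∈ J

  kept? : Decidable Kept
  kept? e = rep vs e ∈? J

  Keptᵛ : Pred Vertex 0ℓ
  Keptᵛ v = Kept (proj₁ v)

  keptᵛ? : Decidable Keptᵛ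
  keptᵛ? v = kept? (proj₁ v)

  kept-along : ∀ {e e′} → Linked vs e e′ → Kept e → Kept e′
  kept-along p = subst (_∈ J) (linked⇒rep p)

  filter-halves : ∀ us → (∀ {v} → v ∈ us → v ∈ vs) →
    filter kept? (concatMap halves us) ≡ concatMap halves (filter keptᵛ? us)
  filter-halves [] _ = refl
  filter-halves ((x , y , z) ∷ us) us⊆vs = go (kept? x)
    where
    open ≡-Reasoning
    y≡x : rep vs y ≡ rep vs x
    y≡x = rep-first (us⊆vs (here refl)) (there (here refl))
    z≡x : rep vs z ≡ rep vs x
    z≡x = rep-first (us⊆vs (here refl)) (there (there (here refl)))
    go : Dec (Kept x) →
      filter kept? (concatMap halves ((x , y , z) ∷ us)) ≡ concatMap halves (filter keptᵛ? ((x , y , z) ∷ us))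
    go (yes k) = begin
      filter kept? (x ∷ y ∷ z ∷ _)     ≡⟨ filter-accept kept? k ⟩
      x ∷ filter kept? (y ∷ z ∷ _)     ≡⟨ cong (x ∷_) (filter-accept kept? (subst (_∈ J) (sym y≡x) k)) ⟩
      x ∷ y ∷ filter kept? (z ∷ _)     ≡⟨ cong (λ l → x ∷ y ∷ l) (filter-accept kept? (subst (_∈ J) (sym z≡x) k)) ⟩
      x ∷ y ∷ z ∷ filter kept? (concatMap halves us)
        ≡⟨ cong (λ l → x ∷ y ∷ z ∷ l) (filter-halves us (us⊆vs ∘ there)) ⟩
      concatMap halves ((x , y , z) ∷ filter keptᵛ? us)
        ≡⟨ cong (concatMap halves) (filter-accept keptᵛ? k) ⟨
      concatMap halves (filter keptᵛ? ((x , y , z) ∷ us)) ∎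
    go (no ¬k) = begin
      filter kept? (x ∷ y ∷ z ∷ _)     ≡⟨ filter-reject kept? ¬k ⟩
      filter kept? (y ∷ z ∷ _)         ≡⟨ filter-reject kept? (¬k ∘ subst (_∈ J) y≡x) ⟩
      filter kept? (z ∷ _)             ≡⟨ filter-reject kept? (¬k ∘ subst (_∈ J) z≡x) ⟩
      filter kept? (concatMap halves us) ≡⟨ filter-halves us (us⊆vs ∘ there) ⟩
      concatMap halves (filter keptᵛ? us) ≡⟨ cong (concatMap halves) (filter-reject keptᵛ? ¬k) ⟨
      concatMap halves (filter keptᵛ? ((x , y , z) ∷ us)) ∎

  meet-kept : ∀ {e e′} → Kept e → Meet vs e e′ → Meet (filter keptᵛ? vs) e e′
  meet-kept k m with find m
  ... | v , v∈vs , e∈v , e′∈v =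
    lose (∈-filter⁺ keptᵛ? v∈vs (subst (_∈ J) (rep-first v∈vs e∈v) k)) (e∈v , e′∈v)

  linked-kept : ∀ {e e′} → Kept e → Linked vs e e′ → Linked (filter keptᵛ? vs) e e′
  linked-kept k ε           = ε
  linked-kept k (fwd m ◅ p) =
    fwd (meet-kept k m) ◅ linked-kept (kept-along (fwd m ◅ ε) k) p
  linked-kept k (bwd m ◅ p) =
    bwd (meet-kept k′ m) ◅ linked-kept k′ p
    where k′ = kept-along (bwd m ◅ ε) k

  -- The subdiagram D_J formed by the components in J ⊆ [D].
  sub : Diagram
  sub .word      = filter kept? (word D)
  sub .vertices  = filter keptᵛ? vs
  sub .edges     = filter kept? (edges D)
  sub .unique    = Unique.filter⁺ kept? (unique D)
  sub .twoEnds   = begin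
    filter kept? (word D) ++ concatMap halves (filter keptᵛ? vs)
      ≡⟨ cong (filter kept? (word D) ++_) (filter-halves vs (λ v∈ → v∈)) ⟨
    filter kept? (word D) ++ filter kept? (concatMap halves vs)
      ≡⟨ filter-++ kept? (word D) _ ⟨
    filter kept? (word D ++ concatMap halves vs)
      ↭⟨ filter-↭ kept? (twoEnds D) ⟩
    filter kept? (edges D ++ edges D)
      ≡⟨ filter-++ kept? (edges D) _ ⟩
    filter kept? (edges D) ++ filter kept? (edges D) ∎
    where open PermutationReasoning
  sub .connected = tabulate reaches
    where
    reaches : ∀ {e} → e ∈ filter kept? (edges D) →
              Any (Linked (filter keptᵛ? vs) e) (filter kept? (word D))
    reaches e∈ with ∈-filter⁻ kept? e∈
    ... | e∈D , k with find (lookup (connected D) e∈D)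
    ... | l , l∈word , p = lose (∈-filter⁺ kept? l∈word (kept-along p k)) (linked-kept k p)

------------------------------------------------------------------------
-- Product

∅ : Diagram
∅ .word      = []
∅ .vertices  = []
∅ .edges     = []
∅ .unique    = []
∅ .twoEnds   = ↭-refl
∅ .connected = All.[]

tag : ℕ → Edge → Edge
tag = _∷_

open CommutativeMonoidSolver (++-commutativeMonoid {A = Edge}) using (solve; _⊕_; _⊜_)

interchange : (as bs cs ds : List Edge) →
  (as ++ bs) ++ (cs ++ ds) ↭ (as ++ cs) ++ (bs ++ ds)
interchange = CommutativeSemigroupProperties.interchange
  (CommutativeMonoid.commutativeSemigroup ++-commutativeMonoid)

tags-disjoint : ∀ {k l} → ¬ k ≡ l → ∀ xs ys → Disjoint (map (tag k) xs) (map (tag l) ys)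
tags-disjoint k≢l xs ys (p , q) with ∈-map⁻ _ p | ∈-map⁻ _ q
... | _ , _ , refl | _ , _ , eq = k≢l (∷-injectiveˡ eq)

halves-map : ∀ f vs → concatMap halves (map (mapᵛ f) vs) ≡ map f (concatMap halves vs)
halves-map f vs = trans (concatMap-map halves (mapᵛ f) vs) (sym (map-concatMap f halves vs))

meet-map : ∀ f {vs e e′} → Meet vs e e′ → Meet (map (mapᵛ f) vs) (f e) (f e′)
meet-map f = Any.map⁺ ∘ Any.map (λ (p , q) → Any.map⁺ (Any.map (cong f) p) , Any.map⁺ (Any.map (cong f) q))

-- The loops are cut at their base points and glued.
infixr 7 _∙_
_∙_ : Diagram → Diagram → Diagram
(D ∙ D′) .word      = map (tag 0) (word D) ++ map (tag 1) (word D′)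
(D ∙ D′) .vertices  = map (mapᵛ (tag 0)) (vertices D) ++ map (mapᵛ (tag 1)) (vertices D′)
(D ∙ D′) .edges     = map (tag 0) (edges D) ++ map (tag 1) (edges D′)
(D ∙ D′) .unique    =
  Unique.++⁺ (Unique.map⁺ ∷-injectiveʳ (unique D)) (Unique.map⁺ ∷-injectiveʳ (unique D′))
             (tags-disjoint (λ ()) (edges D) (edges D′))
(D ∙ D′) .twoEnds   = begin
  (t₀ (word D) ++ t₁ (word D′)) ++ concatMap halves (V ++ V′)
    ≡⟨ cong ((t₀ (word D) ++ t₁ (word D′)) ++_) (concatMap-++ halves V V′) ⟩
  (t₀ (word D) ++ t₁ (word D′)) ++ (concatMap halves V ++ concatMap halves V′)
    ≡⟨ cong₂ (λ p q → (t₀ (word D) ++ t₁ (word D′)) ++ (p ++ q))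
         (halves-map (tag 0) (vertices D)) (halves-map (tag 1) (vertices D′)) ⟩
  (t₀ (word D) ++ t₁ (word D′)) ++ (t₀ H ++ t₁ H′)
    ↭⟨ interchange (t₀ (word D)) (t₁ (word D′)) (t₀ H) (t₁ H′) ⟩
  (t₀ (word D) ++ t₀ H) ++ (t₁ (word D′) ++ t₁ H′)
    ≡⟨ cong₂ _++_ (map-++ (tag 0) (word D) H) (map-++ (tag 1) (word D′) H′) ⟨
  t₀ (word D ++ H) ++ t₁ (word D′ ++ H′)
    ↭⟨ ++⁺ (map⁺ (tag 0) (twoEnds D)) (map⁺ (tag 1) (twoEnds D′)) ⟩
  t₀ (edges D ++ edges D) ++ t₁ (edges D′ ++ edges D′)
    ≡⟨ cong₂ _++_ (map-++ (tag 0) (edges D) _) (map-++ (tag 1) (edges D′) _) ⟩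
  (t₀ (edges D) ++ t₀ (edges D)) ++ (t₁ (edges D′) ++ t₁ (edges D′))
    ↭⟨ interchange (t₀ (edges D)) (t₀ (edges D)) (t₁ (edges D′)) (t₁ (edges D′)) ⟩
  (t₀ (edges D) ++ t₁ (edges D′)) ++ (t₀ (edges D) ++ t₁ (edges D′)) ∎
  where
  open PermutationReasoning
  t₀ = map (tag 0)
  t₁ = map (tag 1)
  V  = map (mapᵛ (tag 0)) (vertices D)
  V′ = map (mapᵛ (tag 1)) (vertices D′)
  H  = concatMap halves (vertices D)
  H′ = concatMap halves (vertices D′)
(D ∙ D′) .connected = tabulate reaches
  where
  reaches : ∀ {e} → e ∈ edges (D ∙ D′) → Any (Linked (vertices (D ∙ D′)) e) (word (D ∙ D′))
  reaches e∈ with ∈-++⁻ (map (tag 0) (edges D)) e∈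
  ... | inj₁ e∈D with ∈-map⁻ (tag 0) e∈D
  ... | e , e∈ , refl = Any.++⁺ˡ (Any.map⁺ (Any.map
          (EqClosure.gmap (tag 0) (Any.++⁺ˡ ∘ meet-map (tag 0))) (lookup (connected D) e∈)))
  reaches e∈ | inj₂ e∈D′ with ∈-map⁻ (tag 1) e∈D′
  ... | e , e∈ , refl = Any.++⁺ʳ (map (tag 0) (word D)) (Any.map⁺ (Any.map
          (EqClosure.gmap (tag 1) (Any.++⁺ʳ (map (mapᵛ (tag 0)) (vertices D)) ∘ meet-map (tag 1)))
          (lookup (connected D′) e∈)))

product : List Diagram → Diagram
product = foldr _∙_ ∅

------------------------------------------------------------------------
-- The diagrams J i j

-- up k and low k are the rail edges between the k-th and (k+1)-st rungs,
-- counted from the left; for k = 0 and k = i they are legs (for i = 0 they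
-- are the chords p₁p₂ and p₃p₄).  rung k is u_{k+1} v_{k+1} and chord k is
-- a_{k+1} b_{k+1}.
up low rung chord : ℕ → Edge
up    k = 0 ∷ k ∷ []
low   k = 1 ∷ k ∷ []
rung  k = 2 ∷ k ∷ []
chord k = 3 ∷ k ∷ []

ladder : ℕ → List Vertex
ladder zero    = []
ladder (suc i) = (up (suc i) , up i , rung i) ∷ (rung i , low i , low (suc i)) ∷ ladder i

wordJ : ℕ → ℕ → List Edge
wordJ i j = up i ∷ map chord (upTo j) ++ up 0 ∷ low 0 ∷ map chord (downFrom j) ++ low i ∷ []

edgesJ : ℕ → ℕ → List Edge
edgesJ i j = map up (downFrom (suc i)) ++ map low (downFrom (suc i))
          ++ map rung (downFrom i) ++ map chord (downFrom j)

uniqueJ : ∀ i j → Unique (edgesJ i j)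
uniqueJ i j =
  Unique.++⁺ (tagged 0 (suc i)) (Unique.++⁺ (tagged 1 (suc i)) (Unique.++⁺ (tagged 2 i) (tagged 3 j)
    (apart (λ ()) i j))
    (disjoint-++ (map rung (downFrom i)) (apart (λ ()) (suc i) i) (apart (λ ()) (suc i) j)))
    (disjoint-++ (map low (downFrom (suc i))) (apart (λ ()) (suc i) (suc i))
      (disjoint-++ (map rung (downFrom i)) (apart (λ ()) (suc i) i) (apart (λ ()) (suc i) j)))
  where
  name : ℕ → ℕ → Edge
  name t k = t ∷ k ∷ []
  tagged : ∀ t n → Unique (map (name t) (downFrom n))
  tagged t n = Unique.map⁺ (∷-injectiveˡ ∘ ∷-injectiveʳ) (Unique.downFrom⁺ n)
  apart : ∀ {t u} → ¬ t ≡ u → ∀ m n → Disjoint (map (name t) (downFrom m)) (map (name u) (downFrom n))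
  apart t≢u m n (p , q) with ∈-map⁻ _ p | ∈-map⁻ _ q
  ... | _ , _ , refl | _ , _ , eq = t≢u (∷-injectiveˡ eq)
  disjoint-++ : ∀ {xs : List Edge} ys {zs} → Disjoint xs ys → Disjoint xs zs → Disjoint xs (ys ++ zs)
  disjoint-++ ys d d′ (p , q) with ∈-++⁻ ys q
  ... | inj₁ q′ = d (p , q′)
  ... | inj₂ q′ = d′ (p , q′)

railEdges : ℕ → List Edge
railEdges i = map up (downFrom (suc i)) ++ map low (downFrom (suc i)) ++ map rung (downFrom i)

twoEnds-rails : ∀ i → up i ∷ up 0 ∷ low 0 ∷ low i ∷ concatMap halves (ladder i) ↭ railEdges i ++ railEdges i
twoEnds-rails zero    =
  solve 2 (λ u l → u ⊕ (u ⊕ (l ⊕ l)) ⊜ ((u ⊕ l) ⊕ (u ⊕ l))) ↭-refl [ up 0 ] [ low 0 ]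
twoEnds-rails (suc i) = begin
  up (suc i) ∷ up 0 ∷ low 0 ∷ low (suc i) ∷ concatMap halves (ladder (suc i))
    ↭⟨ solve 8 (λ u′ u u₀ l′ l l₀ r h →
         (u′ ⊕ (u₀ ⊕ (l₀ ⊕ (l′ ⊕ (u′ ⊕ (u ⊕ (r ⊕ (r ⊕ (l ⊕ (l′ ⊕ h))))))))))
         ⊜ ((u′ ⊕ (l′ ⊕ r)) ⊕ (u′ ⊕ (l′ ⊕ r))) ⊕ (u ⊕ (u₀ ⊕ (l₀ ⊕ (l ⊕ h)))))
         ↭-refl [ up (suc i) ] [ up i ] [ up 0 ] [ low (suc i) ] [ low i ] [ low 0 ] [ rung i ]
         (concatMap halves (ladder i)) ⟩
  (new ++ new) ++ (up i ∷ up 0 ∷ low 0 ∷ low i ∷ concatMap halves (ladder i))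
    ↭⟨ ++⁺ˡ (new ++ new) (twoEnds-rails i) ⟩
  (new ++ new) ++ ((U ++ L ++ R) ++ (U ++ L ++ R))
    ↭⟨ solve 6 (λ u l r U L R →
         (((u ⊕ (l ⊕ r)) ⊕ (u ⊕ (l ⊕ r))) ⊕ ((U ⊕ (L ⊕ R)) ⊕ (U ⊕ (L ⊕ R))))
         ⊜ ((u ⊕ U) ⊕ ((l ⊕ L) ⊕ (r ⊕ R))) ⊕ ((u ⊕ U) ⊕ ((l ⊕ L) ⊕ (r ⊕ R))))
         ↭-refl [ up (suc i) ] [ low (suc i) ] [ rung i ] U L R ⟩
  railEdges (suc i) ++ railEdges (suc i) ∎
  where
  open PermutationReasoning
  new = up (suc i) ∷ low (suc i) ∷ rung i ∷ []
  U = map up (downFrom (suc i))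
  L = map low (downFrom (suc i))
  R = map rung (downFrom i)

twoEndsJ : ∀ i j → wordJ i j ++ concatMap halves (ladder i) ↭ edgesJ i j ++ edgesJ i j
twoEndsJ i j = begin
  wordJ i j ++ H
    ↭⟨ solve 7 (λ u u₀ l l₀ A B h →
         ((u ⊕ (A ⊕ (u₀ ⊕ (l₀ ⊕ (B ⊕ l))))) ⊕ h)
         ⊜ (u ⊕ (u₀ ⊕ (l₀ ⊕ (l ⊕ h)))) ⊕ (A ⊕ B))
         ↭-refl [ up i ] [ up 0 ] [ low i ] [ low 0 ] (map chord (upTo j)) C H ⟩
  (up i ∷ up 0 ∷ low 0 ∷ low i ∷ H) ++ (map chord (upTo j) ++ C)
    ↭⟨ ++⁺ (twoEnds-rails i) (++⁺ (map⁺ chord upTo↭downFrom) ↭-refl) ⟩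
  ((U ++ L ++ R) ++ (U ++ L ++ R)) ++ (C ++ C)
    ↭⟨ solve 4 (λ U L R C → (((U ⊕ (L ⊕ R)) ⊕ (U ⊕ (L ⊕ R))) ⊕ (C ⊕ C))
         ⊜ (U ⊕ (L ⊕ (R ⊕ C))) ⊕ (U ⊕ (L ⊕ (R ⊕ C)))) ↭-refl U L R C ⟩
  edgesJ i j ++ edgesJ i j ∎
  where
  open PermutationReasoning
  H = concatMap halves (ladder i)
  U = map up (downFrom (suc i))
  L = map low (downFrom (suc i))
  R = map rung (downFrom i)
  C = map chord (downFrom j)
  upTo↭downFrom : upTo j ↭ downFrom j
  upTo↭downFrom = ↭-trans (↭-sym (↭-reverse (upTo j))) (↭-reflexive (reverse-upTo j))

up-linked : ∀ i {k} → k ∈ downFrom (suc i) → Linked (ladder i) (up k) (up 0)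
up-linked zero    (here refl) = ε
up-linked (suc i) (here refl) =
  fwd (here (here refl , there (here refl))) ◅ linked-weaken (linked-weaken (up-linked i (here refl)))
up-linked (suc i) (there k∈)  = linked-weaken (linked-weaken (up-linked i k∈))

low-linked : ∀ i {k} → k ∈ downFrom (suc i) → Linked (ladder i) (low k) (low 0)
low-linked zero    (here refl) = ε
low-linked (suc i) (here refl) =
  fwd (there (here (there (there (here refl)) , there (here refl)))) ◅ linked-weaken (linked-weaken (low-linked i (here refl)))
low-linked (suc i) (there k∈)  = linked-weaken (linked-weaken (low-linked i k∈))

rung-linked : ∀ i {k} → k ∈ downFrom i → Linked (ladder i) (rung k) (up 0)
rung-linked (suc i) (here refl) =
  fwd (here (there (there (here refl)) , here refl)) ◅ up-linked (suc i) (here refl)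
rung-linked (suc i) (there k∈)  = linked-weaken (linked-weaken (rung-linked i k∈))

J : ℕ → ℕ → Diagram
J i j .word      = wordJ i j
J i j .vertices  = ladder i
J i j .edges     = edgesJ i j
J i j .unique    = uniqueJ i j
J i j .twoEnds   = twoEndsJ i j
J i j .connected = All.++⁺ (All.map⁺ (tabulate (lose up₀∈ ∘ up-linked i)))
  (All.++⁺ (All.map⁺ (tabulate (lose low₀∈ ∘ low-linked i)))
  (All.++⁺ (All.map⁺ (tabulate (lose up₀∈ ∘ rung-linked i)))
           (All.map⁺ (tabulate λ k∈ → lose (chord∈ k∈) ε))))
  where
  A = map chord (upTo j)
  B = map chord (downFrom j)
  up₀∈ : up 0 ∈ wordJ i j
  up₀∈ = there (∈-++⁺ʳ A (here refl))
  low₀∈ : low 0 ∈ wordJ i j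
  low₀∈ = there (∈-++⁺ʳ A (there (here refl)))
  chord∈ : ∀ {k} → k ∈ downFrom j → chord k ∈ wordJ i j
  chord∈ k∈ = there (∈-++⁺ʳ A (there (there (∈-++⁺ˡ (∈-map⁺ chord k∈)))))

------------------------------------------------------------------------
-- Splittings of a set into nonempty parts

insertions : ∀ {a} {A : Set a} → A → List (List A) → List (List (List A))
insertions x []       = []
insertions x (P ∷ Ps) = ((x ∷ P) ∷ Ps) ∷ map (P ∷_) (insertions x Ps)

splittings : ∀ {a} {A : Set a} → List A → List (List (List A))
splittings []       = [] ∷ []
splittings (x ∷ xs) = concatMap (λ Ps → ((x ∷ []) ∷ Ps) ∷ insertions x Ps) (splittings xs)

------------------------------------------------------------------------
-- The space 𝒞 and the projection π

module _ {c ℓ} (R : CommutativeRing c ℓ) where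

  open CommutativeRing R using (Carrier; _≈_; _+_; _*_; -_; 0#; 1#)
  open RawSemiringDefs (Semiring.rawSemiring (CommutativeRing.semiring R)) using (_^_) renaming (_×_ to _⋆_)

  infixl 6 _+ᶜ_
  infixr 7 _·ᶜ_
  infix 4 _≈ᶜ_

  data 𝒞 : Set c where
    ⟦_⟧  : Diagram → 𝒞
    0ᶜ   : 𝒞
    _+ᶜ_ : 𝒞 → 𝒞 → 𝒞
    _·ᶜ_ : Carrier → 𝒞 → 𝒞

  -ᶜ_ : 𝒞 → 𝒞
  -ᶜ x = (- 1#) ·ᶜ x

  data _≈ᶜ_ : 𝒞 → 𝒞 → Set (c ⊔ ℓ) where
    iso         : ∀ {D D′} → D ≅ D′ → ⟦ D ⟧ ≈ᶜ ⟦ D′ ⟧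
    stu         : ∀ {S T U} → STU S T U → ⟦ S ⟧ ≈ᶜ ⟦ T ⟧ +ᶜ (-ᶜ ⟦ U ⟧)
    reflᶜ       : ∀ {x} → x ≈ᶜ x
    symᶜ        : ∀ {x y} → x ≈ᶜ y → y ≈ᶜ x
    transᶜ      : ∀ {x y z} → x ≈ᶜ y → y ≈ᶜ z → x ≈ᶜ z
    +-congᶜ     : ∀ {x y u v} → x ≈ᶜ y → u ≈ᶜ v → x +ᶜ u ≈ᶜ y +ᶜ v
    ·-congᶜ     : ∀ {a b x y} → a ≈ b → x ≈ᶜ y → a ·ᶜ x ≈ᶜ b ·ᶜ y
    +-assocᶜ    : ∀ x y z → (x +ᶜ y) +ᶜ z ≈ᶜ x +ᶜ (y +ᶜ z)
    +-commᶜ     : ∀ x y → x +ᶜ y ≈ᶜ y +ᶜ x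
    +-identityᶜ : ∀ x → 0ᶜ +ᶜ x ≈ᶜ x
    ·-distribˡᶜ : ∀ a x y → a ·ᶜ (x +ᶜ y) ≈ᶜ a ·ᶜ x +ᶜ a ·ᶜ y
    ·-distribʳᶜ : ∀ x a b → (a + b) ·ᶜ x ≈ᶜ a ·ᶜ x +ᶜ b ·ᶜ x
    ·-assocᶜ    : ∀ a b x → (a * b) ·ᶜ x ≈ᶜ a ·ᶜ (b ·ᶜ x)
    ·-identityᶜ : ∀ x → 1# ·ᶜ x ≈ᶜ x
    ·-zeroᶜ     : ∀ x → 0# ·ᶜ x ≈ᶜ 0ᶜ

  𝒞-leftModule : LeftModule (CommutativeRing.ring R) c (c ⊔ ℓ)
  𝒞-leftModule = record
    { Carrierᴹ = 𝒞 ; _≈ᴹ_ = _≈ᶜ_ ; _+ᴹ_ = _+ᶜ_ ; _*ₗ_ = _·ᶜ_ ; 0ᴹ = 0ᶜ ; -ᴹ_ = -ᶜ_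
    ; isLeftModule = record
      { isLeftSemimodule = record
        { +ᴹ-isCommutativeMonoid = record
          { isMonoid = record
            { isSemigroup = record
              { isMagma = record
                { isEquivalence = record { refl = reflᶜ ; sym = symᶜ ; trans = transᶜ }
                ; ∙-cong = +-congᶜ }
              ; assoc = +-assocᶜ }
            ; identity = +-identityᶜ , λ x → transᶜ (+-commᶜ x 0ᶜ) (+-identityᶜ x) }
          ; comm = +-commᶜ }
        ; isPreleftSemimodule = record
          { *ₗ-cong = ·-congᶜ ; *ₗ-zeroˡ = ·-zeroᶜ ; *ₗ-distribʳ = ·-distribʳᶜ
          ; *ₗ-identityˡ = ·-identityᶜ ; *ₗ-assoc = ·-assocᶜ ; *ₗ-zeroʳ = zeroʳᶜ
          ; *ₗ-distribˡ = ·-distribˡᶜ } }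
      ; -ᴹ‿cong = ·-congᶜ (CommutativeRing.refl R)
      ; -ᴹ‿inverse = inverseˡᶜ , λ x → transᶜ (+-commᶜ x (-ᶜ x)) (inverseˡᶜ x) } }
    where
    zeroʳᶜ : ∀ a → a ·ᶜ 0ᶜ ≈ᶜ 0ᶜ
    zeroʳᶜ a = transᶜ (·-congᶜ (CommutativeRing.refl R) (symᶜ (·-zeroᶜ 0ᶜ)))
      (transᶜ (symᶜ (·-assocᶜ a 0# 0ᶜ))
      (transᶜ (·-congᶜ (CommutativeRing.zeroʳ R a) reflᶜ) (·-zeroᶜ 0ᶜ)))
    inverseˡᶜ : ∀ x → (-ᶜ x) +ᶜ x ≈ᶜ 0ᶜ
    inverseˡᶜ x = transᶜ (+-congᶜ reflᶜ (symᶜ (·-identityᶜ x)))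
      (transᶜ (symᶜ (·-distribʳᶜ x (- 1#) 1#))
      (transᶜ (·-congᶜ (CommutativeRing.-‿inverseˡ R 1#) reflᶜ) (·-zeroᶜ x)))

  sumᶜ : List 𝒞 → 𝒞
  sumᶜ = foldr _+ᶜ_ 0ᶜ

  -- (-1)^i (i-1)!
  coefficient : ℕ → Carrier
  coefficient i = (- 1#) ^ i * (((i ∸ 1) !) ⋆ 1#)

  -- The terms of the sum over i and over the splittings into i parts are
  -- indexed by all splittings into at least two parts.
  π : Diagram → 𝒞
  π D = ⟦ D ⟧ +ᶜ (-ᶜ sumᶜ (map term (filter (λ Ps → 2 ℕ.≤? length Ps) (splittings (components D)))))
    where
    term : List (List Edge) → 𝒞
    term Ps = coefficient (length Ps) ·ᶜ ⟦ product (map (sub D) Ps) ⟧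

------------------------------------------------------------------------
-- Fields and Lie algebras

ringOf : ∀ {c ℓ₁ ℓ₂} → HeytingField c ℓ₁ ℓ₂ → CommutativeRing c ℓ₁
ringOf K = HeytingCommutativeRing.commutativeRing (HeytingField.heytingCommutativeRing K)

module _ {c ℓ₁ ℓ₂} (K : HeytingField c ℓ₁ ℓ₂) where

  open HeytingField K using (Carrier; _≈_; _#_; _*_; 0#; 1#; #⇒invertible; *-congˡ)
    renaming (trans to ≈-trans; sym to ≈-sym)
  open RawSemiringDefs (Semiring.rawSemiring (CommutativeRing.semiring (ringOf K))) using () renaming (_×_ to _⋆_)

  CharacteristicZero : Set ℓ₂
  CharacteristicZero = ∀ n → (suc n ⋆ 1#) # 0#

  reciprocal : ∀ {x} → x # 0# → Carrier
  reciprocal x#0 = proj₁ (#⇒invertible x#0)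

  reciprocal-inverse : ∀ {x} (x#0 : x # 0#) → reciprocal x#0 * x ≈ 1#
  reciprocal-inverse x#0 =
    ≈-trans (*-congˡ (≈-sym (HeytingProperties.x-0≈x (HeytingField.heytingCommutativeRing K) _)))
            (proj₁ (proj₂ (#⇒invertible x#0)))

record LieAlgebra {c ℓ} (R : CommutativeRing c ℓ) m ℓm : Set (c ⊔ ℓ ⊔ lsuc (m ⊔ ℓm)) where
  field
    leftModule : LeftModule (CommutativeRing.ring R) m ℓm
  open LeftModule leftModule public
  field
    ⁅_,_⁆         : Carrierᴹ → Carrierᴹ → Carrierᴹ
    ⁅⁆-cong       : ∀ {x x′ y y′} → x ≈ᴹ x′ → y ≈ᴹ y′ → ⁅ x , y ⁆ ≈ᴹ ⁅ x′ , y′ ⁆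
    ⁅⁆-+ˡ         : ∀ x y z → ⁅ x +ᴹ y , z ⁆ ≈ᴹ ⁅ x , z ⁆ +ᴹ ⁅ y , z ⁆
    ⁅⁆-+ʳ         : ∀ x y z → ⁅ x , y +ᴹ z ⁆ ≈ᴹ ⁅ x , y ⁆ +ᴹ ⁅ x , z ⁆
    ⁅⁆-*ˡ         : ∀ a x y → ⁅ a *ₗ x , y ⁆ ≈ᴹ a *ₗ ⁅ x , y ⁆
    ⁅⁆-*ʳ         : ∀ a x y → ⁅ x , a *ₗ y ⁆ ≈ᴹ a *ₗ ⁅ x , y ⁆
    ⁅⁆-alternating : ∀ x → ⁅ x , x ⁆ ≈ᴹ 0ᴹ
    ⁅⁆-jacobi     : ∀ x y z →
      ⁅ x , ⁅ y , z ⁆ ⁆ +ᴹ ⁅ y , ⁅ z , x ⁆ ⁆ +ᴹ ⁅ z , ⁅ x , y ⁆ ⁆ ≈ᴹ 0ᴹ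

module _ {c ℓ m ℓm} {R : CommutativeRing c ℓ} (𝔤 : LieAlgebra R m ℓm) where

  open CommutativeRing R using (Carrier; _≈_; _*_; 0#; 1#)
  open LieAlgebra 𝔤
  open RawMonoidDefs +ᴹ-rawMonoid using () renaming (sum to sumᴹ)
  open RawMonoidDefs (CommutativeRing.+-rawMonoid R) using (sum)

  record IsIdeal {p} (I : Pred Carrierᴹ p) : Set (c ⊔ m ⊔ ℓm ⊔ p) where
    field
      resp   : ∀ {x y} → x ≈ᴹ y → I x → I y
      0∈     : I 0ᴹ
      +-clos : ∀ {x y} → I x → I y → I (x +ᴹ y)
      *-clos : ∀ a {x} → I x → I (a *ₗ x)
      ⁅⁆-clos : ∀ x {y} → I y → I ⁅ x , y ⁆

  -- No ideal is both nonzero and proper.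
  record IsSimple : Set (c ⊔ lsuc (c ⊔ m ⊔ ℓm)) where
    field
      nonabelian : ¬ (∀ x y → ⁅ x , y ⁆ ≈ᴹ 0ᴹ)
      ideals     : ∀ {I : Pred Carrierᴹ (c ⊔ m ⊔ ℓm)} → IsIdeal I →
                   ¬ (¬ (∀ {x} → I x → x ≈ᴹ 0ᴹ) × ¬ (∀ x → I x))

  record IsBasis {n} (e : Fin n → Carrierᴹ) : Set (c ⊔ ℓ ⊔ m ⊔ ℓm) where
    field
      coordinate  : Carrierᴹ → Fin n → Carrier
      spanning    : ∀ x → x ≈ᴹ sumᴹ (λ i → coordinate x i *ₗ e i)
      independent : ∀ (a : Fin n → Carrier) → sumᴹ (λ i → a i *ₗ e i) ≈ᴹ 0ᴹ → ∀ i → a i ≈ 0#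

  module _ {n} {e : Fin n → Carrierᴹ} (basis : IsBasis e) where

    open IsBasis basis

    trace : (Carrierᴹ → Carrierᴹ) → Carrier
    trace f = sum (λ i → coordinate (f (e i)) i)

    killing : Carrierᴹ → Carrierᴹ → Carrier
    killing x y = trace (λ z → ⁅ x , ⁅ y , z ⁆ ⁆)

  IsDual : (Carrierᴹ → Carrierᴹ → Carrier) → ∀ {n} → (e e* : Fin n → Carrierᴹ) → Set ℓ
  IsDual ⟨_,_⟩ e e* = ∀ i j → ⟨ e i , e* j ⟩ ≈ (if does (i Fin.≟ j) then 1# else 0#)

  ----------------------------------------------------------------------
  -- The universal enveloping algebra

  infixl 6 _+ᵁ_
  infixl 7 _*ᵁ_
  infix 4 _≈ᵁ_

  data U : Set (c ⊔ m) where
    ι      : Carrierᴹ → U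
    scalar : Carrier → U
    _+ᵁ_   : U → U → U
    _*ᵁ_   : U → U → U

  0ᵁ 1ᵁ : U
  0ᵁ = scalar 0#
  1ᵁ = scalar 1#

  -ᵁ_ : U → U
  -ᵁ u = scalar (CommutativeRing.-_ R 1#) *ᵁ u

  -- The unital associative algebra generated by 𝔤, subject to ι being
  -- linear and ⁅ x , y ⁆ = xy - yx.
  data _≈ᵁ_ : U → U → Set (c ⊔ ℓ ⊔ m ⊔ ℓm) where
    reflᵁ       : ∀ {u} → u ≈ᵁ u
    symᵁ        : ∀ {u v} → u ≈ᵁ v → v ≈ᵁ u
    transᵁ      : ∀ {u v w} → u ≈ᵁ v → v ≈ᵁ w → u ≈ᵁ w
    +-congᵁ     : ∀ {u v u′ v′} → u ≈ᵁ u′ → v ≈ᵁ v′ → u +ᵁ v ≈ᵁ u′ +ᵁ v′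
    *-congᵁ     : ∀ {u v u′ v′} → u ≈ᵁ u′ → v ≈ᵁ v′ → u *ᵁ v ≈ᵁ u′ *ᵁ v′
    +-assocᵁ    : ∀ u v w → (u +ᵁ v) +ᵁ w ≈ᵁ u +ᵁ (v +ᵁ w)
    +-commᵁ     : ∀ u v → u +ᵁ v ≈ᵁ v +ᵁ u
    +-identityᵁ : ∀ u → 0ᵁ +ᵁ u ≈ᵁ u
    *-assocᵁ    : ∀ u v w → (u *ᵁ v) *ᵁ w ≈ᵁ u *ᵁ (v *ᵁ w)
    *-identityᵁ : ∀ u → 1ᵁ *ᵁ u ≈ᵁ u
    *-zeroᵁ     : ∀ u → 0ᵁ *ᵁ u ≈ᵁ 0ᵁ
    distribˡᵁ   : ∀ u v w → u *ᵁ (v +ᵁ w) ≈ᵁ (u *ᵁ v) +ᵁ (u *ᵁ w)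
    distribʳᵁ   : ∀ u v w → (v +ᵁ w) *ᵁ u ≈ᵁ (v *ᵁ u) +ᵁ (w *ᵁ u)
    scalar-cong : ∀ {a b} → a ≈ b → scalar a ≈ᵁ scalar b
    scalar-+    : ∀ a b → scalar (CommutativeRing._+_ R a b) ≈ᵁ scalar a +ᵁ scalar b
    scalar-*    : ∀ a b → scalar (a * b) ≈ᵁ scalar a *ᵁ scalar b
    scalar-comm : ∀ a u → scalar a *ᵁ u ≈ᵁ u *ᵁ scalar a
    ι-cong      : ∀ {x y} → x ≈ᴹ y → ι x ≈ᵁ ι y
    ι-+         : ∀ x y → ι (x +ᴹ y) ≈ᵁ ι x +ᵁ ι y
    ι-*         : ∀ a x → ι (a *ₗ x) ≈ᵁ scalar a *ᵁ ι x
    ι-⁅⁆        : ∀ x y → ι ⁅ x , y ⁆ ≈ᵁ (ι x *ᵁ ι y) +ᵁ (-ᵁ (ι y *ᵁ ι x))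

  U-ring : Ring (c ⊔ m) (c ⊔ ℓ ⊔ m ⊔ ℓm)
  U-ring = record
    { Carrier = U ; _≈_ = _≈ᵁ_ ; _+_ = _+ᵁ_ ; _*_ = _*ᵁ_ ; -_ = -ᵁ_ ; 0# = 0ᵁ ; 1# = 1ᵁ
    ; isRing = record
      { +-isAbelianGroup = record
        { isGroup = record
          { isMonoid = record
            { isSemigroup = record
              { isMagma = record
                { isEquivalence = record { refl = reflᵁ ; sym = symᵁ ; trans = transᵁ }
                ; ∙-cong = +-congᵁ }
              ; assoc = +-assocᵁ }
            ; identity = +-identityᵁ , λ u → transᵁ (+-commᵁ u 0ᵁ) (+-identityᵁ u) }
          ; inverse = inverseˡᵁ , λ u → transᵁ (+-commᵁ u (-ᵁ u)) (inverseˡᵁ u)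
          ; ⁻¹-cong = *-congᵁ reflᵁ }
        ; comm = +-commᵁ }
      ; *-cong = *-congᵁ
      ; *-assoc = *-assocᵁ
      ; *-identity = *-identityᵁ , λ u → transᵁ (symᵁ (scalar-comm 1# u)) (*-identityᵁ u)
      ; distrib = distribˡᵁ , distribʳᵁ } }
    where
    inverseˡᵁ : ∀ u → (-ᵁ u) +ᵁ u ≈ᵁ 0ᵁ
    inverseˡᵁ u = transᵁ (+-congᵁ reflᵁ (symᵁ (*-identityᵁ u)))
      (transᵁ (symᵁ (distribʳᵁ u _ _))
      (transᵁ (*-congᵁ (transᵁ (symᵁ (scalar-+ _ _)) (scalar-cong (CommutativeRing.-‿inverseˡ R 1#))) reflᵁ)
              (*-zeroᵁ u)))

  U-leftModule : LeftModule (CommutativeRing.ring R) (c ⊔ m) (c ⊔ ℓ ⊔ m ⊔ ℓm)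
  U-leftModule = record
    { Carrierᴹ = U ; _≈ᴹ_ = _≈ᵁ_ ; _+ᴹ_ = _+ᵁ_ ; _*ₗ_ = λ a u → scalar a *ᵁ u ; 0ᴹ = 0ᵁ ; -ᴹ_ = -ᵁ_
    ; isLeftModule = record
      { isLeftSemimodule = record
        { +ᴹ-isCommutativeMonoid = Ring.+-isCommutativeMonoid U-ring
        ; isPreleftSemimodule = record
          { *ₗ-cong = λ a≈b → *-congᵁ (scalar-cong a≈b)
          ; *ₗ-zeroˡ = *-zeroᵁ
          ; *ₗ-distribʳ = λ u a b → transᵁ (*-congᵁ (scalar-+ a b) reflᵁ) (distribʳᵁ u _ _)
          ; *ₗ-identityˡ = *-identityᵁ
          ; *ₗ-assoc = λ a b u → transᵁ (*-congᵁ (scalar-* a b) reflᵁ) (*-assocᵁ _ _ u)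
          ; *ₗ-zeroʳ = λ a → Ring.zeroʳ U-ring (scalar a)
          ; *ₗ-distribˡ = λ a → distribˡᵁ (scalar a) } }
      ; -ᴹ‿cong = *-congᵁ reflᵁ
      ; -ᴹ‿inverse = Ring.-‿inverse U-ring } }

  Central : U → Set (c ⊔ ℓ ⊔ m ⊔ ℓm)
  Central z = ∀ u → z *ᵁ u ≈ᵁ u *ᵁ z

  ----------------------------------------------------------------------
  -- Weight systems

  module _ {n} (e e* : Fin n → Carrierᴹ) where

    open RawMonoidDefs (Ring.+-rawMonoid U-ring) using () renaming (sum to sumᵁ)

    -- The sum over the index i_a of a chord a is taken where its first
    -- endpoint is met; the index is then remembered for the second one.
    chordValue : (Edge → Maybe (Fin n)) → List Edge → U
    chordValue index []      = 1ᵁ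
    chordValue index (a ∷ w) with index a
    ... | nothing = sumᵁ λ i →
      ι (e i) *ᵁ chordValue (λ b → if does (b ≟ᵉ a) then just i else index b) w
    ... | just i  = ι (e* i) *ᵁ chordValue index w

    -- Chord diagrams span 𝒞, so at most one w satisfies these conditions up to ≈ᵁ.
    record IsWeightSystem (w : 𝒞 R → U) : Set (c ⊔ ℓ ⊔ m ⊔ ℓm) where
      open LeftModuleMorphisms (LeftModule.rawLeftModule (𝒞-leftModule R)) (LeftModule.rawLeftModule U-leftModule)
      field
        isLinear : IsLeftModuleHomomorphism w
        central  : ∀ x → Central (w x)
        chords   : ∀ D → IsChordDiagram D → w ⟦ D ⟧ ≈ᵁ chordValue (λ _ → nothing) (word D)

-- A ladder with one more rung is resolved at its last two legs by STU into four
-- diagrams in which the rung has become a chord: the chord crosses both rails,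
-- only one of them, or none.  Averaging the Casimir tensor over an element x of 𝔤,
-- Σ eᵢ x eᵢ*, gives (Ω - 1/2λ) x, because the Casimir element acts on the adjoint
-- representation as 1/λ.  Hence
--   w (J (i + 1) s) = w (J i (s + 1)) - Ω w (J i s) + (1/λ) w (J i s).
-- Since w is multiplicative, the composite w ∘ π is a sum over the splittings of
-- the set of components, with the coefficients of a cumulant; pulling out one
-- chord from this sum replaces w (J i (s + 1)) by w (J i (s + 1)) - Ω w (J i s),
-- which cancels the product term.  For i = 0 the two rails are separate components;
-- when a splitting separates them, each of their blocks contributes -1/2λ.
module Submission where

open import Algebra.Apartness.Bundles using (HeytingField)
open import Algebra.Bundles using (CommutativeMonoid; CommutativeRing; Ring; Semiring)
import Algebra.Definitions.RawSemiring as RawSemiringDefs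
open import Algebra.Module.Bundles using (LeftModule)
import Algebra.Module.Construct.TensorUnit as TensorUnit
open import Algebra.Module.Morphism.Structures using (module LeftModuleMorphisms)
import Algebra.Properties.AbelianGroup as AbelianGroupProperties
import Algebra.Properties.CommutativeMonoid.Mult as CommutativeMonoidMult
import Algebra.Properties.CommutativeMonoid.Sum as Sum
import Algebra.Properties.CommutativeSemigroup as CommutativeSemigroupProperties
import Algebra.Properties.Ring as RingProperties
import Algebra.Properties.Semiring.Mult as SemiringMult
import Algebra.Properties.Semiring.Sum as SemiringSum
import Algebra.Solver.CommutativeMonoid as CommutativeMonoidSolver
import Algebra.Solver.Ring.NaturalCoefficients.Default as NaturalSolver
open import Data.Bool.Base using (Bool; true; false; if_then_else_)
open import Data.Empty using (⊥-elim)
open import Data.Fin.Base using (Fin; zero; suc)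
import Data.Fin.Properties as Fin
open import Data.List.Base
  using (List; []; _∷_; [_]; _++_; map; concatMap; length; reverse; filter; deduplicate;
         replicate; upTo; downFrom)
open import Data.List.Membership.Propositional using (_∈_; _∉_; find; lose)
open import Data.List.Membership.Propositional.Properties
  using (∈-++⁺ˡ; ∈-++⁺ʳ; ∈-++⁻; ∈-∃++; ∈-map⁺; ∈-map⁻; ∈-concat⁻′; ∈-concatMap⁺; ∈-deduplicate⁺;
         ∈-downFrom⁺)
open import Data.List.Properties
  using (map-id; map-id-local; map-cong-local; map-∘; map-++; length-map; ++-identityʳ; ++-assoc;
         concatMap-map; concatMap-cong; map-concatMap; unfold-reverse; reverse-involutive;
         reverse-map; reverse-upTo; length-reverse; length-upTo; length-downFrom; filter-++;
         filter-all; filter-none; filter-accept; filter-reject; ∷-injectiveˡ; ∷-injectiveʳ)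
open import Data.List.Relation.Binary.Disjoint.Propositional using (Disjoint)
import Data.List.Relation.Binary.Permutation.Homogeneous as Homogeneous
open import Data.List.Relation.Binary.Permutation.Propositional as ↭
  using (_↭_; prep; swap; ↭-refl; ↭-sym; ↭-trans; ↭-reflexive; ↭⇒↭ₛ; module PermutationReasoning)
open import Data.List.Relation.Binary.Permutation.Propositional.Properties
  using (shift; shifts; drop-∷; ++⁺; ++⁺ˡ; ++⁺ʳ; ++-comm; map⁺; ↭-length; ↭-empty-inv; ↭-reverse;
         ∈-resp-↭; Any-resp-↭; All-resp-↭; ++-commutativeMonoid)
import Data.List.Relation.Binary.Permutation.Setoid.Properties as SetoidPermutation
open import Data.List.Relation.Binary.Pointwise.Base using (Pointwise; []; _∷_)
open import Data.List.Relation.Binary.Sublist.Propositional as Sublist using (_⊆_; []; _∷_; _∷ʳ_)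
open import Data.List.Relation.Unary.All as All using (All; []; _∷_)
import Data.List.Relation.Unary.All.Properties as All
open import Data.List.Relation.Unary.AllPairs as AllPairs using ([]; _∷_)
open import Data.List.Relation.Unary.Any as Any using (Any; here; there)
open import Data.List.Relation.Unary.Unique.Propositional using (Unique)
import Data.List.Relation.Unary.Unique.Propositional.Properties as Unique
open import Data.Maybe.Base using (Maybe; just; nothing)
open import Data.Nat.Base as ℕ using (ℕ; zero; suc; _!)
import Data.Nat.Properties as ℕ
open import Data.Product.Base using (Σ; _×_; _,_; proj₁; proj₂; ∃; ∃₂)
open import Data.Sum.Base using (_⊎_; inj₁; inj₂; reduce)
open import Data.Unit.Base using (⊤)
open import Function.Base using (_∘_; id)
open import Level using (_⊔_)
import Relation.Binary.Construct.Closure.Equivalence as EqClosure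
open import Relation.Binary.Construct.Closure.ReflexiveTransitive using (ε; _◅_; _◅◅_)
open import Relation.Binary.Construct.Closure.Symmetric using (fwd; bwd)
open import Relation.Binary.PropositionalEquality as ≡ using (_≡_; _≢_; cong; cong₂; subst; subst₂)
import Relation.Binary.Reasoning.Setoid as SetoidReasoning
open import Relation.Nullary.Decidable using (does; yes; no; dec-true; dec-false; ¬?)
open import Relation.Nullary.Negation using (¬_)
open import Relation.Unary using (Pred; Decidable)
open import Defs
open Diagram
open Homogeneous using (Permutation)

-- The adjoint Casimir element

-- The cancellation rests on the identity μ (q + 1) + q μ q = 0 for the coefficients of π: a chord
-- whose insertion merely multiplied every block by Ω would enter with μ (q + 1) as a part of its
-- own and q times with μ q inside the other parts. What survives is the deviation of the blocks
-- from this rule: zero for a block without rails, and for a block with both rails exactly what the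
-- resolution of a rung provides. For i = 0 the obstacle is that `J 0 j` and `J 1 j` have different
-- sets of components. The term (1/λ) w̄ (J 0 j) supplies 1/2λ for each rail and so removes the
-- splittings that separate the rails; the remaining ones are the splittings of `J 1 j`. The other
-- obstacle is that `w` is prescribed on chord diagrams only, whereas the new chord crosses a leg
-- that ends at an internal vertex. The rest of the ladder is therefore opened by STU from its far
-- end, which leaves the crossing intact until only chords remain.

-- The library's sum lemmas with the length fixed, which unification cannot
-- recover from a sum of variable length.
module FixedSum {a ℓ} (M : CommutativeMonoid a ℓ) (n : ℕ) where

  open CommutativeMonoid M using (Carrier; _≈_) renaming (_∙_ to _+_; ε to 0#)
  private module S = Sum M

  ∑ : (Fin n → Carrier) → Carrier
  ∑ = S.sum

  ∑-cong : ∀ {f g} → (∀ i → f i ≈ g i) → ∑ f ≈ ∑ g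
  ∑-cong = S.sum-cong-≋

  ∑-∙ : ∀ f g → ∑ (λ i → f i + g i) ≈ ∑ f + ∑ g
  ∑-∙ = S.∑-distrib-+

  ∑-ε : ∑ (λ _ → 0#) ≈ 0#
  ∑-ε = S.sum-replicate-zero n

  ∑-comm : ∀ (f : Fin n → Fin n → Carrier) → ∑ (λ i → ∑ (f i)) ≈ ∑ (λ j → ∑ (λ i → f i j))
  ∑-comm = S.∑-comm

module _ {c ℓ m ℓm} {R : CommutativeRing c ℓ} (M : LeftModule (CommutativeRing.ring R) m ℓm) where

  open CommutativeRing R using (Carrier)
  private module M = LeftModule M

  module _ {k ℓk} (N : LeftModule (CommutativeRing.ring R) k ℓk) where

    private module N = LeftModule N

    record IsLinear (f : M.Carrierᴹ → N.Carrierᴹ) : Set (c ⊔ m ⊔ ℓm ⊔ ℓk) where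
      field
        resp  : ∀ {x y} → x M.≈ᴹ y → f x N.≈ᴹ f y
        +-homo : ∀ x y → f (x M.+ᴹ y) N.≈ᴹ f x N.+ᴹ f y
        *-homo : ∀ a x → f (a M.*ₗ x) N.≈ᴹ a N.*ₗ f x

      0-homo : f M.0ᴹ N.≈ᴹ N.0ᴹ
      0-homo = N.≈ᴹ-trans (resp (M.≈ᴹ-sym (M.*ₗ-zeroˡ M.0ᴹ)))
        (N.≈ᴹ-trans (*-homo _ _) (N.*ₗ-zeroˡ _))

      neg-homo : ∀ x → f (M.-ᴹ x) N.≈ᴹ N.-ᴹ f x
      neg-homo x = AbelianGroupProperties.inverseˡ-unique N.+ᴹ-abelianGroup _ _
        (N.≈ᴹ-trans (N.≈ᴹ-sym (+-homo _ _)) (N.≈ᴹ-trans (resp (M.-ᴹ‿inverseˡ x)) 0-homo))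

      sum-homo : ∀ {n} (a : Fin n → Carrier) (x : Fin n → M.Carrierᴹ) →
        f (Sum.sum M.+ᴹ-commutativeMonoid (λ i → a i M.*ₗ x i)) N.≈ᴹ
        Sum.sum N.+ᴹ-commutativeMonoid (λ i → a i N.*ₗ f (x i))
      sum-homo {zero}  a x = 0-homo
      sum-homo {suc n} a x = N.≈ᴹ-trans (+-homo _ _)
        (N.+ᴹ-cong (*-homo _ _) (sum-homo (a ∘ suc) (x ∘ suc)))

module Casimir {c ℓ m ℓm} {R : CommutativeRing c ℓ} (𝔤 : LieAlgebra R m ℓm)
  {n} (e e* : Fin n → LieAlgebra.Carrierᴹ 𝔤) (basis : IsBasis 𝔤 e)
  (lam : CommutativeRing.Carrier R)
  (dual : IsDual 𝔤 (λ x y → CommutativeRing._*_ R lam (killing 𝔤 basis x y)) e e*) where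

  module R = CommutativeRing R
  open R using (Carrier; _≈_; _+_; _*_; -_; 0#; 1#)
  open LieAlgebra 𝔤
  open IsBasis basis
  module ΣR = FixedSum R.+-commutativeMonoid n
  module ΣM = FixedSum +ᴹ-commutativeMonoid n
  open AbelianGroupProperties +ᴹ-abelianGroup using () renaming (inverseˡ-unique to -ᴹ-unique)
  open AbelianGroupProperties R.+-abelianGroup using () renaming (inverseˡ-unique to neg-unique; ⁻¹-involutive to neg-involutive)

  R-module : LeftModule R.ring c ℓ
  R-module = TensorUnit.leftModule {R = R.ring}

  ⁅⁆-linearʳ : ∀ x → IsLinear {R = R} leftModule leftModule (λ y → ⁅ x , y ⁆)
  ⁅⁆-linearʳ x = record { resp = ⁅⁆-cong ≈ᴹ-refl ; +-homo = ⁅⁆-+ʳ x ; *-homo = λ a y → ⁅⁆-*ʳ a x y }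

  ⁅⁆-linearˡ : ∀ y → IsLinear {R = R} leftModule leftModule (λ x → ⁅ x , y ⁆)
  ⁅⁆-linearˡ y = record { resp = λ p → ⁅⁆-cong p ≈ᴹ-refl ; +-homo = λ x x′ → ⁅⁆-+ˡ x x′ y ; *-homo = λ a x → ⁅⁆-*ˡ a x y }

  ⁅⁆-antisym : ∀ x y → ⁅ x , y ⁆ ≈ᴹ -ᴹ ⁅ y , x ⁆
  ⁅⁆-antisym x y = -ᴹ-unique _ _ (begin
    ⁅ x , y ⁆ +ᴹ ⁅ y , x ⁆
      ≈⟨ +ᴹ-cong (+ᴹ-identityˡ _) (+ᴹ-identityʳ _) ⟨
    (0ᴹ +ᴹ ⁅ x , y ⁆) +ᴹ (⁅ y , x ⁆ +ᴹ 0ᴹ)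
      ≈⟨ +ᴹ-cong (+ᴹ-congʳ (⁅⁆-alternating x)) (+ᴹ-congˡ (⁅⁆-alternating y)) ⟨
    (⁅ x , x ⁆ +ᴹ ⁅ x , y ⁆) +ᴹ (⁅ y , x ⁆ +ᴹ ⁅ y , y ⁆)
      ≈⟨ +ᴹ-cong (⁅⁆-+ʳ x x y) (⁅⁆-+ʳ y x y) ⟨
    ⁅ x , x +ᴹ y ⁆ +ᴹ ⁅ y , x +ᴹ y ⁆
      ≈⟨ ⁅⁆-+ˡ x y (x +ᴹ y) ⟨
    ⁅ x +ᴹ y , x +ᴹ y ⁆
      ≈⟨ ⁅⁆-alternating (x +ᴹ y) ⟩
    0ᴹ ∎)
    where open SetoidReasoning ≈ᴹ-setoid

  ⁅⁆-derivation : ∀ x y z → ⁅ ⁅ x , y ⁆ , z ⁆ ≈ᴹ ⁅ x , ⁅ y , z ⁆ ⁆ +ᴹ -ᴹ ⁅ y , ⁅ x , z ⁆ ⁆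
  ⁅⁆-derivation x y z = begin
    ⁅ ⁅ x , y ⁆ , z ⁆           ≈⟨ ⁅⁆-antisym _ _ ⟩
    -ᴹ ⁅ z , ⁅ x , y ⁆ ⁆        ≈⟨ -ᴹ-unique _ _ (⁅⁆-jacobi x y z) ⟨
    ⁅ x , ⁅ y , z ⁆ ⁆ +ᴹ ⁅ y , ⁅ z , x ⁆ ⁆
      ≈⟨ +ᴹ-congˡ (≈ᴹ-trans (⁅⁆-cong ≈ᴹ-refl (⁅⁆-antisym z x)) (IsLinear.neg-homo (⁅⁆-linearʳ y) _)) ⟩
    ⁅ x , ⁅ y , z ⁆ ⁆ +ᴹ -ᴹ ⁅ y , ⁅ x , z ⁆ ⁆ ∎
    where open SetoidReasoning ≈ᴹ-setoid

  -- `IsBasis` gives `coordinate` as a bare function; that it respects `≈ᴹ` and is linear is deduced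
  -- from this uniqueness in `coordinate-linear`.
  coordinate-unique : ∀ {x} (a : Fin n → Carrier) → x ≈ᴹ ΣM.∑ (λ i → a i *ₗ e i) → ∀ i → coordinate x i ≈ a i
  coordinate-unique {x} a x≈ i = R.trans (neg-unique _ _ (independent (λ j → coordinate x j + - a j) zero-sum i))
    (neg-involutive _)
    where
    open SetoidReasoning ≈ᴹ-setoid
    zero-sum : ΣM.∑ (λ j → (coordinate x j + - a j) *ₗ e j) ≈ᴹ 0ᴹ
    zero-sum = begin
      ΣM.∑ (λ j → (coordinate x j + - a j) *ₗ e j)
        ≈⟨ ΣM.∑-cong (λ j → ≈ᴹ-trans (*ₗ-distribʳ _ _ _) (+ᴹ-congˡ (*ₗ-congʳ (R.sym (RingProperties.-1*x≈-x R.ring _))))) ⟩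
      ΣM.∑ (λ j → coordinate x j *ₗ e j +ᴹ (- 1# * a j) *ₗ e j)
        ≈⟨ ΣM.∑-∙ _ _ ⟩
      ΣM.∑ (λ j → coordinate x j *ₗ e j) +ᴹ ΣM.∑ (λ j → (- 1# * a j) *ₗ e j)
        ≈⟨ +ᴹ-cong (≈ᴹ-trans (≈ᴹ-sym (spanning x)) (≈ᴹ-trans x≈ (ΣM.∑-cong (λ j → *ₗ-congʳ (R.sym (R.*-identityˡ _))))))
                   ≈ᴹ-refl ⟩
      ΣM.∑ (λ j → (1# * a j) *ₗ e j) +ᴹ ΣM.∑ (λ j → (- 1# * a j) *ₗ e j)
        ≈⟨ ΣM.∑-∙ _ _ ⟨
      ΣM.∑ (λ j → (1# * a j) *ₗ e j +ᴹ (- 1# * a j) *ₗ e j)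
        ≈⟨ ΣM.∑-cong (λ j → ≈ᴹ-trans (≈ᴹ-sym (*ₗ-distribʳ _ _ _))
             (≈ᴹ-trans (*ₗ-congʳ (R.trans (R.sym (R.distribʳ _ _ _)) (R.trans (R.*-congʳ (R.-‿inverseʳ 1#)) (R.zeroˡ _))))
                       (*ₗ-zeroˡ _))) ⟩
      ΣM.∑ (λ j → 0ᴹ)
        ≈⟨ ΣM.∑-ε ⟩
      0ᴹ ∎

  coordinate-linear : ∀ i → IsLinear {R = R} leftModule R-module (λ x → coordinate x i)
  coordinate-linear i = record
    { resp   = λ {x} {y} x≈y → coordinate-unique (coordinate y) (≈ᴹ-trans x≈y (spanning y)) i
    ; +-homo = λ x y → coordinate-unique _ (≈ᴹ-trans (+ᴹ-cong (spanning x) (spanning y))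
        (≈ᴹ-trans (≈ᴹ-sym (ΣM.∑-∙ _ _)) (ΣM.∑-cong (λ j → ≈ᴹ-sym (*ₗ-distribʳ _ _ _))))) i
    ; *-homo = λ a x → coordinate-unique _ (≈ᴹ-trans (*ₗ-congˡ (spanning x))
        (≈ᴹ-trans (IsLinear.sum-homo (scaling a) (coordinate x) e) (ΣM.∑-cong (λ j →
          ≈ᴹ-trans (≈ᴹ-sym (*ₗ-assoc _ _ _)) (*ₗ-congʳ (R.*-comm _ _)))))) i
    }
    where
    scaling : ∀ a → IsLinear {R = R} leftModule leftModule (a *ₗ_)
    scaling a = record
      { resp = *ₗ-congˡ ; +-homo = *ₗ-distribˡ a
      ; *-homo = λ b x → ≈ᴹ-trans (≈ᴹ-sym (*ₗ-assoc _ _ _)) (≈ᴹ-trans (*ₗ-congʳ (R.*-comm _ _)) (*ₗ-assoc _ _ _)) }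

  _∘ˡ_ : ∀ {k ℓk} {N : LeftModule R.ring k ℓk} {g : Carrierᴹ → LeftModule.Carrierᴹ N} {f : Carrierᴹ → Carrierᴹ} →
    IsLinear {R = R} leftModule N g → IsLinear {R = R} leftModule leftModule f → IsLinear {R = R} leftModule N (g ∘ f)
  _∘ˡ_ {N = N} G F = record
    { resp   = G.resp ∘ F.resp
    ; +-homo = λ x y → N.≈ᴹ-trans (G.resp (F.+-homo x y)) (G.+-homo _ _)
    ; *-homo = λ a x → N.≈ᴹ-trans (G.resp (F.*-homo a x)) (G.*-homo _ _) }
    where
    module N = LeftModule N
    module G = IsLinear G
    module F = IsLinear F

  module _ {k ℓk} {N : LeftModule R.ring k ℓk} where

    private
      module N = LeftModule N
      module ΣN = FixedSum N.+ᴹ-commutativeMonoid n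

    expand : ∀ {f} → IsLinear {R = R} leftModule N f → ∀ x → f x N.≈ᴹ ΣN.∑ (λ i → coordinate x i N.*ₗ f (e i))
    expand F x = N.≈ᴹ-trans (IsLinear.resp F (spanning x)) (IsLinear.sum-homo F (coordinate x) e)

    ∑-linear : ∀ {f : Fin n → Carrierᴹ → N.Carrierᴹ} → (∀ i → IsLinear {R = R} leftModule N (f i)) →
      IsLinear {R = R} leftModule N (λ x → ΣN.∑ (λ i → f i x))
    ∑-linear {f} F = record
      { resp   = λ p → ΣN.∑-cong (λ i → IsLinear.resp (F i) p)
      ; +-homo = λ x y → N.≈ᴹ-trans (ΣN.∑-cong (λ i → IsLinear.+-homo (F i) x y)) (ΣN.∑-∙ _ _)
      ; *-homo = λ a x → N.≈ᴹ-trans (ΣN.∑-cong (λ i → IsLinear.*-homo (F i) a x)) (N.≈ᴹ-sym (scale-∑ a (λ i → f i x))) }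
      where
      scale-∑ : ∀ {k} a (g : Fin k → N.Carrierᴹ) →
        a N.*ₗ Sum.sum N.+ᴹ-commutativeMonoid g N.≈ᴹ Sum.sum N.+ᴹ-commutativeMonoid (λ i → a N.*ₗ g i)
      scale-∑ {zero}  a g = N.*ₗ-zeroʳ a
      scale-∑ {suc k} a g = N.≈ᴹ-trans (N.*ₗ-distribˡ a _ _) (N.+ᴹ-congˡ (scale-∑ a (g ∘ suc)))

  *-linear : ∀ a {f} → IsLinear {R = R} leftModule R-module f → IsLinear {R = R} leftModule R-module (λ x → a * f x)
  *-linear a F = record
    { resp   = λ p → R.*-congˡ (F.resp p)
    ; +-homo = λ x y → R.trans (R.*-congˡ (F.+-homo x y)) (R.distribˡ a _ _)
    ; *-homo = λ b x → R.trans (R.*-congˡ (F.*-homo b x)) (R.trans (R.sym (R.*-assoc _ _ _))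
        (R.trans (R.*-congʳ (R.*-comm a b)) (R.*-assoc _ _ _))) }
    where module F = IsLinear F

  Endo : (Carrierᴹ → Carrierᴹ) → Set _
  Endo = IsLinear {R = R} leftModule leftModule

  tr : (Carrierᴹ → Carrierᴹ) → Carrier
  tr = trace 𝔤 basis

  tr-cong : ∀ {f g} → (∀ z → f z ≈ᴹ g z) → tr f ≈ tr g
  tr-cong p = ΣR.∑-cong (λ i → IsLinear.resp (coordinate-linear i) (p (e i)))

  tr-comm : ∀ {f g} → Endo f → Endo g → tr (f ∘ g) ≈ tr (g ∘ f)
  tr-comm {f} {g} F G = begin
    tr (f ∘ g)                                                          ≈⟨ product-trace {f} {g} F ⟩
    ΣR.∑ (λ i → ΣR.∑ (λ j → coordinate (g (e i)) j * coordinate (f (e j)) i))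
      ≈⟨ ΣR.∑-comm _ ⟩
    ΣR.∑ (λ j → ΣR.∑ (λ i → coordinate (g (e i)) j * coordinate (f (e j)) i))
      ≈⟨ ΣR.∑-cong (λ j → ΣR.∑-cong (λ i → R.*-comm _ _)) ⟩
    ΣR.∑ (λ j → ΣR.∑ (λ i → coordinate (f (e j)) i * coordinate (g (e i)) j))
      ≈⟨ product-trace {g} {f} G ⟨
    tr (g ∘ f) ∎
    where
    open SetoidReasoning R.setoid
    product-trace : ∀ {f g} → Endo f →
      tr (f ∘ g) ≈ ΣR.∑ (λ i → ΣR.∑ (λ j → coordinate (g (e i)) j * coordinate (f (e j)) i))
    product-trace F = ΣR.∑-cong (λ i → expand {N = R-module} (_∘ˡ_ {N = R-module} (coordinate-linear i) F) _)

  tr-minus : ∀ f g → tr (λ z → f z +ᴹ -ᴹ g z) ≈ tr f + - tr g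
  tr-minus f g = begin
    tr (λ z → f z +ᴹ -ᴹ g z)
      ≈⟨ ΣR.∑-cong (λ i → R.trans (IsLinear.+-homo (coordinate-linear i) _ _)
                                  (R.+-congˡ (IsLinear.neg-homo (coordinate-linear i) _))) ⟩
    ΣR.∑ (λ i → coordinate (f (e i)) i + - coordinate (g (e i)) i)  ≈⟨ ΣR.∑-∙ _ _ ⟩
    tr f + ΣR.∑ (λ i → - coordinate (g (e i)) i)
      ≈⟨ R.+-congˡ (neg-unique _ _ (R.trans (R.sym (ΣR.∑-∙ _ _))
           (R.trans (ΣR.∑-cong (λ i → R.-‿inverseˡ _)) ΣR.∑-ε))) ⟩
    tr f + - tr g ∎
    where open SetoidReasoning R.setoid

  ad : ∀ x → Endo (λ z → ⁅ x , z ⁆)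
  ad = ⁅⁆-linearʳ

  ⟨_,_⟩ : Carrierᴹ → Carrierᴹ → Carrier
  ⟨ x , y ⟩ = lam * killing 𝔤 basis x y

  ⟨⟩-sym : ∀ x y → ⟨ x , y ⟩ ≈ ⟨ y , x ⟩
  ⟨⟩-sym x y = R.*-congˡ (tr-comm (ad x) (ad y))

  ⟨⟩-linearˡ : ∀ y → IsLinear {R = R} leftModule R-module (λ x → ⟨ x , y ⟩)
  ⟨⟩-linearˡ y = *-linear lam (∑-linear {N = R-module} (λ i → _∘ˡ_ {N = R-module} (coordinate-linear i) (⁅⁆-linearˡ _)))

  ⟨⟩-linearʳ : ∀ x → IsLinear {R = R} leftModule R-module (λ y → ⟨ x , y ⟩)
  ⟨⟩-linearʳ x = record
    { resp   = λ {y} {y′} p → R.trans (⟨⟩-sym x y) (R.trans (IsLinear.resp (⟨⟩-linearˡ x) p) (⟨⟩-sym y′ x))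
    ; +-homo = λ y y′ → R.trans (⟨⟩-sym x _) (R.trans (IsLinear.+-homo (⟨⟩-linearˡ x) y y′) (R.+-cong (⟨⟩-sym y x) (⟨⟩-sym y′ x)))
    ; *-homo = λ a y → R.trans (⟨⟩-sym x _) (R.trans (IsLinear.*-homo (⟨⟩-linearˡ x) a y) (R.*-congˡ (⟨⟩-sym y x))) }

  -- In terms of `ad` this compares tr([ad x, ad y] ad z) with tr(ad x [ad y, ad z]). Their first
  -- terms agree, and their second terms differ by moving `ad y` cyclically under the trace.
  ⟨⟩-invariant : ∀ x y z → ⟨ ⁅ x , y ⁆ , z ⟩ ≈ ⟨ x , ⁅ y , z ⁆ ⟩
  ⟨⟩-invariant x y z = R.*-congˡ (begin
    tr (λ u → ⁅ ⁅ x , y ⁆ , ⁅ z , u ⁆ ⁆)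
      ≈⟨ tr-cong (λ u → ⁅⁆-derivation x y ⁅ z , u ⁆) ⟩
    tr (λ u → ⁅ x , ⁅ y , ⁅ z , u ⁆ ⁆ ⁆ +ᴹ -ᴹ ⁅ y , ⁅ x , ⁅ z , u ⁆ ⁆ ⁆)
      ≈⟨ tr-minus (λ u → ⁅ x , ⁅ y , ⁅ z , u ⁆ ⁆ ⁆) (λ u → ⁅ y , ⁅ x , ⁅ z , u ⁆ ⁆ ⁆) ⟩
    tr (λ u → ⁅ x , ⁅ y , ⁅ z , u ⁆ ⁆ ⁆) + - tr (λ u → ⁅ y , ⁅ x , ⁅ z , u ⁆ ⁆ ⁆)
      ≈⟨ R.+-congˡ (R.-‿cong (tr-comm (ad y) (_∘ˡ_ {N = leftModule} (ad x) (ad z)))) ⟩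
    tr (λ u → ⁅ x , ⁅ y , ⁅ z , u ⁆ ⁆ ⁆) + - tr (λ u → ⁅ x , ⁅ z , ⁅ y , u ⁆ ⁆ ⁆)
      ≈⟨ tr-minus (λ u → ⁅ x , ⁅ y , ⁅ z , u ⁆ ⁆ ⁆) (λ u → ⁅ x , ⁅ z , ⁅ y , u ⁆ ⁆ ⁆) ⟨
    tr (λ u → ⁅ x , ⁅ y , ⁅ z , u ⁆ ⁆ ⁆ +ᴹ -ᴹ ⁅ x , ⁅ z , ⁅ y , u ⁆ ⁆ ⁆)
      ≈⟨ tr-cong (λ u → ≈ᴹ-trans (⁅⁆-cong ≈ᴹ-refl (⁅⁆-derivation y z u))
           (≈ᴹ-trans (⁅⁆-+ʳ x _ _) (+ᴹ-congˡ (IsLinear.neg-homo (ad x) _)))) ⟨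
    tr (λ u → ⁅ x , ⁅ ⁅ y , z ⁆ , u ⁆ ⁆) ∎)
    where open SetoidReasoning R.setoid

  ∑-δ : ∀ {k} (a : Fin k → Carrier) j →
    Sum.sum R.+-commutativeMonoid (λ i → a i * (if does (i Fin.≟ j) then 1# else 0#)) ≈ a j
  ∑-δ {suc k} a zero    = R.trans (R.+-cong (R.*-identityʳ _)
      (R.trans (FixedSum.∑-cong R.+-commutativeMonoid k (λ i → R.zeroʳ (a (suc i)))) (FixedSum.∑-ε R.+-commutativeMonoid k)))
    (R.+-identityʳ _)
  ∑-δ {suc k} a (suc j) = R.trans (R.+-cong (R.zeroʳ _) (∑-δ (a ∘ suc) j)) (R.+-identityˡ _)

  coordinate-dual : ∀ x j → coordinate x j ≈ ⟨ x , e* j ⟩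
  coordinate-dual x j = R.sym (begin
    ⟨ x , e* j ⟩                                     ≈⟨ expand {N = R-module} (⟨⟩-linearˡ (e* j)) x ⟩
    ΣR.∑ (λ i → coordinate x i * ⟨ e i , e* j ⟩)     ≈⟨ ΣR.∑-cong (λ i → R.*-congˡ (dual i j)) ⟩
    ΣR.∑ (λ i → coordinate x i * (if does (i Fin.≟ j) then 1# else 0#)) ≈⟨ ∑-δ (coordinate x) j ⟩
    coordinate x j ∎)
    where open SetoidReasoning R.setoid

  -- The coordinates of an element are its pairings with the `e* j`, and each `e* j` is in turn a
  -- combination of the `e i`.
  nondegenerate : ∀ {x y} → (∀ i → ⟨ e i , x ⟩ ≈ ⟨ e i , y ⟩) → x ≈ᴹ y
  nondegenerate {x} {y} p = begin
    x                                     ≈⟨ spanning x ⟩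
    ΣM.∑ (λ j → coordinate x j *ₗ e j)    ≈⟨ ΣM.∑-cong (λ j → *ₗ-congʳ (same j)) ⟩
    ΣM.∑ (λ j → coordinate y j *ₗ e j)    ≈⟨ spanning y ⟨
    y ∎
    where
    open SetoidReasoning ≈ᴹ-setoid
    by-e : ∀ z j → coordinate z j ≈ ΣR.∑ (λ i → coordinate (e* j) i * ⟨ e i , z ⟩)
    by-e z j = R.trans (coordinate-dual z j) (R.trans (⟨⟩-sym z (e* j)) (expand {N = R-module} (⟨⟩-linearˡ z) (e* j)))
    same : ∀ j → coordinate x j ≈ coordinate y j
    same j = R.trans (by-e x j) (R.trans (ΣR.∑-cong (λ i → R.*-congˡ (p i))) (R.sym (by-e y j)))

  expand* : ∀ x → x ≈ᴹ ΣM.∑ (λ i → ⟨ e i , x ⟩ *ₗ e* i)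
  expand* x = nondegenerate (λ j → R.sym (begin
    ⟨ e j , ΣM.∑ (λ i → ⟨ e i , x ⟩ *ₗ e* i) ⟩        ≈⟨ IsLinear.sum-homo (⟨⟩-linearʳ (e j)) (λ i → ⟨ e i , x ⟩) e* ⟩
    ΣR.∑ (λ i → ⟨ e i , x ⟩ * ⟨ e j , e* i ⟩)         ≈⟨ ΣR.∑-cong (λ i → R.*-congˡ (R.trans (dual j i) (δ-sym j i))) ⟩
    ΣR.∑ (λ i → ⟨ e i , x ⟩ * (if does (i Fin.≟ j) then 1# else 0#)) ≈⟨ ∑-δ (λ i → ⟨ e i , x ⟩) j ⟩
    ⟨ e j , x ⟩ ∎))
    where
    open SetoidReasoning R.setoid
    δ-sym : ∀ j i → (if does (j Fin.≟ i) then 1# else 0#) ≈ (if does (i Fin.≟ j) then 1# else 0#)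
    δ-sym j i with j Fin.≟ i | i Fin.≟ j
    ... | yes _ | yes _ = R.refl
    ... | no _  | no _  = R.refl
    ... | yes p | no q  with () ← q (≡.sym p)
    ... | no p  | yes q with () ← p (≡.sym q)

  -- An arbitrary bilinear `T` stands in for the tensor product: symmetry and ad-invariance of the
  -- Casimir tensor Σ eᵢ ⊗ eᵢ* are stated after applying `T`.
  module Tensor {k ℓk} {N : LeftModule R.ring k ℓk} {T : Carrierᴹ → Carrierᴹ → LeftModule.Carrierᴹ N}
    (linearˡ : ∀ y → IsLinear {R = R} leftModule N (λ x → T x y))
    (linearʳ : ∀ x → IsLinear {R = R} leftModule N (T x)) where

    private module N = LeftModule N
    module ΣN = FixedSum N.+ᴹ-commutativeMonoid n

    symmetric : ΣN.∑ (λ i → T (e i) (e* i)) N.≈ᴹ ΣN.∑ (λ i → T (e* i) (e i))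
    symmetric = begin
      ΣN.∑ (λ i → T (e i) (e* i))
        ≈⟨ ΣN.∑-cong (λ i → expand {N = N} (linearʳ (e i)) (e* i)) ⟩
      ΣN.∑ (λ i → ΣN.∑ (λ j → coordinate (e* i) j N.*ₗ T (e i) (e j)))
        ≈⟨ ΣN.∑-comm _ ⟩
      ΣN.∑ (λ j → ΣN.∑ (λ i → coordinate (e* i) j N.*ₗ T (e i) (e j)))
        ≈⟨ ΣN.∑-cong (λ j → ΣN.∑-cong (λ i → N.*ₗ-congʳ (gram-symmetric i j))) ⟩
      ΣN.∑ (λ j → ΣN.∑ (λ i → coordinate (e* j) i N.*ₗ T (e i) (e j)))
        ≈⟨ ΣN.∑-cong (λ j → expand {N = N} (linearˡ (e j)) (e* j)) ⟨
      ΣN.∑ (λ j → T (e* j) (e j)) ∎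
      where
      open SetoidReasoning N.≈ᴹ-setoid
      gram-symmetric : ∀ i j → coordinate (e* i) j ≈ coordinate (e* j) i
      gram-symmetric i j = R.trans (coordinate-dual _ _) (R.trans (⟨⟩-sym _ _) (R.sym (coordinate-dual _ _)))

    -- On both sides T eⱼ eᵢ* has the coefficient ⟨ eᵢ , ⁅ x , eⱼ* ⁆ ⟩: by invariance of the form it
    -- is the j-th coordinate of ⁅ eᵢ , x ⁆ with respect to `e`, and by `expand*` the i-th
    -- coordinate of ⁅ x , eⱼ* ⁆ with respect to `e*`.
    invariant : ∀ x → ΣN.∑ (λ i → T ⁅ e i , x ⁆ (e* i)) N.≈ᴹ ΣN.∑ (λ i → T (e i) ⁅ x , e* i ⁆)
    invariant x = begin
      ΣN.∑ (λ i → T ⁅ e i , x ⁆ (e* i))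
        ≈⟨ ΣN.∑-cong (λ i → expand {N = N} (linearˡ (e* i)) _) ⟩
      ΣN.∑ (λ i → ΣN.∑ (λ j → coordinate ⁅ e i , x ⁆ j N.*ₗ T (e j) (e* i)))
        ≈⟨ ΣN.∑-comm _ ⟩
      ΣN.∑ (λ j → ΣN.∑ (λ i → coordinate ⁅ e i , x ⁆ j N.*ₗ T (e j) (e* i)))
        ≈⟨ ΣN.∑-cong (λ j → ΣN.∑-cong (λ i → N.*ₗ-congʳ (R.trans (coordinate-dual _ _) (⟨⟩-invariant _ _ _)))) ⟩
      ΣN.∑ (λ j → ΣN.∑ (λ i → ⟨ e i , ⁅ x , e* j ⁆ ⟩ N.*ₗ T (e j) (e* i)))
        ≈⟨ ΣN.∑-cong (λ j → N.≈ᴹ-trans (IsLinear.resp (linearʳ (e j)) (expand* _))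
             (IsLinear.sum-homo (linearʳ (e j)) (λ i → ⟨ e i , ⁅ x , e* j ⁆ ⟩) e*)) ⟨
      ΣN.∑ (λ j → T (e j) ⁅ x , e* j ⁆) ∎
      where open SetoidReasoning N.≈ᴹ-setoid

  casimir : Carrierᴹ → Carrierᴹ
  casimir x = ΣM.∑ (λ i → ⁅ e i , ⁅ e* i , x ⁆ ⁆)

  -- Both sides, paired with y, are λ times traces of ad y ad x.
  casimir-eigenvalue : ∀ x → lam *ₗ casimir x ≈ᴹ x
  casimir-eigenvalue x = nondegenerate (λ k → pairing (e k))
    where
    open SetoidReasoning R.setoid
    module P y = Tensor {N = R-module} {T = λ a b → ⟨ ⁅ y , a ⁆ , ⁅ b , x ⁆ ⟩}
      (λ b → _∘ˡ_ {N = R-module} (⟨⟩-linearˡ _) (ad y))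
      (λ a → _∘ˡ_ {N = R-module} (⟨⟩-linearʳ _) (⁅⁆-linearˡ x))
    pairing : ∀ y → ⟨ y , lam *ₗ casimir x ⟩ ≈ ⟨ y , x ⟩
    pairing y = begin
      ⟨ y , lam *ₗ casimir x ⟩
        ≈⟨ IsLinear.*-homo (⟨⟩-linearʳ y) lam _ ⟩
      lam * ⟨ y , casimir x ⟩
        ≈⟨ R.*-congˡ (R.trans (IsLinear.resp (⟨⟩-linearʳ y) (ΣM.∑-cong (λ i → ≈ᴹ-sym (*ₗ-identityˡ _))))
             (IsLinear.sum-homo (⟨⟩-linearʳ y) (λ _ → 1#) (λ i → ⁅ e i , ⁅ e* i , x ⁆ ⁆))) ⟩
      lam * ΣR.∑ (λ i → 1# * ⟨ y , ⁅ e i , ⁅ e* i , x ⁆ ⁆ ⟩)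
        ≈⟨ R.*-congˡ (ΣR.∑-cong (λ i → R.trans (R.*-identityˡ _) (R.sym (⟨⟩-invariant _ _ _)))) ⟩
      lam * ΣR.∑ (λ i → ⟨ ⁅ y , e i ⁆ , ⁅ e* i , x ⁆ ⟩)
        -- Exchanging `e` and `e*` lets `turn` leave `e* i` alone in one slot, where pairing with it
        -- reads off the i-th coordinate, as a trace requires.
        ≈⟨ R.*-congˡ (P.symmetric y) ⟩
      lam * ΣR.∑ (λ i → ⟨ ⁅ y , e* i ⁆ , ⁅ e i , x ⁆ ⟩)
        ≈⟨ R.*-congˡ (ΣR.∑-cong (λ i → turn (e i) (e* i))) ⟩
      lam * ΣR.∑ (λ i → ⟨ ⁅ y , ⁅ x , e i ⁆ ⁆ , e* i ⟩)
        ≈⟨ R.*-congˡ (ΣR.∑-cong (λ i → R.sym (coordinate-dual _ _))) ⟩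
      ⟨ y , x ⟩ ∎
      where
      turn : ∀ a b → ⟨ ⁅ y , b ⁆ , ⁅ a , x ⁆ ⟩ ≈ ⟨ ⁅ y , ⁅ x , a ⁆ ⁆ , b ⟩
      turn a b = begin
        ⟨ ⁅ y , b ⁆ , ⁅ a , x ⁆ ⟩       ≈⟨ ⟨⟩-sym _ _ ⟩
        ⟨ ⁅ a , x ⁆ , ⁅ y , b ⁆ ⟩       ≈⟨ ⟨⟩-invariant _ _ _ ⟨
        ⟨ ⁅ ⁅ a , x ⁆ , y ⁆ , b ⟩
          ≈⟨ IsLinear.resp (⟨⟩-linearˡ b) (≈ᴹ-trans (⁅⁆-antisym _ _)
               (≈ᴹ-trans (≈ᴹ-sym (IsLinear.neg-homo (ad y) _)) (⁅⁆-cong ≈ᴹ-refl (≈ᴹ-sym (⁅⁆-antisym x a))))) ⟩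
        ⟨ ⁅ y , ⁅ x , a ⁆ ⁆ , b ⟩ ∎

-- Averaging over the Casimir tensor in the enveloping algebra

module Sandwich {c ℓ m ℓm} {R : CommutativeRing c ℓ} (𝔤 : LieAlgebra R m ℓm)
  {n} (e e* : Fin n → LieAlgebra.Carrierᴹ 𝔤) (basis : IsBasis 𝔤 e)
  (lam : CommutativeRing.Carrier R)
  (dual : IsDual 𝔤 (λ x y → CommutativeRing._*_ R lam (killing 𝔤 basis x y)) e e*)
  (lam⁻¹ half : CommutativeRing.Carrier R)
  (lam-inverse : CommutativeRing._≈_ R (CommutativeRing._*_ R lam⁻¹ lam) (CommutativeRing.1# R))
  (half-double : CommutativeRing._≈_ R (CommutativeRing._+_ R half half) (CommutativeRing.1# R)) where

  open Casimir 𝔤 e e* basis lam dual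
  private module G = LieAlgebra 𝔤
  open LieAlgebra 𝔤 using (Carrierᴹ; ⁅_,_⁆)
  open Ring (U-ring 𝔤) renaming (Carrier to 𝕌)
  open RingProperties (U-ring 𝔤) using (-‿distribˡ-*; -‿distribʳ-*)
  open AbelianGroupProperties +-abelianGroup using () renaming (⁻¹-∙-comm to neg-+)
  module ΣU = FixedSum +-commutativeMonoid n
  open SetoidReasoning setoid

  -- The adjoint Casimir eigenvalue is 1/λ, but the correction `q` in the averaging is only half of
  -- it; see `q-double`.
  h : R.Carrier
  h = half R.* lam⁻¹

  h-double : h R.+ h R.≈ lam⁻¹
  h-double = R.trans (R.sym (R.distribʳ _ _ _)) (R.trans (R.*-congʳ half-double) (R.*-identityˡ _))

  Ω : 𝕌
  Ω = ΣU.∑ (λ i → ι (e i) * ι (e* i))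

  ∑-*ˡ : ∀ u (f : Fin n → 𝕌) → u * ΣU.∑ f ≈ ΣU.∑ (λ i → u * f i)
  ∑-*ˡ = SemiringSum.*-distribˡ-sum semiring

  ∑-*ʳ : ∀ u (f : Fin n → 𝕌) → ΣU.∑ f * u ≈ ΣU.∑ (λ i → f i * u)
  ∑-*ʳ = SemiringSum.*-distribʳ-sum semiring

  Linearᵁ : (Carrierᴹ → 𝕌) → Set _
  Linearᵁ = IsLinear {R = R} G.leftModule (U-leftModule 𝔤)

  ι-linear : Linearᵁ ι
  ι-linear = record { resp = ι-cong ; +-homo = ι-+ ; *-homo = ι-* }

  *-linearˡ : ∀ u {f} → Linearᵁ f → Linearᵁ (λ x → u * f x)
  *-linearˡ u F = record
    { resp   = λ p → *-congˡ (F.resp p)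
    ; +-homo = λ x y → trans (*-congˡ (F.+-homo x y)) (distribˡ _ _ _)
    ; *-homo = λ a x → trans (*-congˡ (F.*-homo a x)) (trans (sym (*-assoc _ _ _))
        (trans (*-congʳ (sym (scalar-comm a u))) (*-assoc _ _ _))) }
    where module F = IsLinear F

  *-linearʳ : ∀ u {f} → Linearᵁ f → Linearᵁ (λ x → f x * u)
  *-linearʳ u F = record
    { resp   = λ p → *-congʳ (F.resp p)
    ; +-homo = λ x y → trans (*-congʳ (F.+-homo x y)) (distribʳ _ _ _)
    ; *-homo = λ a x → trans (*-congʳ (F.*-homo a x)) (*-assoc _ _ _) }
    where module F = IsLinear F

  halving : ∀ {u v} → u + u ≈ v + v → u ≈ v
  halving {u} {v} p = trans (sym (halve u)) (trans (*-congˡ p) (halve v))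
    where
    halve : ∀ u → scalar half * (u + u) ≈ u
    halve u = begin
      scalar half * (u + u)                   ≈⟨ distribˡ _ _ _ ⟩
      scalar half * u + scalar half * u       ≈⟨ distribʳ _ _ _ ⟨
      (scalar half + scalar half) * u         ≈⟨ *-congʳ (trans (sym (scalar-+ half half)) (scalar-cong half-double)) ⟩
      1# * u                                  ≈⟨ *-identityˡ u ⟩
      u ∎

  ι-swap : ∀ x y → ι x * ι y ≈ ι y * ι x + ι ⁅ x , y ⁆
  ι-swap x y = begin
    ι x * ι y                                       ≈⟨ +-identityʳ _ ⟨
    ι x * ι y + 0#                                  ≈⟨ +-congˡ (-‿inverseˡ _) ⟨
    ι x * ι y + (- (ι y * ι x) + ι y * ι x)         ≈⟨ +-assoc _ _ _ ⟨
    (ι x * ι y - ι y * ι x) + ι y * ι x             ≈⟨ +-congʳ (sym (ι-⁅⁆ x y)) ⟩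
    ι ⁅ x , y ⁆ + ι y * ι x                         ≈⟨ +-comm _ _ ⟩
    ι y * ι x + ι ⁅ x , y ⁆ ∎

  ι-casimir : ∀ x → ι (casimir x) ≈ scalar lam⁻¹ * ι x
  ι-casimir x = trans (ι-cong (G.≈ᴹ-trans (G.≈ᴹ-sym (G.*ₗ-identityˡ _)) (G.≈ᴹ-trans (G.*ₗ-congʳ (R.sym lam-inverse))
    (G.≈ᴹ-trans (G.*ₗ-assoc _ _ _) (G.*ₗ-congˡ (casimir-eigenvalue x)))))) (ι-* _ _)

  module _ (x : Carrierᴹ) where

    private
      q = ΣU.∑ (λ i → ι (e i) * ι ⁅ x , e* i ⁆)

      module T = Tensor {N = U-leftModule 𝔤} {T = λ a b → ι a * ι b}
        (λ b → *-linearʳ (ι b) ι-linear) (λ a → *-linearˡ (ι a) ι-linear)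
      module T′ = Tensor {N = U-leftModule 𝔤} {T = λ a b → ι ⁅ a , x ⁆ * ι b}
        (λ b → _∘ˡ_ {N = U-leftModule 𝔤} (*-linearʳ (ι b) ι-linear) (⁅⁆-linearˡ x))
        (λ a → *-linearˡ (ι ⁅ a , x ⁆) ι-linear)

      commutator : ∀ a b → ι a * ι ⁅ x , b ⁆ + ι ⁅ b , x ⁆ * ι a ≈ - ι ⁅ a , ⁅ b , x ⁆ ⁆
      commutator a b = begin
        ι a * ι ⁅ x , b ⁆ + ι z * ι a
          ≈⟨ +-congʳ (*-congˡ (trans (ι-cong (⁅⁆-antisym x b)) (IsLinear.neg-homo ι-linear z))) ⟩
        ι a * - ι z + ι z * ι a              ≈⟨ +-congʳ (sym (-‿distribʳ-* _ _)) ⟩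
        - (ι a * ι z) + ι z * ι a            ≈⟨ +-comm _ _ ⟩
        ι z * ι a - ι a * ι z                ≈⟨ ι-⁅⁆ z a ⟨
        ι ⁅ z , a ⁆                          ≈⟨ ι-cong (⁅⁆-antisym z a) ⟩
        ι (G.-ᴹ ⁅ a , z ⁆)                   ≈⟨ IsLinear.neg-homo ι-linear _ ⟩
        - ι ⁅ a , z ⁆ ∎
        where z = ⁅ b , x ⁆

      -- A single term of `q` is a product, not a commutator. By invariance and symmetry of the
      -- tensor, `q` is also Σ ι ⁅ eᵢ* , x ⁆ ι eᵢ; adding the two forms makes every term a
      -- commutator, and the sum becomes the image of -`casimir x`.
      q-double : q + q ≈ - (scalar lam⁻¹ * ι x)
      q-double = begin
        q + q
          ≈⟨ +-congˡ (trans (sym (T.invariant x)) T′.symmetric) ⟩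
        q + ΣU.∑ (λ i → ι ⁅ e* i , x ⁆ * ι (e i))
          ≈⟨ ΣU.∑-∙ _ _ ⟨
        ΣU.∑ (λ i → ι (e i) * ι ⁅ x , e* i ⁆ + ι ⁅ e* i , x ⁆ * ι (e i))
          ≈⟨ ΣU.∑-cong (λ i → commutator (e i) (e* i)) ⟩
        ΣU.∑ (λ i → - ι ⁅ e i , ⁅ e* i , x ⁆ ⁆)
          ≈⟨ ∑-*ˡ (scalar (R.- R.1#)) (λ i → ι ⁅ e i , ⁅ e* i , x ⁆ ⁆) ⟨
        - ΣU.∑ (λ i → ι ⁅ e i , ⁅ e* i , x ⁆ ⁆)
          ≈⟨ -‿cong (ΣU.∑-cong (λ i → sym (trans (*-congʳ {ι ⁅ e i , ⁅ e* i , x ⁆ ⁆} {scalar R.1#} {1#} refl) (*-identityˡ _)))) ⟩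
        - ΣU.∑ (λ i → scalar R.1# * ι ⁅ e i , ⁅ e* i , x ⁆ ⁆)
          ≈⟨ -‿cong (trans (sym (IsLinear.sum-homo ι-linear (λ _ → R.1#) (λ i → ⁅ e i , ⁅ e* i , x ⁆ ⁆)))
               (ι-cong (ΣM.∑-cong (λ i → G.*ₗ-identityˡ _)))) ⟩
        - ι (casimir x)                       ≈⟨ -‿cong (ι-casimir x) ⟩
        - (scalar lam⁻¹ * ι x) ∎

      q-value : q ≈ - (scalar h * ι x)
      q-value = halving (begin
        q + q                                                   ≈⟨ q-double ⟩
        - (scalar lam⁻¹ * ι x)
          ≈⟨ -‿cong (*-congʳ (trans (scalar-cong (R.sym h-double)) (scalar-+ h h))) ⟩
        - ((scalar h + scalar h) * ι x)                         ≈⟨ -‿cong (distribʳ _ _ _) ⟩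
        - (scalar h * ι x + scalar h * ι x)                     ≈⟨ neg-+ _ _ ⟨
        - (scalar h * ι x) + - (scalar h * ι x) ∎)

    sandwich : ΣU.∑ (λ i → ι (e i) * (ι x * ι (e* i))) ≈ (Ω - scalar h) * ι x
    sandwich = begin
      ΣU.∑ (λ i → ι (e i) * (ι x * ι (e* i)))
        ≈⟨ ΣU.∑-cong (λ i → trans (*-congˡ (ι-swap x (e* i))) (trans (distribˡ _ _ _) (+-congʳ (sym (*-assoc _ _ _))))) ⟩
      ΣU.∑ (λ i → ι (e i) * ι (e* i) * ι x + ι (e i) * ι ⁅ x , e* i ⁆)
        ≈⟨ ΣU.∑-∙ _ _ ⟩
      ΣU.∑ (λ i → ι (e i) * ι (e* i) * ι x) + q
        ≈⟨ +-cong (sym (∑-*ʳ (ι x) (λ i → ι (e i) * ι (e* i)))) q-value ⟩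
      Ω * ι x - scalar h * ι x
        ≈⟨ +-congˡ (-‿distribˡ-* _ _) ⟩
      Ω * ι x + - scalar h * ι x
        ≈⟨ distribʳ _ _ _ ⟨
      (Ω - scalar h) * ι x ∎

-- Diagrams and the STU relation

module _ where

  open ≡ using (refl; sym; trans)
  open CommutativeMonoidSolver (++-commutativeMonoid {A = Edge}) using (solve; _⊕_; _⊜_)

  ↻-refl : ∀ {v} → v ↻ v
  ↻-refl {_ , _ , _} = rot₀

  ↭⇒↻ : ∀ {vs us} → vs ↭ us → Permutation _↻_ vs us
  ↭⇒↻ = Homogeneous.map (λ { refl → ↻-refl }) ∘ ↭⇒↭ₛ

  shifted : ∀ {D D′} before after → word D ≡ before ++ after → word D′ ≡ after ++ before →
    Permutation _↻_ (vertices D) (vertices D′) → D ≅ D′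
  shifted {D} {D′} before after p q r = record
    { rename        = id
    ; before        = before
    ; after         = after
    ; word-split    = p
    ; word-rotated  = trans q (sym (map-id _))
    ; same-vertices = subst (λ vs → Permutation _↻_ vs (vertices D′)) (sym (map-id _)) r }

  -- Isomorphism constrains only the word and the vertices, so the edge lists and the proofs carried
  -- by diagrams never have to be compared.
  ≅-reflexive : ∀ {D D′} → word D ≡ word D′ → vertices D ≡ vertices D′ → D ≅ D′
  ≅-reflexive {D} p q = shifted [] (word D) refl (trans (sym p) (sym (++-identityʳ _))) (↭⇒↻ (↭-reflexive q))

  halves-rotated : ∀ {v u} → v ↻ u → halves v ↭ halves u
  halves-rotated rot₀ = ↭-refl
  halves-rotated (rot₁ {x} {y} {z}) = ++-comm [ x ] (y ∷ z ∷ [])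
  halves-rotated (rot₂ {x} {y} {z}) = ++-comm (x ∷ y ∷ []) [ z ]

  concatMap-halves-↭ : ∀ {vs us} → vs ↭ us → concatMap halves vs ↭ concatMap halves us
  concatMap-halves-↭ _↭_.refl = ↭-refl
  concatMap-halves-↭ (prep v p) = ++⁺ˡ (halves v) (concatMap-halves-↭ p)
  concatMap-halves-↭ (swap v u p) =
    ↭-trans (shifts (halves v) (halves u)) (++⁺ˡ (halves u) (++⁺ˡ (halves v) (concatMap-halves-↭ p)))
  concatMap-halves-↭ (_↭_.trans p q) = ↭-trans (concatMap-halves-↭ p) (concatMap-halves-↭ q)

  -- Accounting for the two ends of an edge `e`: `E` lists all edges, `M` the ends left when those
  -- of `e` are taken away. `absent` records that there is no third end.
  record Split (e : Edge) (M E : List Edge) : Set where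
    field
      others   : List Edge
      distinct : Unique (e ∷ others)
      edges-↭  : E ↭ e ∷ others
      ends-↭   : M ↭ others ++ others
      absent   : e ∉ M

  split-ends : ∀ {e L M E} → Unique E → L ↭ E ++ E → L ↭ e ∷ e ∷ M → Split e M E
  split-ends {e} {L} {M} {E} unique ends twice
    with ys , zs , refl ← ∈-∃++ (reduce (∈-++⁻ E (∈-resp-↭ (↭-trans (↭-sym twice) ends) (here refl))))
    = record
    { others   = E′
    ; distinct = distinct
    ; edges-↭  = E↭
    ; ends-↭   = M↭
    ; absent   = λ e∈M → All.lookup (AllPairs.head distinct) (reduce (∈-++⁻ E′ (∈-resp-↭ M↭ e∈M))) refl }
    where
    E′ = ys ++ zs
    E↭ : E ↭ e ∷ E′
    E↭ = shift e ys zs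
    distinct : Unique (e ∷ E′)
    distinct = SetoidPermutation.Unique-resp-↭ (≡.setoid Edge) (↭⇒↭ₛ E↭) unique
    M↭ : M ↭ E′ ++ E′
    M↭ = drop-∷ (drop-∷ (↭-trans (↭-sym twice) (↭-trans ends (↭-trans (++⁺ E↭ E↭) (prep e (shift e E′ E′))))))

  module _ (S : Diagram) {leg x y} {left right rest}
    (word-S : word S ≡ left ++ leg ∷ right) (vertices-S : vertices S ≡ (leg , x , y) ∷ rest) where

    private
      H = concatMap halves rest

      legs : word S ++ concatMap halves (vertices S) ↭ leg ∷ leg ∷ (left ++ right ++ x ∷ y ∷ H)
      legs = ↭-trans (↭-reflexive (cong₂ (λ w vs → w ++ concatMap halves vs) word-S vertices-S))
        (solve 6 (λ A l B x y h → ((A ⊕ (l ⊕ B)) ⊕ (l ⊕ (x ⊕ (y ⊕ h)))) ⊜ (l ⊕ (l ⊕ (A ⊕ (B ⊕ (x ⊕ (y ⊕ h)))))))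
          ↭-refl left [ leg ] right [ x ] [ y ] H)

      splitting : Split leg (left ++ right ++ x ∷ y ∷ H) (edges S)
      splitting = split-ends (unique S) (twoEnds S) legs
      open Split splitting

      leg∉H : leg ∉ H
      leg∉H = absent ∘ ∈-++⁺ʳ left ∘ ∈-++⁺ʳ right ∘ there ∘ there

    -- One construction gives both T and U, according to `order`. It stays connected because a path
    -- from an edge to the loop of `S` either avoids the removed vertex or, on its first visit
    -- there, stands on `x` or `y`, which now end on the loop.
    attach : ∀ p q → p ∷ q ∷ [] ↭ x ∷ y ∷ [] → Diagram
    attach p q order .word = left ++ p ∷ q ∷ right
    attach p q order .vertices = rest
    attach p q order .edges = others
    attach p q order .unique = AllPairs.tail distinct
    attach p q order .twoEnds = ↭-trans (begin
      (left ++ p ∷ q ∷ right) ++ H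
        ↭⟨ solve 4 (λ A pq B h → ((A ⊕ (pq ⊕ B)) ⊕ h) ⊜ (pq ⊕ (A ⊕ (B ⊕ h)))) ↭-refl left (p ∷ q ∷ []) right H ⟩
      (p ∷ q ∷ []) ++ left ++ right ++ H
        ↭⟨ ++⁺ʳ _ order ⟩
      (x ∷ y ∷ []) ++ left ++ right ++ H
        ↭⟨ solve 4 (λ A xy B h → (xy ⊕ (A ⊕ (B ⊕ h))) ⊜ (A ⊕ (B ⊕ (xy ⊕ h)))) ↭-refl left (x ∷ y ∷ []) right H ⟩
      left ++ right ++ x ∷ y ∷ H ∎)
      ends-↭
      where open PermutationReasoning
    attach p q order .connected = All.tabulate λ {e} e∈ →
      reach (λ e≡leg → e≢leg e∈ (sym e≡leg)) (All.lookup (connected S) (∈-resp-↭ (↭-sym edges-↭) (there e∈)))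
      where
      e≢leg : ∀ {e} → e ∈ others → leg ≢ e
      e≢leg = All.lookup (AllPairs.head distinct)
      pq∈ : ∀ {e} → e ∈ x ∷ y ∷ [] → e ∈ left ++ p ∷ q ∷ right
      pq∈ e∈ = ∈-++⁺ʳ left (∈-++⁺ˡ (∈-resp-↭ (↭-sym order) e∈))
      kept : ∀ {e} → e ≢ leg → e ∈ left ++ leg ∷ right → e ∈ left ++ p ∷ q ∷ right
      kept e≢leg e∈ with ∈-++⁻ left e∈
      ... | inj₁ e∈left          = ∈-++⁺ˡ e∈left
      ... | inj₂ (here e≡leg)    = ⊥-elim (e≢leg e≡leg)
      ... | inj₂ (there e∈right) = ∈-++⁺ʳ left (there (there e∈right))
      at-vertex : ∀ {e} → e ≢ leg → e ∈ leg ∷ x ∷ y ∷ [] → Any (Linked rest e) (left ++ p ∷ q ∷ right)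
      at-vertex e≢leg (here e≡leg) = ⊥-elim (e≢leg e≡leg)
      at-vertex e≢leg (there e∈)   = lose (pq∈ e∈) ε
      -- Both ends of the leg are used up, on the loop and at the removed vertex, so an edge met at
      -- another vertex cannot be the leg.
      not-leg : ∀ {e} → Any (λ v → e ∈ halves v) rest → e ≢ leg
      not-leg a refl with v , v∈ , e∈ ← find a = leg∉H (∈-concatMap⁺′ v∈ e∈)
        where
        ∈-concatMap⁺′ : ∀ {v e vs} → v ∈ vs → e ∈ halves v → e ∈ concatMap halves vs
        ∈-concatMap⁺′ {v} (here refl) e∈ = ∈-++⁺ˡ e∈
        ∈-concatMap⁺′ {vs = u ∷ _} (there v∈) e∈ = ∈-++⁺ʳ (halves u) (∈-concatMap⁺′ v∈ e∈)
      walk : ∀ {e l} → e ≢ leg → Linked ((leg , x , y) ∷ rest) e l → l ∈ left ++ leg ∷ right →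
        Any (Linked rest e) (left ++ p ∷ q ∷ right)
      walk e≢ ε l∈ = lose (kept e≢ l∈) ε
      walk e≢ (fwd (here (e∈ , _)) ◅ _) l∈ = at-vertex e≢ e∈
      walk e≢ (bwd (here (_ , e∈)) ◅ _) l∈ = at-vertex e≢ e∈
      walk e≢ (fwd (there m) ◅ path) l∈ = Any.map (fwd m ◅_) (walk (not-leg (Any.map proj₂ m)) path l∈)
      walk e≢ (bwd (there m) ◅ path) l∈ = Any.map (bwd m ◅_) (walk (not-leg (Any.map proj₁ m)) path l∈)
      reach : ∀ {e} → e ≢ leg → Any (Linked (vertices S) e) (word S) → Any (Linked rest e) (left ++ p ∷ q ∷ right)
      reach e≢ a with find (subst₂ (λ vs w → Any (Linked vs _) w) vertices-S word-S a)
      ... | l , l∈ , path = walk e≢ path l∈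

  -- `STU` expects its vertex at the head of the list and its cyclic order to start at the leg; this
  -- isomorphic diagram arranges both.
  pull : ∀ D {v u rest} → vertices D ↭ v ∷ rest → v ↻ u → Diagram
  pull D {u = u} {rest} p r .word = word D
  pull D {u = u} {rest} p r .vertices = u ∷ rest
  pull D p r .edges = edges D
  pull D p r .unique = unique D
  pull D {v} {u} {rest} p r .twoEnds = ↭-trans
    (++⁺ˡ (word D) (↭-sym (↭-trans (concatMap-halves-↭ p) (++⁺ʳ (concatMap halves rest) (halves-rotated r))))) (twoEnds D)
  pull D {v} {u} {rest} p r .connected = All.map (Any.map (EqClosure.map (moved ∘ Any-resp-↭ p))) (connected D)
    where
    moved : ∀ {e e′} → Meet (v ∷ rest) e e′ → Meet (u ∷ rest) e e′
    moved (here (e∈ , e′∈)) = here (∈-resp-↭ (halves-rotated r) e∈ , ∈-resp-↭ (halves-rotated r) e′∈)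
    moved (there m) = there m

  pull-≅ : ∀ D {v u rest} (p : vertices D ↭ v ∷ rest) (r : v ↻ u) → D ≅ pull D p r
  pull-≅ D p r = shifted [] (word D) refl (sym (++-identityʳ _))
    (Homogeneous.trans (↭⇒↻ p) (Homogeneous.prep r (↭⇒↻ ↭-refl)))

  record Resolution (S : Diagram) (left right : List Edge) (x y : Edge) (rest : List Vertex) : Set where
    field
      S′ T⁺ T⁻   : Diagram
      S≅S′       : S ≅ S′
      relation   : STU S′ T⁺ T⁻
      word⁺      : word T⁺ ≡ left ++ x ∷ y ∷ right
      vertices⁺  : vertices T⁺ ≡ rest
      word⁻      : word T⁻ ≡ left ++ y ∷ x ∷ right
      vertices⁻  : vertices T⁻ ≡ rest

  resolve : ∀ S {v rest leg x y} left {right} → vertices S ↭ v ∷ rest → v ↻ (leg , x , y) →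
    word S ≡ left ++ leg ∷ right → Resolution S left right x y rest
  resolve S {leg = leg} {x} {y} left p r q = record
    { S′ = S′
    ; T⁺ = attach S′ q refl x y ↭-refl
    ; T⁻ = attach S′ q refl y x (swap y x ↭-refl)
    ; S≅S′ = pull-≅ S p r
    ; relation = record
      { leg = leg ; x = x ; y = y ; left = left ; word-S = q ; vertices-S = refl
      ; word-T = refl ; vertices-T = refl ; word-U = refl ; vertices-U = refl }
    ; word⁺ = refl ; vertices⁺ = refl ; word⁻ = refl ; vertices⁻ = refl }
    where S′ = pull S p r

  rotate : ∀ D before after → word D ≡ before ++ after → Diagram
  rotate D before after p .word      = after ++ before
  rotate D before after p .vertices  = vertices D
  rotate D before after p .edges     = edges D
  rotate D before after p .unique    = unique D
  rotate D before after p .twoEnds   =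
    ↭-trans (++⁺ʳ _ (↭-trans (++-comm after before) (↭-reflexive (sym p)))) (twoEnds D)
  rotate D before after p .connected =
    All.map (Any-resp-↭ (↭-trans (↭-reflexive p) (++-comm before after))) (connected D)

  rotate-≅ : ∀ D before after p → D ≅ rotate D before after p
  rotate-≅ D before after p = shifted before after p refl (↭⇒↻ ↭-refl)

-- Weights of diagrams

record Leg (D : Diagram) : Set where
  field
    {leg x y}   : Edge
    left right  : List Edge
    {vertex}    : Vertex
    {rest}      : List Vertex
    word-≡      : word D ≡ left ++ leg ∷ right
    vertices-↭  : vertices D ↭ vertex ∷ rest
    rotated     : vertex ↻ (leg , x , y)

-- The component of `v` reaches the loop at some edge `l`. Being linked to an edge at a vertex, `l`
-- is itself at a vertex, possibly different from `v`, and is a leg there.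
leg-exists : ∀ D {v vs} → vertices D ≡ v ∷ vs → Leg D
leg-exists D {v} {vs} eq = build (find (All.lookup (connected D) (end⇒edge (here ≡.refl))))
  where
  end⇒edge : ∀ {e} → e ∈ halves v → e ∈ edges D
  end⇒edge {e} e∈ = reduce (∈-++⁻ (edges D) (∈-resp-↭ (twoEnds D) (∈-++⁺ʳ (word D)
    (subst (λ us → e ∈ concatMap halves us) (≡.sym eq) (∈-++⁺ˡ e∈)))))
  touch : ∀ {us e l} → Linked us e l → Any (λ u → e ∈ halves u) us → Any (λ u → l ∈ halves u) us
  touch ε           a = a
  touch (fwd m ◅ p) a = touch p (Any.map proj₂ m)
  touch (bwd m ◅ p) a = touch p (Any.map proj₁ m)
  start : ∀ {u l} → l ∈ halves u → ∃₂ λ x y → u ↻ (l , x , y)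
  start (here ≡.refl)                 = _ , _ , rot₀
  start (there (here ≡.refl))         = _ , _ , rot₁
  start (there (there (here ≡.refl))) = _ , _ , rot₂
  build : (∃ λ l → l ∈ word D × Linked (vertices D) (proj₁ v) l) → Leg D
  build (l , l∈ , path)
    with u , u∈ , l∈u ← find (touch path (subst (Any (λ u → proj₁ v ∈ halves u)) (≡.sym eq) (here (here ≡.refl))))
    = record
    { left       = proj₁ (∈-∃++ l∈)
    ; right      = proj₁ (proj₂ (∈-∃++ l∈))
    ; word-≡     = proj₂ (proj₂ (∈-∃++ l∈))
    ; vertices-↭ = ↭-trans (↭-reflexive (proj₂ (proj₂ (∈-∃++ u∈)))) (shift u _ _)
    ; rotated    = proj₂ (proj₂ (start l∈u)) }

StuStep : ∀ {p} → (Diagram → Set p) → Set p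
StuStep P = ∀ S {v rest leg x y} left {right} (p : vertices S ↭ v ∷ rest) (r : v ↻ (leg , x , y))
  (q : word S ≡ left ++ leg ∷ right) →
  P (Resolution.T⁺ (resolve S left p r q)) → P (Resolution.T⁻ (resolve S left p r q)) → P S

-- Carries properties of `w` from chord diagrams, where its values are prescribed, to all diagrams:
-- as long as there are internal vertices some leg exists, and each resolution removes one vertex.
stu-induction : ∀ {p} (P : Diagram → Set p) → (∀ D → IsChordDiagram D → P D) → StuStep P → ∀ D → P D
stu-induction P base step D = go (length (vertices D)) D ≡.refl
  where
  go : ∀ n D → length (vertices D) ≡ n → P D
  go zero D eq = base D (empty (vertices D) eq)
    where
    empty : ∀ vs → length vs ≡ 0 → vs ≡ []
    empty [] _ = ≡.refl
  go (suc n) D eq = step D left vertices-↭ rotated word-≡ (go n T⁺ shorter) (go n T⁻ shorter)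
    where
    nonempty : ∀ vs → length vs ≡ suc n → ∃₂ λ v us → vs ≡ v ∷ us
    nonempty (v ∷ us) _ = v , us , ≡.refl
    open Leg (leg-exists D (proj₂ (proj₂ (nonempty (vertices D) eq))))
    open Resolution (resolve D left vertices-↭ rotated word-≡)
    shorter : length rest ≡ n
    shorter = ℕ.suc-injective (≡.trans (≡.sym (↭-length vertices-↭)) eq)

-- Local relations between words of chords

module ChordValues {c ℓ m ℓm} {R : CommutativeRing c ℓ} (𝔤 : LieAlgebra R m ℓm)
  {n} (e e* : Fin n → LieAlgebra.Carrierᴹ 𝔤) where

  open Ring (U-ring 𝔤) renaming (Carrier to 𝕌)
  module ΣU = FixedSum +-commutativeMonoid n
  open SetoidReasoning setoid

  Index : Set
  Index = Edge → Maybe (Fin n)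

  _[_≔_] : Index → Edge → Fin n → Index
  (σ [ a ≔ i ]) b = if does (b ≟ᵉ a) then just i else σ b

  value : Index → List Edge → 𝕌
  value = chordValue 𝔤 e e*

  ≔-same : ∀ σ a i → (σ [ a ≔ i ]) a ≡ just i
  ≔-same σ a i rewrite dec-true (a ≟ᵉ a) ≡.refl = ≡.refl

  ≔-other : ∀ σ a i {b} → b ≢ a → (σ [ a ≔ i ]) b ≡ σ b
  ≔-other σ a i {b} b≢a rewrite dec-false (b ≟ᵉ a) b≢a = ≡.refl

  first : ∀ σ a → σ a ≡ nothing → ∀ v → value σ (a ∷ v) ≡ ΣU.∑ (λ i → ι (e i) * value (σ [ a ≔ i ]) v)
  first σ a eq v with nothing ← σ a = ≡.refl

  second : ∀ σ a {i} → σ a ≡ just i → ∀ v → value σ (a ∷ v) ≡ ι (e* i) * value σ v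
  second σ a eq v with just i ← σ a with ≡.refl ← eq = ≡.refl

  value-cong : ∀ {σ τ} v → (∀ {a} → a ∈ v → σ a ≡ τ a) → value σ v ≈ value τ v
  value-cong [] p = refl
  value-cong {σ} {τ} (a ∷ v) p with σ a | τ a | p (here ≡.refl)
  ... | just i  | just i  | ≡.refl = *-congˡ (value-cong v (p ∘ there))
  ... | nothing | nothing | ≡.refl = ΣU.∑-cong (λ i → *-congˡ (value-cong v (λ {b} b∈ →
    cong (λ r → if does (b ≟ᵉ a) then just i else r) (p (there b∈)))))

  value-fresh : ∀ σ {a} i v → a ∉ v → value (σ [ a ≔ i ]) v ≈ value σ v
  value-fresh σ i v a∉v = value-cong v (λ b∈ → ≔-other σ _ i (λ { ≡.refl → a∉v b∈ }))

  value-map : ∀ {f : Edge → Edge} → (∀ {a b} → f a ≡ f b → a ≡ b) → ∀ σ v → value σ (map f v) ≈ value (σ ∘ f) v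
  value-map inj σ [] = refl
  value-map {f} inj σ (a ∷ v) with σ (f a)
  ... | just i  = *-congˡ (value-map inj σ v)
  ... | nothing = ΣU.∑-cong (λ i → *-congˡ (trans (value-map inj _ v) (value-cong v (λ {b} _ → same b i))))
    where
    same : ∀ b i → (σ [ f a ≔ i ]) (f b) ≡ ((σ ∘ f) [ a ≔ i ]) b
    same b i with b ≟ᵉ a
    ... | yes ≡.refl = ≔-same σ (f b) i
    ... | no b≢a     = ≔-other σ (f a) i (b≢a ∘ inj)

  value-++ : ∀ σ v w → Disjoint v w → value σ (v ++ w) ≈ value σ v * value σ w
  value-++ σ []      w d = sym (*-identityˡ _)
  value-++ σ (a ∷ v) w d with σ a
  ... | just i  = trans (*-congˡ (value-++ σ v w (λ (p , q) → d (there p , q)))) (sym (*-assoc _ _ _))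
  ... | nothing = begin
    ΣU.∑ (λ i → ι (e i) * value (σ [ a ≔ i ]) (v ++ w))
      ≈⟨ ΣU.∑-cong (λ i → trans (*-congˡ (trans (value-++ _ v w (λ (p , q) → d (there p , q)))
           (*-congˡ (value-fresh σ i w (λ a∈ → d (here ≡.refl , a∈)))))) (sym (*-assoc _ _ _))) ⟩
    ΣU.∑ (λ i → ι (e i) * value (σ [ a ≔ i ]) v * value σ w)
      ≈⟨ SemiringSum.*-distribʳ-sum semiring (value σ w) (λ i → ι (e i) * value (σ [ a ≔ i ]) v) ⟨
    ΣU.∑ (λ i → ι (e i) * value (σ [ a ≔ i ]) v) * value σ w ∎

  -- The labels of `P` multiply from the left, and the central `t` moves past them; `c ∉ P` ensures
  -- that `c` is still without an index when the changed part is reached. `M` and `N` include the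
  -- whole rest of the word.
  value-prefix : ∀ {t c M N} → Central 𝔤 t →
    (∀ {σ} → σ c ≡ nothing → value σ M ≈ t * value σ N) →
    ∀ {σ} P → c ∉ P → σ c ≡ nothing → value σ (P ++ M) ≈ t * value σ (P ++ N)
  value-prefix central rel []      c∉ σc = rel σc
  value-prefix {t} {c} {M} {N} central rel {σ} (a ∷ P) c∉ σc = go (σ a) ≡.refl
    where
    past : ∀ u v → u * (t * v) ≈ t * (u * v)
    past u v = trans (sym (*-assoc _ _ _)) (trans (*-congʳ (sym (central u))) (*-assoc _ _ _))
    go : ∀ r → σ a ≡ r → value σ (a ∷ P ++ M) ≈ t * value σ (a ∷ P ++ N)
    go (just i) eq = begin
      value σ (a ∷ P ++ M)             ≡⟨ second σ a eq _ ⟩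
      ι (e* i) * value σ (P ++ M)      ≈⟨ *-congˡ (value-prefix central rel P (c∉ ∘ there) σc) ⟩
      ι (e* i) * (t * value σ (P ++ N)) ≈⟨ past _ _ ⟩
      t * (ι (e* i) * value σ (P ++ N)) ≡⟨ cong (t *_) (second σ a eq _) ⟨
      t * value σ (a ∷ P ++ N) ∎
    go nothing eq = begin
      value σ (a ∷ P ++ M)             ≡⟨ first σ a eq _ ⟩
      ΣU.∑ (λ i → ι (e i) * value (σ [ a ≔ i ]) (P ++ M))
        ≈⟨ ΣU.∑-cong (λ i → trans (*-congˡ (value-prefix central rel P (c∉ ∘ there)
             (≡.trans (≔-other σ a i (c∉ ∘ here)) σc))) (past _ _)) ⟩
      ΣU.∑ (λ i → t * (ι (e i) * value (σ [ a ≔ i ]) (P ++ N)))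
        ≈⟨ SemiringSum.*-distribˡ-sum semiring t (λ i → ι (e i) * value (σ [ a ≔ i ]) (P ++ N)) ⟨
      t * ΣU.∑ (λ i → ι (e i) * value (σ [ a ≔ i ]) (P ++ N))
        ≡⟨ cong (t *_) (first σ a eq _) ⟨
      t * value σ (a ∷ P ++ N) ∎

  value-isolated : ∀ {σ c} Q → c ∉ Q → σ c ≡ nothing →
    value σ (c ∷ c ∷ Q) ≈ ΣU.∑ (λ i → ι (e i) * ι (e* i)) * value σ Q
  value-isolated {σ} {c} Q c∉ σc = begin
    value σ (c ∷ c ∷ Q)    ≡⟨ first σ c σc _ ⟩
    ΣU.∑ (λ i → ι (e i) * value (σ [ c ≔ i ]) (c ∷ Q))
      ≈⟨ ΣU.∑-cong (λ i → trans (*-congˡ (trans (reflexive (second (σ [ c ≔ i ]) c (≔-same σ c i) Q)) (*-congˡ (value-fresh σ i Q c∉))))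
           (sym (*-assoc _ _ _))) ⟩
    ΣU.∑ (λ i → ι (e i) * ι (e* i) * value σ Q)
      ≈⟨ SemiringSum.*-distribʳ-sum semiring (value σ Q) (λ i → ι (e i) * ι (e* i)) ⟨
    ΣU.∑ (λ i → ι (e i) * ι (e* i)) * value σ Q ∎

  module _ {t} (sandwich : ∀ x → ΣU.∑ (λ i → ι (e i) * (ι x * ι (e* i))) ≈ t * ι x) where

    sandwich-* : ∀ x z → ΣU.∑ (λ i → ι (e i) * (ι x * (ι (e* i) * z))) ≈ t * (ι x * z)
    sandwich-* x z = begin
      ΣU.∑ (λ i → ι (e i) * (ι x * (ι (e* i) * z)))
        ≈⟨ ΣU.∑-cong (λ i → trans (*-congˡ (sym (*-assoc _ _ _))) (sym (*-assoc _ _ _))) ⟩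
      ΣU.∑ (λ i → ι (e i) * (ι x * ι (e* i)) * z)
        ≈⟨ SemiringSum.*-distribʳ-sum semiring z (λ i → ι (e i) * (ι x * ι (e* i))) ⟨
      ΣU.∑ (λ i → ι (e i) * (ι x * ι (e* i))) * z    ≈⟨ *-congʳ (sandwich x) ⟩
      t * ι x * z                                    ≈⟨ *-assoc _ _ _ ⟩
      t * (ι x * z) ∎

    -- The end of `u` between the two ends of `c` may be its second, whose label is already known,
    -- or its first, whose label is still to be summed over; then the two sums are exchanged before
    -- averaging over the label of `c`.
    value-sandwich : ∀ {σ c u} Q → c ≢ u → c ∉ Q → σ c ≡ nothing →
      value σ (c ∷ u ∷ c ∷ Q) ≈ t * value σ (u ∷ Q)
    value-sandwich {σ} {c} {u} Q c≢u c∉ σc = trans (reflexive (first σ c σc _)) (go (σ u) ≡.refl)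
      where
      go : ∀ r → σ u ≡ r → ΣU.∑ (λ i → ι (e i) * value (σ [ c ≔ i ]) (u ∷ c ∷ Q)) ≈ t * value σ (u ∷ Q)
      go (just p) eq = begin
        ΣU.∑ (λ i → ι (e i) * value (σ [ c ≔ i ]) (u ∷ c ∷ Q))
          ≈⟨ ΣU.∑-cong (λ i → *-congˡ (trans (reflexive (second (σ [ c ≔ i ]) u (≡.trans (≔-other σ c i (c≢u ∘ ≡.sym)) eq) _))
               (*-congˡ (trans (reflexive (second (σ [ c ≔ i ]) c (≔-same σ c i) Q)) (*-congˡ (value-fresh σ i Q c∉)))))) ⟩
        ΣU.∑ (λ i → ι (e i) * (ι (e* p) * (ι (e* i) * value σ Q)))    ≈⟨ sandwich-* (e* p) (value σ Q) ⟩
        t * (ι (e* p) * value σ Q)                                    ≡⟨ cong (t *_) (second σ u eq Q) ⟨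
        t * value σ (u ∷ Q) ∎
      go nothing eq = begin
        ΣU.∑ (λ i → ι (e i) * value (σ [ c ≔ i ]) (u ∷ c ∷ Q))
          ≈⟨ ΣU.∑-cong (λ i → trans (*-congˡ (trans (reflexive (first (σ [ c ≔ i ]) u (≡.trans (≔-other σ c i (c≢u ∘ ≡.sym)) eq) _))
               (ΣU.∑-cong (λ p → *-congˡ (trans
                 (reflexive (second ((σ [ c ≔ i ]) [ u ≔ p ]) c (≡.trans (≔-other (σ [ c ≔ i ]) u p c≢u) (≔-same σ c i)) Q))
                 (*-congˡ (value-cong Q (λ {b} b∈ → cong (λ r → if does (b ≟ᵉ u) then just p else r)
                   (≔-other σ c i (λ { ≡.refl → c∉ b∈ }))))))))))
               (SemiringSum.*-distribˡ-sum semiring (ι (e i)) (λ p → ι (e p) * (ι (e* i) * value (σ [ u ≔ p ]) Q)))) ⟩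
        ΣU.∑ (λ i → ΣU.∑ (λ p → ι (e i) * (ι (e p) * (ι (e* i) * value (σ [ u ≔ p ]) Q))))
          ≈⟨ ΣU.∑-comm _ ⟩
        ΣU.∑ (λ p → ΣU.∑ (λ i → ι (e i) * (ι (e p) * (ι (e* i) * value (σ [ u ≔ p ]) Q))))
          ≈⟨ ΣU.∑-cong (λ p → sandwich-* (e p) (value (σ [ u ≔ p ]) Q)) ⟩
        ΣU.∑ (λ p → t * (ι (e p) * value (σ [ u ≔ p ]) Q))
          ≈⟨ SemiringSum.*-distribˡ-sum semiring t (λ p → ι (e p) * value (σ [ u ≔ p ]) Q) ⟨
        t * ΣU.∑ (λ p → ι (e p) * value (σ [ u ≔ p ]) Q)
          ≡⟨ cong (t *_) (first σ u eq Q) ⟨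
        t * value σ (u ∷ Q) ∎

-- Multiplicativity of the weight system

module WeightSystem {c ℓ m ℓm} {R : CommutativeRing c ℓ} (𝔤 : LieAlgebra R m ℓm)
  {n} (e e* : Fin n → LieAlgebra.Carrierᴹ 𝔤)
  (w : 𝒞 R → U 𝔤) (isWeightSystem : IsWeightSystem 𝔤 e e* w) where

  private module R = CommutativeRing R
  open ChordValues 𝔤 e e*
  open Ring (U-ring 𝔤) renaming (Carrier to 𝕌)
  open RingProperties (U-ring 𝔤) using (-‿distribˡ-*; -‿distribʳ-*)
  open IsWeightSystem isWeightSystem public
  open LeftModuleMorphisms.IsLeftModuleHomomorphism isLinear public using (⟦⟧-cong; +ᴹ-homo; *ₗ-homo; 0ᴹ-homo)
  open SetoidReasoning setoid

  W : Diagram → 𝕌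
  W D = w ⟦ D ⟧

  W-≅ : ∀ {D D′} → D ≅ D′ → W D ≈ W D′
  W-≅ i = ⟦⟧-cong (iso i)

  W-≡ : ∀ {D D′} → word D ≡ word D′ → vertices D ≡ vertices D′ → W D ≈ W D′
  W-≡ p q = W-≅ (≅-reflexive p q)

  W-resolution : ∀ {S left right x y rest} (res : Resolution S left right x y rest) →
    let open Resolution res in W S ≈ W T⁺ - W T⁻
  W-resolution res = trans (W-≅ S≅S′) (trans (⟦⟧-cong (stu relation)) (trans (+ᴹ-homo _ _) (+-congˡ (*ₗ-homo _ _))))
    where open Resolution res

  private
    chord-product : ∀ D D′ → IsChordDiagram D → IsChordDiagram D′ → W (D ∙ D′) ≈ W D * W D′
    chord-product D D′ p p′ = begin
      W (D ∙ D′)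
        ≈⟨ chords (D ∙ D′) (cong₂ (λ V V′ → map (mapᵛ (tag 0)) V ++ map (mapᵛ (tag 1)) V′) p p′) ⟩
      value none (map (tag 0) (word D) ++ map (tag 1) (word D′))
        ≈⟨ value-++ none _ _ (tags-disjoint (λ ()) (word D) (word D′)) ⟩
      value none (map (tag 0) (word D)) * value none (map (tag 1) (word D′))
        ≈⟨ *-cong (value-map ∷-injectiveʳ none (word D)) (value-map ∷-injectiveʳ none (word D′)) ⟩
      value none (word D) * value none (word D′)
        ≈⟨ *-cong (chords D p) (chords D′ p′) ⟨
      W D * W D′ ∎
      where
      none : Index
      none _ = nothing

    rotated-map : ∀ f {v u} → v ↻ u → mapᵛ f v ↻ mapᵛ f u
    rotated-map f rot₀ = rot₀
    rotated-map f rot₁ = rot₁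
    rotated-map f rot₂ = rot₂

  -- Both sides satisfy STU in each factor and agree on chord diagrams. `D` is reduced to a chord
  -- diagram first, so that afterwards the vertices of the product are just those of `D′`.
  W-∙ : ∀ D D′ → W (D ∙ D′) ≈ W D * W D′
  W-∙ D D′ = stu-induction (λ D → W (D ∙ D′) ≈ W D * W D′) (λ D p →
      stu-induction (λ D′ → W (D ∙ D′) ≈ W D * W D′) (λ D′ → chord-product D D′ p) (stepʳ D p) D′) stepˡ D
    where
    stepˡ : StuStep (λ D → W (D ∙ D′) ≈ W D * W D′)
    stepˡ S {rest = rest} {leg} {x} {y} left {right} p r q ih⁺ ih⁻ = begin
      W (S ∙ D′)
        ≈⟨ W-resolution res′ ⟩
      W (Resolution.T⁺ res′) - W (Resolution.T⁻ res′)
        ≈⟨ +-cong (W-≡ (≡.sym (front (x ∷ y ∷ right))) ≡.refl) (-‿cong (W-≡ (≡.sym (front (y ∷ x ∷ right))) ≡.refl)) ⟩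
      W (T⁺ ∙ D′) - W (T⁻ ∙ D′)
        ≈⟨ +-cong ih⁺ (-‿cong ih⁻) ⟩
      W T⁺ * W D′ - W T⁻ * W D′
        ≈⟨ trans (+-congˡ (-‿distribˡ-* _ _)) (sym (distribʳ _ _ _)) ⟩
      (W T⁺ - W T⁻) * W D′
        ≈⟨ *-congʳ (W-resolution res) ⟨
      W S * W D′ ∎
      where
      res = resolve S left p r q
      open Resolution res
      front : ∀ v → map (tag 0) (left ++ v) ++ map (tag 1) (word D′) ≡
                    map (tag 0) left ++ (map (tag 0) v ++ map (tag 1) (word D′))
      front v = ≡.trans (cong (_++ map (tag 1) (word D′)) (map-++ (tag 0) left v)) (++-assoc (map (tag 0) left) _ _)
      res′ = resolve (S ∙ D′) (map (tag 0) left)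
        (++⁺ʳ (map (mapᵛ (tag 1)) (vertices D′)) (map⁺ (mapᵛ (tag 0)) p))
        (rotated-map (tag 0) r)
        (≡.trans (cong (λ v → map (tag 0) v ++ map (tag 1) (word D′)) q) (front (leg ∷ right)))

    stepʳ : ∀ D → IsChordDiagram D → StuStep (λ D′ → W (D ∙ D′) ≈ W D * W D′)
    stepʳ D chord S {rest = rest} {leg} {x} {y} left {right} p r q ih⁺ ih⁻ = begin
      W (D ∙ S)
        ≈⟨ W-resolution res′ ⟩
      W (Resolution.T⁺ res′) - W (Resolution.T⁻ res′)
        ≈⟨ +-cong (W-≡ (≡.sym (behind (x ∷ y ∷ right))) no-vertices) (-‿cong (W-≡ (≡.sym (behind (y ∷ x ∷ right))) no-vertices)) ⟩
      W (D ∙ T⁺) - W (D ∙ T⁻)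
        ≈⟨ +-cong ih⁺ (-‿cong ih⁻) ⟩
      W D * W T⁺ - W D * W T⁻
        ≈⟨ trans (+-congˡ (-‿distribʳ-* _ _)) (sym (distribˡ _ _ _)) ⟩
      W D * (W T⁺ - W T⁻)
        ≈⟨ *-congˡ (W-resolution res) ⟨
      W D * W S ∎
      where
      res = resolve S left p r q
      open Resolution res
      no-vertices : ∀ {vs} → vs ≡ map (mapᵛ (tag 0)) (vertices D) ++ vs
      no-vertices {vs} = cong (λ V → map (mapᵛ (tag 0)) V ++ vs) (≡.sym chord)
      behind : ∀ v → map (tag 0) (word D) ++ map (tag 1) (left ++ v) ≡
                     (map (tag 0) (word D) ++ map (tag 1) left) ++ map (tag 1) v
      behind v = ≡.trans (cong (map (tag 0) (word D) ++_) (map-++ (tag 1) left v)) (≡.sym (++-assoc (map (tag 0) (word D)) _ _))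
      res′ = resolve (D ∙ S) (map (tag 0) (word D) ++ map (tag 1) left)
        (↭-trans (↭-reflexive (≡.sym no-vertices)) (map⁺ (mapᵛ (tag 1)) p))
        (rotated-map (tag 1) r)
        (≡.trans (cong (λ v → map (tag 0) (word D) ++ map (tag 1) v) q) (behind (leg ∷ right)))

  W-∅ : W ∅ ≈ 1#
  W-∅ = chords ∅ ≡.refl

-- Ladders

cell : ℕ → List Vertex
cell t = (up (suc t) , up t , rung t) ∷ (rung t , low t , low (suc t)) ∷ []

-- The cells are listed from the left, those of a ladder from the right.
segment : ℕ → ℕ → List Vertex
segment m zero    = []
segment m (suc n) = cell m ++ segment (suc m) n

segment-last : ∀ m n → segment m (suc n) ↭ cell (m ℕ.+ n) ++ segment m n
segment-last m zero    = ↭-reflexive (cong (λ t → cell t ++ []) (≡.sym (ℕ.+-identityʳ m)))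
segment-last m (suc n) = ↭-trans (++⁺ˡ (cell m) (segment-last (suc m) n))
  (↭-trans (shifts (cell m) (cell (suc m ℕ.+ n)))
    (↭-reflexive (cong (λ t → cell t ++ segment m (suc n)) (≡.sym (ℕ.+-suc m n)))))

ladder↭segment : ∀ k → ladder k ↭ segment 0 k
ladder↭segment zero    = ↭-refl
ladder↭segment (suc k) = ↭-trans (++⁺ˡ (cell k) (ladder↭segment k)) (↭-sym (segment-last 0 k))

-- A single chord: its weight is the Casimir element, which is how `Ω-central` follows from the
-- centrality of weights.
○ : Diagram
○ .word      = [] ∷ [] ∷ []
○ .vertices  = []
○ .edges     = [] ∷ []
○ .unique    = [] ∷ []
○ .twoEnds   = ↭-refl
○ .connected = here ε ∷ []

-- The word of J i j read from its third leg, with the chords named by X.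
ladderWord : ℕ → List Edge → List Edge
ladderWord k X = (low 0 ∷ reverse X) ++ low k ∷ up k ∷ X ++ up 0 ∷ []

chord-absent : ∀ D {c M} → vertices D ≡ [] → word D ↭ c ∷ c ∷ M → c ∉ M
chord-absent D {c} {M} p q = Split.absent (split-ends (unique D) (twoEnds D)
  (↭-trans (↭-reflexive (≡.trans (cong (λ vs → word D ++ concatMap halves vs) p) (++-identityʳ _))) q))

module LadderRelations {c ℓ m ℓm} {R : CommutativeRing c ℓ} (𝔤 : LieAlgebra R m ℓm)
  {n} (e e* : Fin n → LieAlgebra.Carrierᴹ 𝔤)
  (w : 𝒞 R → U 𝔤) (isWeightSystem : IsWeightSystem 𝔤 e e* w) where

  open ChordValues 𝔤 e e*
  open WeightSystem 𝔤 e e* w isWeightSystem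
  open Ring (U-ring 𝔤) renaming (Carrier to 𝕌)
  open RingProperties (U-ring 𝔤) using (-‿distribˡ-*; -‿distribʳ-*)
  open AbelianGroupProperties +-abelianGroup using () renaming (inverseˡ-unique to neg-unique)
  open SetoidReasoning setoid

  Ω : 𝕌
  Ω = ΣU.∑ (λ i → ι (e i) * ι (e* i))

  W-○ : W ○ ≈ Ω
  W-○ = trans (chords ○ ≡.refl) (ΣU.∑-cong (λ i → *-congˡ (*-identityʳ _)))

  Ω-central : Central 𝔤 Ω
  Ω-central u = trans (*-congʳ (sym W-○)) (trans (central ⟦ ○ ⟧ u) (*-congˡ W-○))

  module _ (M N : List Edge) (t : 𝕌) where

    -- Quantifying over all `D` and `D′` with the given words and vertices frees the claim from the
    -- way they were built, so that it applies to whatever `resolve` returns.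
    record Scales (V : List Vertex) (P Q : List Edge) : Set (c ⊔ ℓ ⊔ m ⊔ ℓm) where
      constructor scales
      field
        scale : ∀ D D′ → word D ≡ P ++ M ++ Q → vertices D ↭ V →
          word D′ ≡ P ++ N ++ Q → vertices D′ ↭ V → W D ≈ t * W D′
    open Scales

    private
      combine : ∀ {a b a′ b′} → a ≈ t * a′ → b ≈ t * b′ → a - b ≈ t * (a′ - b′)
      combine {a} {b} {a′} {b′} p q = begin
        a - b                     ≈⟨ +-cong p (-‿cong q) ⟩
        t * a′ - t * b′           ≈⟨ +-congˡ (-‿distribʳ-* _ _) ⟩
        t * a′ + t * - b′         ≈⟨ distribˡ _ _ _ ⟨
        t * (a′ - b′) ∎

    -- A leg outside the changed part can be resolved in the same way in both diagrams; the factor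
    -- `t` then comes out of the difference.
    resolveʳ : ∀ {V v rest leg x y P} Q₁ {Q₂} → V ↭ v ∷ rest → v ↻ (leg , x , y) →
      Scales rest P (Q₁ ++ x ∷ y ∷ Q₂) → Scales rest P (Q₁ ++ y ∷ x ∷ Q₂) → Scales V P (Q₁ ++ leg ∷ Q₂)
    resolveʳ {leg = leg} {x} {y} {P} Q₁ {Q₂} p r s⁺ s⁻ = scales λ D D′ word-D vertices-D word-D′ vertices-D′ →
      let
        res  = resolve D (P ++ M ++ Q₁) (↭-trans vertices-D p) r (≡.trans word-D (≡.sym (focus M)))
        res′ = resolve D′ (P ++ N ++ Q₁) (↭-trans vertices-D′ p) r (≡.trans word-D′ (≡.sym (focus N)))
      in begin
        W D                     ≈⟨ W-resolution res ⟩
        W (Resolution.T⁺ res) - W (Resolution.T⁻ res)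
          ≈⟨ combine (scale s⁺ _ _ (focus M) ↭-refl (focus N) ↭-refl) (scale s⁻ _ _ (focus M) ↭-refl (focus N) ↭-refl) ⟩
        t * (W (Resolution.T⁺ res′) - W (Resolution.T⁻ res′)) ≈⟨ *-congˡ (W-resolution res′) ⟨
        t * W D′ ∎
      where
      focus : ∀ K {v} → (P ++ K ++ Q₁) ++ v ≡ P ++ K ++ Q₁ ++ v
      focus K = ≡.trans (++-assoc P _ _) (cong (P ++_) (++-assoc K _ _))

    resolveˡ : ∀ {V v rest leg x y} P₁ {P₂ Q} → V ↭ v ∷ rest → v ↻ (leg , x , y) →
      Scales rest (P₁ ++ x ∷ y ∷ P₂) Q → Scales rest (P₁ ++ y ∷ x ∷ P₂) Q → Scales V (P₁ ++ leg ∷ P₂) Q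
    resolveˡ {leg = leg} {x} {y} P₁ {P₂} {Q} p r s⁺ s⁻ = scales λ D D′ word-D vertices-D word-D′ vertices-D′ →
      let
        res  = resolve D P₁ (↭-trans vertices-D p) r (≡.trans word-D (++-assoc P₁ (leg ∷ P₂) _))
        res′ = resolve D′ P₁ (↭-trans vertices-D′ p) r (≡.trans word-D′ (++-assoc P₁ (leg ∷ P₂) _))
      in begin
        W D                     ≈⟨ W-resolution res ⟩
        W (Resolution.T⁺ res) - W (Resolution.T⁻ res)
          ≈⟨ combine (scale s⁺ _ _ (focus (x ∷ y ∷ P₂)) ↭-refl (focus (x ∷ y ∷ P₂)) ↭-refl)
                     (scale s⁻ _ _ (focus (y ∷ x ∷ P₂)) ↭-refl (focus (y ∷ x ∷ P₂)) ↭-refl) ⟩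
        t * (W (Resolution.T⁺ res′) - W (Resolution.T⁻ res′)) ≈⟨ *-congˡ (W-resolution res′) ⟨
        t * W D′ ∎
      where
      focus : ∀ K {v} → P₁ ++ K ++ v ≡ (P₁ ++ K) ++ v
      focus K = ≡.sym (++-assoc P₁ K _)

    -- The ladder is opened from the end whose legs lie outside the changed part.
    scales-segment : (∀ P Q → Scales [] P Q) → ∀ m n {P Q} → low m ∈ P → up m ∈ Q → Scales (segment m n) P Q
    scales-segment base m zero    low∈ up∈ = base _ _
    scales-segment base m (suc n) low∈ up∈
      with P₁ , P₂ , ≡.refl ← ∈-∃++ low∈ | Q₁ , Q₂ , ≡.refl ← ∈-∃++ up∈ =
      -- Resolving the legs `up m` and `low m` puts both ends of `rung m` on the loop and makes
      -- `up (suc m)` and `low (suc m)` the legs of the shorter segment. The four cases are the two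
      -- orders on either side.
      resolveʳ Q₁ ↭-refl rot₁
        (resolveˡ P₁ ↭-refl rot₁
          (scales-segment base (suc m) n (∈-++⁺ʳ P₁ (here ≡.refl)) (∈-++⁺ʳ Q₁ (there (here ≡.refl))))
          (scales-segment base (suc m) n (∈-++⁺ʳ P₁ (there (here ≡.refl))) (∈-++⁺ʳ Q₁ (there (here ≡.refl)))))
        (resolveˡ P₁ ↭-refl rot₁
          (scales-segment base (suc m) n (∈-++⁺ʳ P₁ (here ≡.refl)) (∈-++⁺ʳ Q₁ (here ≡.refl)))
          (scales-segment base (suc m) n (∈-++⁺ʳ P₁ (there (here ≡.refl))) (∈-++⁺ʳ Q₁ (here ≡.refl))))

    scales-ladder : (∀ P Q → Scales [] P Q) → ∀ k {P Q} → low 0 ∈ P → up 0 ∈ Q → Scales (ladder k) P Q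
    scales-ladder base k low∈ up∈ = scales λ D D′ p q p′ q′ → scale (scales-segment base 0 k low∈ up∈) D D′
      p (↭-trans q (ladder↭segment k)) p′ (↭-trans q′ (ladder↭segment k))

  private
    -- The permutation `twice` says that `M` contributes both ends of `c` besides the letters of
    -- `N`. As an edge has two ends only, `c` occurs nowhere else in the word, which the local
    -- relations presuppose.
    scales-by-value : ∀ M N t c → Central 𝔤 t → (∀ P Q → P ++ M ++ Q ↭ c ∷ c ∷ (P ++ N ++ Q)) →
      (∀ {σ} Q → c ∉ N ++ Q → σ c ≡ nothing → value σ (M ++ Q) ≈ t * value σ (N ++ Q)) → ∀ P Q → Scales M N t [] P Q
    scales-by-value M N t c t-central twice local P Q = scales λ D D′ word-D vertices-D word-D′ vertices-D′ →
      let
        absent : c ∉ P ++ N ++ Q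
        absent = chord-absent D (↭-empty-inv vertices-D) (↭-trans (↭-reflexive word-D) (twice P Q))
      in begin
      W D                                       ≈⟨ chords D (↭-empty-inv vertices-D) ⟩
      value none (word D)                       ≡⟨ cong (value none) word-D ⟩
      value none (P ++ M ++ Q)
        ≈⟨ value-prefix t-central (local Q (absent ∘ ∈-++⁺ʳ P)) P (absent ∘ ∈-++⁺ˡ) ≡.refl ⟩
      t * value none (P ++ N ++ Q)              ≡⟨ cong (λ v → t * value none v) word-D′ ⟨
      t * value none (word D′)                  ≈⟨ *-congˡ (chords D′ (↭-empty-inv vertices-D′)) ⟨
      t * W D′ ∎
      where
      none : Index
      none _ = nothing

  isolated : ∀ c P Q → Scales (c ∷ c ∷ []) [] Ω [] P Q
  isolated c = scales-by-value _ _ Ω c Ω-central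
    (λ P Q → shifts P (c ∷ c ∷ []))
    (λ {σ} Q c∉ → value-isolated {σ} Q c∉)

  module _ (s : CommutativeRing.Carrier R)
    (sandwich : ∀ x → ΣU.∑ (λ i → ι (e i) * (ι x * ι (e* i))) ≈ (Ω - scalar s) * ι x) where

    τ : 𝕌
    τ = Ω - scalar s

    τ-central : Central 𝔤 τ
    τ-central u = begin
      (Ω - scalar s) * u         ≈⟨ distribʳ _ _ _ ⟩
      Ω * u + - scalar s * u     ≈⟨ +-cong (Ω-central u) (trans (sym (-‿distribˡ-* _ _)) (trans (-‿cong (scalar-comm s u)) (-‿distribʳ-* _ _))) ⟩
      u * Ω + u * - scalar s     ≈⟨ distribˡ _ _ _ ⟨
      u * (Ω - scalar s) ∎

    crossed : ∀ c u P Q → Scales (c ∷ u ∷ c ∷ []) (u ∷ []) τ [] P Q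
    crossed c u = scales-by-value _ _ τ c τ-central
      (λ P Q → ↭-trans (++⁺ˡ P (prep c (↭-trans (shift c (u ∷ []) Q) ↭-refl))) (shifts P (c ∷ c ∷ [])))
      (λ {σ} Q c∉ → value-sandwich sandwich {σ} Q (c∉ ∘ here) (c∉ ∘ there))

    -- The new chord, pushed out of the ladder across low k and up k, leaves
    -- the ladder with one more rung and three multiples of the old ladder.
    ladder-step : ∀ k X D D₀ →
      word D ≡ ladderWord (suc k) X → vertices D ≡ ladder (suc k) →
      word D₀ ≡ ladderWord k X → vertices D₀ ≡ ladder k →
      ∃ λ D₁ → word D₁ ≡ ladderWord k (rung k ∷ X) × vertices D₁ ≡ ladder k ×
        W D + Ω * W D₀ ≈ W D₁ + (scalar s * W D₀ + scalar s * W D₀)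
    ladder-step k X D D₀ word-D vertices-D word-D₀ vertices-D₀ = ρ⁺.T⁺ , outer , ≡.refl , (begin
      W D + Ω * W D₀
        ≈⟨ +-congʳ (W-resolution res) ⟩
      (W ρ.T⁺ - W ρ.T⁻) + Ω * W D₀
        ≈⟨ +-congʳ (+-cong (W-resolution res⁺) (-‿cong (W-resolution res⁻))) ⟩
      ((W ρ⁺.T⁺ - W ρ⁺.T⁻) - (W ρ⁻.T⁺ - W ρ⁻.T⁻)) + Ω * W D₀
        ≈⟨ +-congʳ (+-cong (+-congˡ (-‿cong below)) (-‿cong (+-cong above (-‿cong inner)))) ⟩
      ((W ρ⁺.T⁺ - p) - (p - Ω * W D₀)) + Ω * W D₀
        ≈⟨ +-cong (+-congˡ (sym y-value)) (sym x-value) ⟩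
      ((W ρ⁺.T⁺ - p) + y) + (p + y)
        ≈⟨ +-congʳ (+-assoc _ _ _) ⟩
      (W ρ⁺.T⁺ + (- p + y)) + (p + y)
        ≈⟨ +-assoc _ _ _ ⟩
      W ρ⁺.T⁺ + ((- p + y) + (p + y))
        ≈⟨ +-congˡ (trans (+-congʳ (+-comm _ _)) (trans (+-assoc _ _ _) (+-congˡ
             (trans (sym (+-assoc _ _ _)) (trans (+-congʳ (-‿inverseˡ p)) (+-identityˡ y)))))) ⟩
      W ρ⁺.T⁺ + (y + y) ∎)
      where
      P = low 0 ∷ reverse X
      Q = X ++ up 0 ∷ []
      r = rung k
      l = low k
      u = up k
      p = τ * W D₀
      y = scalar s * W D₀
      -- This and `y-value` are the equation τ + s = Ω in two forms; they trade the multiples of Ω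
      -- and τ for multiples of `s`.
      x-value : p + y ≈ Ω * W D₀
      x-value = trans (sym (distribʳ _ _ _)) (*-congʳ (trans (+-assoc _ _ _) (trans (+-congˡ (-‿inverseˡ _)) (Ring.+-identityʳ (U-ring 𝔤) _))))
      y-value : y ≈ - (p - Ω * W D₀)
      y-value = neg-unique _ _ (trans (sym (+-assoc _ _ _)) (trans (+-congʳ (trans (+-comm _ _) x-value)) (-‿inverseʳ _)))
      after : ∀ {a v} → P ++ a ∷ v ≡ (P ++ a ∷ []) ++ v
      after = ≡.sym (++-assoc P _ _)
      -- The leg `up (suc k)` is resolved first, then `low (suc k)` in both results. The ends of the
      -- former rung lie outside both rails with sign +, around one rail with sign - (twice), and
      -- next to each other between the rails with sign +.
      res = resolve D (P ++ low (suc k) ∷ []) (↭-reflexive vertices-D) rot₀ (≡.trans word-D after)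
      module ρ = Resolution res
      res⁺ = resolve ρ.T⁺ P (↭-reflexive ρ.vertices⁺) rot₂ (≡.trans ρ.word⁺ (≡.sym after))
      res⁻ = resolve ρ.T⁻ P (↭-reflexive ρ.vertices⁻) rot₂ (≡.trans ρ.word⁻ (≡.sym after))
      module ρ⁺ = Resolution res⁺
      module ρ⁻ = Resolution res⁻
      ladder-D₀ = ↭-reflexive vertices-D₀
      outer : word ρ⁺.T⁺ ≡ ladderWord k (r ∷ X)
      outer = ≡.sym (≡.trans (cong (λ v → low 0 ∷ v ++ l ∷ u ∷ r ∷ Q) (unfold-reverse r X)) (++-assoc P (r ∷ []) _))
      -- The word is read from the third leg so that the changed letters lie between `low 0` and
      -- `up 0`, the legs from which the remaining ladder is opened.
      below : W ρ⁺.T⁻ ≈ p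
      below = Scales.scale (scales-ladder _ _ τ (crossed r u) k (here ≡.refl) (∈-++⁺ʳ X (here ≡.refl))) _ D₀
        after ↭-refl (≡.trans word-D₀ after) ladder-D₀
      above : W ρ⁻.T⁺ ≈ p
      above = Scales.scale (scales-ladder _ _ τ (crossed r l) k (here ≡.refl) (there (∈-++⁺ʳ X (here ≡.refl)))) _ D₀
        ≡.refl ↭-refl word-D₀ ladder-D₀
      inner : W ρ⁻.T⁻ ≈ Ω * W D₀
      inner = Scales.scale (scales-ladder _ _ Ω (isolated r) k (here ≡.refl) (there (∈-++⁺ʳ X (here ≡.refl)))) _ D₀
        after ↭-refl (≡.trans word-D₀ after) ladder-D₀

-- Sums over splittings

module _ {x} {X : Set x} where

  splittings-induction : ∀ {r} (Q : List X → List (List X) → Set r) → Q [] [] →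
    (∀ x {xs Ps} → Q xs Ps → Q (x ∷ xs) ((x ∷ []) ∷ Ps)) →
    (∀ x {xs Ps Rs} → Q xs Ps → Rs ∈ insertions x Ps → Q (x ∷ xs) Rs) →
    ∀ xs {Ps} → Ps ∈ splittings xs → Q xs Ps
  splittings-induction Q nil new old []       (here ≡.refl) = nil
  splittings-induction Q nil new old (x ∷ xs) Rs∈ with ∈-concat⁻′ (map (λ Ps → ((x ∷ []) ∷ Ps) ∷ insertions x Ps) (splittings xs)) Rs∈
  ... | _ , Rs∈′ , ∈map with ∈-map⁻ _ ∈map
  ... | Ps , Ps∈ , ≡.refl with Rs∈′
  ... | here ≡.refl = new x (splittings-induction Q nil new old xs Ps∈)
  ... | there Rs∈″  = old x (splittings-induction Q nil new old xs Ps∈) Rs∈″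

  insertions-induction : ∀ {r} {x : X} (Q : List (List X) → List (List X) → Set r) →
    (∀ P Ps → Q (P ∷ Ps) ((x ∷ P) ∷ Ps)) →
    (∀ P {Ps Rs} → Q Ps Rs → Q (P ∷ Ps) (P ∷ Rs)) →
    ∀ Ps {Rs} → Rs ∈ insertions x Ps → Q Ps Rs
  insertions-induction Q into past (P ∷ Ps) (here ≡.refl) = into P Ps
  insertions-induction Q into past (P ∷ Ps) (there Rs∈) with ∈-map⁻ (P ∷_) Rs∈
  ... | Rs , Rs∈′ , ≡.refl = past P (insertions-induction Q into past Ps Rs∈′)

  splittings-nonempty : ∀ x xs {Ps} → Ps ∈ splittings (x ∷ xs) → ∃ λ q → length Ps ≡ suc q
  splittings-nonempty x xs = splittings-induction Nonempty _ (λ _ _ → _ , ≡.refl)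
    (λ x {Ps = Ps} _ → insertions-induction (λ _ Rs → ∃ λ q → length Rs ≡ suc q) (λ _ _ → _ , ≡.refl) (λ _ _ → _ , ≡.refl) Ps) (x ∷ xs)
    where
    open import Data.Unit.Base using (⊤)
    Nonempty : List X → List (List X) → Set
    Nonempty []      _  = ⊤
    Nonempty (_ ∷ _) Ps = ∃ λ q → length Ps ≡ suc q

module Splittings {a ℓ} (A : CommutativeRing a ℓ) where

  open CommutativeRing A
  open SetoidReasoning setoid
  open NaturalSolver commutativeSemiring using (solve; _:=_; _:+_; _:*_)

  total : ∀ {x} {X : Set x} → (X → Carrier) → List X → Carrier
  total f []       = 0#
  total f (x ∷ xs) = f x + total f xs

  module _ {x} {X : Set x} where

    total-cong : ∀ {f g : X → Carrier} xs → (∀ {x} → x ∈ xs → f x ≈ g x) → total f xs ≈ total g xs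
    total-cong []       p = refl
    total-cong (x ∷ xs) p = +-cong (p (here ≡.refl)) (total-cong xs (p ∘ there))

    total-++ : ∀ (f : X → Carrier) xs ys → total f (xs ++ ys) ≈ total f xs + total f ys
    total-++ f []       ys = sym (+-identityˡ _)
    total-++ f (x ∷ xs) ys = trans (+-congˡ (total-++ f xs ys)) (sym (+-assoc _ _ _))

    total-map : ∀ {y} {Y : Set y} (f : X → Carrier) (g : Y → X) ys → total f (map g ys) ≡ total (f ∘ g) ys
    total-map f g []       = ≡.refl
    total-map f g (y ∷ ys) = ≡.cong (f (g y) +_) (total-map f g ys)

    total-concatMap : ∀ {y} {Y : Set y} (f : X → Carrier) (g : Y → List X) ys →
      total f (concatMap g ys) ≈ total (total f ∘ g) ys
    total-concatMap f g []       = refl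
    total-concatMap f g (y ∷ ys) = trans (total-++ f (g y) _) (+-congˡ (total-concatMap f g ys))

    total-+ : ∀ (f g : X → Carrier) xs → total (λ x → f x + g x) xs ≈ total f xs + total g xs
    total-+ f g []       = sym (+-identityˡ 0#)
    total-+ f g (x ∷ xs) = trans (+-congˡ (total-+ f g xs))
      (solve 4 (λ p q r s → (p :+ q) :+ (r :+ s) := (p :+ r) :+ (q :+ s)) refl _ _ _ _)

    total-* : ∀ k (f : X → Carrier) xs → total (λ x → k * f x) xs ≈ k * total f xs
    total-* k f []       = sym (zeroʳ k)
    total-* k f (x ∷ xs) = trans (+-congˡ (total-* k f xs)) (sym (distribˡ k _ _))

    total-0 : ∀ {f : X → Carrier} xs → (∀ {x} → x ∈ xs → f x ≈ 0#) → total f xs ≈ 0#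
    total-0 []       p = refl
    total-0 (x ∷ xs) p = trans (+-cong (p (here ≡.refl)) (total-0 xs (p ∘ there))) (+-identityˡ 0#)

  module _ {x} {X : Set x} where

    inserted : X → (List (List X) → Carrier) → List (List X) → Carrier
    inserted x G Ps = total G (insertions x Ps)

    -- Summing over the place of `x`, alone or inside an existing part, turns `G` into a functional
    -- on splittings of the other elements, so sums over splittings can be computed one element at a
    -- time.
    added : X → (List (List X) → Carrier) → List (List X) → Carrier
    added x G Ps = G ((x ∷ []) ∷ Ps) + inserted x G Ps

    splitTotal : (List (List X) → Carrier) → List X → Carrier
    splitTotal G xs = total G (splittings xs)

    splitTotal-∷ : ∀ G x xs → splitTotal G (x ∷ xs) ≈ splitTotal (added x G) xs
    splitTotal-∷ G x xs = total-concatMap G _ (splittings xs)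

    inserted-∷ : ∀ x G P Ps → inserted x G (P ∷ Ps) ≈ G ((x ∷ P) ∷ Ps) + inserted x (G ∘ (P ∷_)) Ps
    inserted-∷ x G P Ps = +-congˡ (reflexive (total-map G (P ∷_) (insertions x Ps)))

    inserted-cong : ∀ {G G′} x Ps → (∀ Rs → G Rs ≈ G′ Rs) → inserted x G Ps ≈ inserted x G′ Ps
    inserted-cong x Ps p = total-cong (insertions x Ps) (λ _ → p _)

    -- Splittings of a set are unordered but are listed here as lists of lists. For a functional
    -- that ignores the order of the parts and of their elements, the sum does not depend on the
    -- listing of the set.
    Respectful : (List (List X) → Carrier) → Set _
    Respectful G = ∀ {Ps Qs} → Permutation _↭_ Ps Qs → G Ps ≈ G Qs

    private
      same : ∀ {Ps : List (List X)} → Permutation _↭_ Ps Ps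
      same {Ps} = Homogeneous.refl (reflexive-pointwise Ps)
        where
        reflexive-pointwise : ∀ Ps → Pointwise _↭_ Ps Ps
        reflexive-pointwise []       = []
        reflexive-pointwise (P ∷ Ps) = ↭-refl ∷ reflexive-pointwise Ps

    behind : ∀ {G} → Respectful G → ∀ P → Respectful (G ∘ (P ∷_))
    behind r P p = r (Homogeneous.prep ↭-refl p)

    private
      inserted-prep : ∀ {G} → Respectful G → ∀ x {P Q Ps Qs} → P ↭ Q → Permutation _↭_ Ps Qs →
        inserted x (G ∘ (P ∷_)) Ps ≈ inserted x (G ∘ (P ∷_)) Qs → inserted x G (P ∷ Ps) ≈ inserted x G (Q ∷ Qs)
      inserted-prep {G} r x {P} {Q} {Ps} {Qs} p ps tails = begin
        inserted x G (P ∷ Ps)                              ≈⟨ inserted-∷ x G P Ps ⟩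
        G ((x ∷ P) ∷ Ps) + inserted x (G ∘ (P ∷_)) Ps
          ≈⟨ +-cong (r (Homogeneous.prep (↭.prep x p) ps))
               (trans tails (inserted-cong x Qs (λ _ → r (Homogeneous.prep p same)))) ⟩
        G ((x ∷ Q) ∷ Qs) + inserted x (G ∘ (Q ∷_)) Qs      ≈⟨ inserted-∷ x G Q Qs ⟨
        inserted x G (Q ∷ Qs) ∎

    inserted-respectful : ∀ {G} → Respectful G → ∀ x → Respectful (inserted x G)
    inserted-respectful r x (Homogeneous.refl []) = refl
    inserted-respectful r x (Homogeneous.refl {P ∷ _} (p ∷ ps)) =
      inserted-prep r x p (Homogeneous.refl ps) (inserted-respectful (behind r P) x (Homogeneous.refl ps))
    inserted-respectful r x (Homogeneous.prep {x = P} p ps) =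
      inserted-prep r x p ps (inserted-respectful (behind r P) x ps)
    inserted-respectful {G} r x (Homogeneous.swap {Ps} {Qs} {P} {Q} {P′} {Q′} p q ps) = begin
      inserted x G (P ∷ Q ∷ Ps)
        ≈⟨ trans (inserted-∷ x G P (Q ∷ Ps)) (+-congˡ (inserted-∷ x _ Q Ps)) ⟩
      G ((x ∷ P) ∷ Q ∷ Ps) + (G (P ∷ (x ∷ Q) ∷ Ps) + inserted x (λ Rs → G (P ∷ Q ∷ Rs)) Ps)
        ≈⟨ +-cong (r (Homogeneous.swap (↭.prep x p) q ps)) (+-cong (r (Homogeneous.swap p (↭.prep x q) ps))
             (trans (inserted-respectful (behind (behind r P) Q) x ps) (inserted-cong x Qs (λ _ → r (Homogeneous.swap p q same))))) ⟩
      G (Q′ ∷ (x ∷ P′) ∷ Qs) + (G ((x ∷ Q′) ∷ P′ ∷ Qs) + inserted x (λ Rs → G (Q′ ∷ P′ ∷ Rs)) Qs)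
        ≈⟨ solve 3 (λ p q r → p :+ (q :+ r) := q :+ (p :+ r)) refl _ _ _ ⟩
      G ((x ∷ Q′) ∷ P′ ∷ Qs) + (G (Q′ ∷ (x ∷ P′) ∷ Qs) + inserted x (λ Rs → G (Q′ ∷ P′ ∷ Rs)) Qs)
        ≈⟨ trans (inserted-∷ x G Q′ (P′ ∷ Qs)) (+-congˡ (inserted-∷ x _ P′ Qs)) ⟨
      inserted x G (Q′ ∷ P′ ∷ Qs) ∎
    inserted-respectful r x (Homogeneous.trans p q) = trans (inserted-respectful r x p) (inserted-respectful r x q)

    added-respectful : ∀ {G} → Respectful G → ∀ x → Respectful (added x G)
    added-respectful r x p = +-cong (r (Homogeneous.prep ↭-refl p)) (inserted-respectful r x p)

    private
      both : ∀ x y G P Ps → inserted x (inserted y G) (P ∷ Ps) ≈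
        (G ((y ∷ x ∷ P) ∷ Ps) + inserted y (G ∘ ((x ∷ P) ∷_)) Ps) +
        (inserted x (G ∘ ((y ∷ P) ∷_)) Ps + inserted x (inserted y (G ∘ (P ∷_))) Ps)
      both x y G P Ps = trans (inserted-∷ x (inserted y G) P Ps)
        (+-cong (inserted-∷ y G (x ∷ P) Ps)
                (trans (inserted-cong x Ps (λ Rs → inserted-∷ y G P Rs)) (total-+ _ _ (insertions x Ps))))

    inserted-comm : ∀ {G} → Respectful G → ∀ x y Ps → inserted x (inserted y G) Ps ≈ inserted y (inserted x G) Ps
    inserted-comm r x y []       = refl
    inserted-comm {G} r x y (P ∷ Ps) = begin
      inserted x (inserted y G) (P ∷ Ps)   ≈⟨ both x y G P Ps ⟩
      _ ≈⟨ +-cong (+-congʳ (r (Homogeneous.prep (↭.swap y x ↭-refl) same)))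
                  (+-congˡ (inserted-comm (behind r P) x y Ps)) ⟩
      _ ≈⟨ solve 4 (λ p q r s → (p :+ q) :+ (r :+ s) := (p :+ r) :+ (q :+ s)) refl _ _ _ _ ⟩
      _ ≈⟨ both y x G P Ps ⟨
      inserted y (inserted x G) (P ∷ Ps) ∎

    -- The outcomes are two new parts, one common new part, one element new and the other inserted
    -- (in two ways), or both inserted; exchanging `x` and `y` permutes them.
    added-comm : ∀ {G} → Respectful G → ∀ x y Ps → added x (added y G) Ps ≈ added y (added x G) Ps
    added-comm {G} r x y Ps = begin
      added x (added y G) Ps    ≈⟨ unfold x y ⟩
      _ ≈⟨ +-cong (+-cong (r (Homogeneous.swap ↭-refl ↭-refl same))
                          (+-congʳ (r (Homogeneous.prep (↭.swap y x ↭-refl) same))))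
                  (+-congˡ (inserted-comm r x y Ps)) ⟩
      _ ≈⟨ solve 5 (λ p q i j k → (p :+ (q :+ i)) :+ (j :+ k) := (p :+ (q :+ j)) :+ (i :+ k)) refl _ _ _ _ _ ⟩
      _ ≈⟨ unfold y x ⟨
      added y (added x G) Ps ∎
      where
      unfold : ∀ x y → added x (added y G) Ps ≈
        (G ((y ∷ []) ∷ (x ∷ []) ∷ Ps) + (G ((y ∷ x ∷ []) ∷ Ps) + inserted y (G ∘ ((x ∷ []) ∷_)) Ps)) +
        (inserted x (G ∘ ((y ∷ []) ∷_)) Ps + inserted x (inserted y G) Ps)
      unfold x y = +-cong (+-congˡ (inserted-∷ y G (x ∷ []) Ps)) (total-+ _ _ (insertions x Ps))

    -- Allows the chord that is to be pulled out to be brought to the head of the list of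
    -- components.
    splitTotal-↭ : ∀ {G xs ys} → Respectful G → xs ↭ ys → splitTotal G xs ≈ splitTotal G ys
    splitTotal-↭ r ↭.refl = refl
    splitTotal-↭ {G} r (↭.prep {xs} {ys} x p) = begin
      splitTotal G (x ∷ xs)          ≈⟨ splitTotal-∷ G x xs ⟩
      splitTotal (added x G) xs      ≈⟨ splitTotal-↭ (added-respectful r x) p ⟩
      splitTotal (added x G) ys      ≈⟨ splitTotal-∷ G x ys ⟨
      splitTotal G (x ∷ ys) ∎
    splitTotal-↭ {G} r (↭.swap {xs} {ys} x y p) = begin
      splitTotal G (x ∷ y ∷ xs)                 ≈⟨ twice x y xs ⟩
      splitTotal (added y (added x G)) xs       ≈⟨ splitTotal-↭ (added-respectful (added-respectful r x) y) p ⟩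
      splitTotal (added y (added x G)) ys       ≈⟨ total-cong (splittings ys) (λ {Ps} _ → added-comm r y x Ps) ⟩
      splitTotal (added x (added y G)) ys       ≈⟨ twice y x ys ⟨
      splitTotal G (y ∷ x ∷ ys) ∎
      where
      twice : ∀ x y xs → splitTotal G (x ∷ y ∷ xs) ≈ splitTotal (added y (added x G)) xs
      twice x y xs = trans (splitTotal-∷ G x (y ∷ xs)) (splitTotal-∷ (added x G) y xs)
    splitTotal-↭ r (↭.trans p q) = trans (splitTotal-↭ r p) (splitTotal-↭ r q)

    Π : (List X → Carrier) → List (List X) → Carrier
    Π v []       = 1#
    Π v (P ∷ Ps) = v P * Π v Ps

    -- The product rule applied to Π v, with derivative δ of v.
    Δ : (v δ : List X → Carrier) → List (List X) → Carrier
    Δ v δ []       = 0#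
    Δ v δ (P ∷ Ps) = δ P * Π v Ps + v P * Δ v δ Ps

    -- For μ q = (-1)^(q-1) (q-1)!, the sum over all splittings is the cumulant belonging to the
    -- moments `v`.
    weighted : (ℕ → Carrier) → (List X → Carrier) → List (List X) → Carrier
    weighted μ v Ps = μ (length Ps) * Π v Ps

    weighted-respectful : ∀ μ {v} → (∀ {P Q} → P ↭ Q → v P ≈ v Q) → Respectful (weighted μ v)
    weighted-respectful μ {v} r p = *-cong (reflexive (≡.cong μ (lengths p))) (products p)
      where
      lengths : ∀ {Ps Qs} → Permutation _↭_ Ps Qs → length Ps ≡ length Qs
      lengths (Homogeneous.refl [])           = ≡.refl
      lengths (Homogeneous.refl (_ ∷ ps))     = ≡.cong suc (lengths (Homogeneous.refl ps))
      lengths (Homogeneous.prep _ ps)         = ≡.cong suc (lengths ps)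
      lengths (Homogeneous.swap _ _ ps)       = ≡.cong (λ k → ℕ.suc (ℕ.suc k)) (lengths ps)
      lengths (Homogeneous.trans ps qs)       = ≡.trans (lengths ps) (lengths qs)
      products : ∀ {Ps Qs} → Permutation _↭_ Ps Qs → Π v Ps ≈ Π v Qs
      products (Homogeneous.refl [])          = refl
      products (Homogeneous.refl (p ∷ ps))    = *-cong (r p) (products (Homogeneous.refl ps))
      products (Homogeneous.prep p ps)        = *-cong (r p) (products ps)
      products (Homogeneous.swap p q ps)      = trans (*-cong (r p) (*-cong (r q) (products ps)))
        (solve 3 (λ x y z → x :* (y :* z) := y :* (x :* z)) refl _ _ _)
      products (Homogeneous.trans ps qs)      = trans (products ps) (products qs)

    -- An insertion keeps the number of parts and alters a single factor of the product, whence the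
    -- product rule.
    inserted-weighted : ∀ μ v x Ps → inserted x (weighted μ v) Ps ≈ μ (length Ps) * Δ v (v ∘ (x ∷_)) Ps
    inserted-weighted μ v x []       = sym (zeroʳ _)
    inserted-weighted μ v x (P ∷ Ps) = begin
      inserted x (weighted μ v) (P ∷ Ps)
        ≈⟨ inserted-∷ x (weighted μ v) P Ps ⟩
      k * (v (x ∷ P) * Π v Ps) + inserted x (weighted μ v ∘ (P ∷_)) Ps
        ≈⟨ +-congˡ (trans (inserted-cong x Ps (λ Rs → solve 3 (λ x y z → x :* (y :* z) := y :* (x :* z)) refl _ _ _))
             (total-* (v P) (weighted (μ ∘ suc) v) (insertions x Ps))) ⟩
      k * (v (x ∷ P) * Π v Ps) + v P * inserted x (weighted (μ ∘ suc) v) Ps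
        ≈⟨ +-congˡ (*-congˡ (inserted-weighted (μ ∘ suc) v x Ps)) ⟩
      k * (v (x ∷ P) * Π v Ps) + v P * (k * Δ v (v ∘ (x ∷_)) Ps)
        ≈⟨ solve 4 (λ k x v d → k :* x :+ v :* (k :* d) := k :* (x :+ v :* d)) refl _ _ _ _ ⟩
      k * (v (x ∷ P) * Π v Ps + v P * Δ v (v ∘ (x ∷_)) Ps) ∎
      where k = μ (suc (length Ps))

  open import Algebra.Properties.Semiring.Mult semiring using (×-congʳ; ×-assoc-*; ×-comm-*) renaming (_×_ to _⋆_)
  module _ {μ : ℕ → Carrier} (μ-suc : ∀ q → μ (suc (suc q)) + suc q ⋆ μ (suc q) ≈ 0#)
    {x} {X : Set x} {v δ : List X → Carrier} {ω} {x₀ : X} (unit : v (x₀ ∷ []) ≈ ω)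
    (rule : ∀ P → v (x₀ ∷ P) ≈ ω * v P + δ P) where

    private
      Δ-rule : ∀ Ps → Δ v (v ∘ (x₀ ∷_)) Ps ≈ length Ps ⋆ (ω * Π v Ps) + Δ v δ Ps
      Δ-rule []       = sym (+-identityˡ 0#)
      Δ-rule (P ∷ Ps) = begin
        v (x₀ ∷ P) * Π v Ps + v P * Δ v (v ∘ (x₀ ∷_)) Ps
          ≈⟨ +-cong (*-congʳ (rule P)) (*-congˡ (Δ-rule Ps)) ⟩
        (ω * v P + δ P) * Π v Ps + v P * (length Ps ⋆ (ω * Π v Ps) + Δ v δ Ps)
          ≈⟨ solve 6 (λ o v d p n e → (o :* v :+ d) :* p :+ v :* (n :+ e) := (o :* (v :* p) :+ v :* n) :+ (d :* p :+ v :* e))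
               refl ω (v P) (δ P) (Π v Ps) (length Ps ⋆ (ω * Π v Ps)) (Δ v δ Ps) ⟩
        (ω * (v P * Π v Ps) + v P * (length Ps ⋆ (ω * Π v Ps))) + (δ P * Π v Ps + v P * Δ v δ Ps)
          ≈⟨ +-congʳ (+-congˡ (trans (×-comm-* (length Ps) (v P) (ω * Π v Ps))
               (×-congʳ (length Ps) (solve 3 (λ v o p → v :* (o :* p) := o :* (v :* p)) refl _ _ _)))) ⟩
        (ω * (v P * Π v Ps) + length Ps ⋆ (ω * (v P * Π v Ps))) + (δ P * Π v Ps + v P * Δ v δ Ps) ∎

    -- An isolated component contributes only through the deviation δ of v
    -- from multiplicativity.
    splitTotal-derivation : ∀ y xs →
      splitTotal (weighted μ v) (x₀ ∷ y ∷ xs) ≈ splitTotal (λ Ps → μ (length Ps) * Δ v δ Ps) (y ∷ xs)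
    splitTotal-derivation y xs = trans (splitTotal-∷ _ x₀ (y ∷ xs)) (total-cong (splittings (y ∷ xs)) λ {Ps} Ps∈ → begin
      μ (suc (length Ps)) * (v (x₀ ∷ []) * Π v Ps) + inserted x₀ (weighted μ v) Ps
        ≈⟨ +-cong (*-congˡ (*-congʳ unit)) (trans (inserted-weighted μ v x₀ Ps) (*-congˡ (Δ-rule Ps))) ⟩
      μ (suc (length Ps)) * (ω * Π v Ps) + μ (length Ps) * (length Ps ⋆ (ω * Π v Ps) + Δ v δ Ps)
        ≈⟨ cancel (length Ps) (splittings-nonempty y xs Ps∈) ⟩
      μ (length Ps) * Δ v δ Ps ∎)
      where
      -- The first summand has x₀ as a part of its own, the second inserts it into one of the q
      -- parts. The relation `μ-suc` begins at q = 1, which is why the list must contain a further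
      -- element `y`.
      cancel : ∀ q {z d} → (∃ λ r → q ≡ suc r) → μ (suc q) * z + μ q * (q ⋆ z + d) ≈ μ q * d
      cancel q {z} {d} (r , ≡.refl) = begin
        μ (suc q) * z + μ q * (q ⋆ z + d)
          ≈⟨ +-congˡ (trans (distribˡ _ _ _) (+-congʳ (trans (×-comm-* q (μ q) z) (sym (×-assoc-* q (μ q) z))))) ⟩
        μ (suc q) * z + ((q ⋆ μ q) * z + μ q * d)
          ≈⟨ solve 4 (λ a z b e → a :* z :+ (b :* z :+ e) := (a :+ b) :* z :+ e) refl _ _ _ _ ⟩
        (μ (suc q) + q ⋆ μ q) * z + μ q * d
          ≈⟨ +-congʳ (trans (*-congʳ (μ-suc r)) (zeroˡ z)) ⟩
        0# + μ q * d
          ≈⟨ +-identityˡ _ ⟩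
        μ q * d ∎

-- What a component of J i j contributes to a block of a splitting: one of the
-- chords p₁p₂, p₃p₄ (for i = 0), the whole ladder, which counts as both, or
-- one of the parallel chords.
data Kind : Set where
  upper lower rails parallel : Kind

uppers lowers parallels : Kind → ℕ
uppers upper       = 1
uppers rails       = 1
uppers _           = 0
lowers lower       = 1
lowers rails       = 1
lowers _           = 0
parallels parallel = 1
parallels _        = 0

module _ {x} {X : Set x} where

  count : (X → ℕ) → List X → ℕ
  count n []       = 0
  count n (x ∷ xs) = n x ℕ.+ count n xs

  count-↭ : ∀ n {xs ys} → xs ↭ ys → count n xs ≡ count n ys
  count-↭ n ↭.refl         = ≡.refl
  count-↭ n (↭.prep x p)   = ≡.cong (n x ℕ.+_) (count-↭ n p)
  count-↭ n (↭.swap {xs} x y p) = ≡.trans (x∙yz≈y∙xz (n x) (n y) (count n xs)) (≡.cong (λ k → n y ℕ.+ (n x ℕ.+ k)) (count-↭ n p))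
    where open CommutativeSemigroupProperties ℕ.+-commutativeSemigroup using (x∙yz≈y∙xz)
  count-↭ n (↭.trans p q)  = ≡.trans (count-↭ n p) (count-↭ n q)


module _ {x} {X : Set x} where

  count-insertions : ∀ n (x : X) Ps {Rs} → Rs ∈ insertions x Ps → count (count n) Rs ≡ n x ℕ.+ count (count n) Ps
  count-insertions n x = insertions-induction (λ Ps Rs → count (count n) Rs ≡ n x ℕ.+ count (count n) Ps)
    (λ P Ps → ℕ.+-assoc (n x) (count n P) _)
    (λ P {Ps} eq → ≡.trans (≡.cong (count n P ℕ.+_) eq) (x∙yz≈y∙xz (count n P) (n x) (count (count n) Ps)))
    where open CommutativeSemigroupProperties ℕ.+-commutativeSemigroup using (x∙yz≈y∙xz)

  count-splittings : ∀ n (xs : List X) {Ps} → Ps ∈ splittings xs → count (count n) Ps ≡ count n xs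
  count-splittings n = splittings-induction (λ xs Ps → count (count n) Ps ≡ count n xs) ≡.refl
    (λ x {Ps = Ps} eq → ≡.cong₂ ℕ._+_ (ℕ.+-identityʳ (n x)) eq)
    (λ x {Ps = Ps} eq Rs∈ → ≡.trans (count-insertions n x Ps Rs∈) (≡.cong (n x ℕ.+_) eq))

count-none : ∀ (n : Kind → ℕ) → n parallel ≡ 0 → ∀ j → count n (replicate j parallel) ≡ 0
count-none n eq zero    = ≡.refl
count-none n eq (suc j) = ≡.cong₂ ℕ._+_ eq (count-none n eq j)

count-parallels : ∀ j → count parallels (replicate j parallel) ≡ j
count-parallels zero    = ≡.refl
count-parallels (suc j) = ≡.cong suc (count-parallels j)

bit : Bool → ℕ
bit b = if b then 1 else 0

-- At most one rail of a given kind occurs: nowhere, in the first block, or in a later one. The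
-- Booleans tell whether the later blocks contain it and whether all blocks together do.
data Share : ℕ → Bool → Bool → Set where
  neither  : Share 0 false false
  ours : Share 1 false true
  theirs : Share 0 true true

share : ∀ k {m} b → k ℕ.+ m ≡ bit b → ∃ λ b′ → m ≡ bit b′ × Share k b′ b
share 0 false eq = false , eq , neither
share 0 true eq = true , eq , theirs
share 1 true eq = false , ℕ.suc-injective eq , ours

-- Cumulants of two rails crossed by parallel chords

module _ {a ℓ} (A : CommutativeRing a ℓ) where

  open CommutativeRing A
  open SetoidReasoning setoid
  open NaturalSolver commutativeSemiring using (solve; _:=_; _:+_; _:*_)
  open Splittings A
  open import Algebra.Properties.Semiring.Mult semiring using () renaming (_×_ to _⋆_)

  -- The arguments are the numbers of upper rails, lower rails and parallel
  -- chords in a block; no block has two rails of the same kind.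
  table : (z₀₀ z₁₀ z₀₁ z₁₁ : ℕ → Carrier) → ℕ → ℕ → ℕ → Carrier
  table z₀₀ z₁₀ z₀₁ z₁₁ 0 0 = z₀₀
  table z₀₀ z₁₀ z₀₁ z₁₁ 1 0 = z₁₀
  table z₀₀ z₁₀ z₀₁ z₁₁ 0 1 = z₀₁
  table z₀₀ z₁₀ z₀₁ z₁₁ 1 1 = z₁₁
  table z₀₀ z₁₀ z₀₁ z₁₁ _ _ = λ _ → 0#

  blockValue : (ℕ → ℕ → ℕ → Carrier) → List Kind → Carrier
  blockValue z P = z (count uppers P) (count lowers P) (count parallels P)

  blockValue-↭ : ∀ z {P Q} → P ↭ Q → blockValue z P ≈ blockValue z Q
  blockValue-↭ z {P} p
    rewrite count-↭ uppers p | count-↭ lowers p | count-↭ parallels p = refl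

  -- `p s`, `q s` and `f s` are the values of a block with `s` parallel chords and no rail, one rail
  -- or both rails, and `g s` that of the ladder with one more rung; `h` is 1/2λ. The recursions are
  -- written without subtraction.
  module _ {μ : ℕ → Carrier} (μ-suc : ∀ q → μ (suc (suc q)) + suc q ⋆ μ (suc q) ≈ 0#)
    (p q f g : ℕ → Carrier) {ω h : Carrier}
    (p-zero : p 0 ≈ 1#) (p-suc : ∀ s → p (suc s) ≈ ω * p s)
    (q-suc : ∀ s → q (suc s) + h * q s ≈ ω * q s)
    (f-suc : ∀ s → f (suc s) + (h * f s + h * f s) ≈ g s + ω * f s) where

    -- By vanishing on single rails, `new` discards the splittings that separate them, in accordance
    -- with the longer ladder being one component. `glued` is an auxiliary value in which `lower`
    -- alone stands for the whole ladder, halfway from `upper ∷ lower` to `rails`.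
    old new glued : List Kind → Carrier
    old   = blockValue (table p q q f)
    new   = blockValue (table p (λ _ → 0#) (λ _ → 0#) g)
    glued = blockValue (table p (λ _ → 0#) g (λ _ → 0#))

    private
      zero-rule : 0# ≈ ω * 0# + 0#
      zero-rule = sym (trans (+-identityʳ _) (zeroʳ ω))

      -- What remains of the recursions after ω times the old value is subtracted: nothing from
      -- `p-suc`, -h q from `q-suc`, g - 2 h f from `f-suc`.
      deviation : ℕ → ℕ → ℕ → Carrier
      deviation = table (λ _ → 0#) (λ s → - (h * q s)) (λ s → - (h * q s)) (λ s → g s - (h * f s + h * f s))

      isolate : ∀ {x y z} → x + y ≈ z → x ≈ z - y
      isolate {x} {y} {z} eq = begin
        x               ≈⟨ trans (+-congˡ (-‿inverseʳ y)) (+-identityʳ x) ⟨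
        x + (y - y)     ≈⟨ +-assoc _ _ _ ⟨
        (x + y) - y     ≈⟨ +-congʳ eq ⟩
        z - y ∎

      rule : ∀ x y s → table p q q f x y (suc s) ≈ ω * table p q q f x y s + deviation x y s
      rule 0 0 s = trans (p-suc s) (sym (+-identityʳ _))
      rule 1 0 s = isolate (q-suc s)
      rule 0 1 s = isolate (q-suc s)
      rule 1 1 s = trans (isolate (f-suc s)) (trans (+-congʳ (+-comm _ _)) (+-assoc _ _ _))
      rule 0 (suc (suc _)) s = zero-rule
      rule 1 (suc (suc _)) s = zero-rule
      rule (suc (suc _)) 0 s = zero-rule
      rule (suc (suc _)) 1 s = zero-rule
      rule (suc (suc _)) (suc (suc _)) s = zero-rule

      δ : List Kind → Carrier
      δ = blockValue deviation

      -- The Booleans say which rails the blocks contain. A rail that is alone in its block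
      -- contributes -h u to `d`. With both rails, adding 2 h u therefore gives 0 if they are
      -- separated; if they share a block, it cancels the -2 h f there and leaves the product with
      -- g.
      Claim : Bool → Bool → (Πold Πnew Δold : Carrier) → Set ℓ
      Claim false false u v d = d ≈ 0# × v ≈ u
      Claim true  false u v d = d + h * u ≈ 0# × v ≈ 0#
      Claim false true  u v d = d + h * u ≈ 0# × v ≈ 0#
      Claim true  true  u v d = d + (h * u + h * u) ≈ v

      one-rail : ∀ {s d u} → d ≈ 0# → (- (h * q s) * u + q s * d) + h * (q s * u) ≈ 0#
      one-rail {s} {d} {u} d≈0 = begin
        (- (h * q s) * u + q s * d) + h * (q s * u)
          ≈⟨ solve 5 (λ n h q u d → (n :* u :+ q :* d) :+ h :* (q :* u) := (n :+ h :* q) :* u :+ q :* d)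
               refl (- (h * q s)) h (q s) u d ⟩
        (- (h * q s) + h * q s) * u + q s * d   ≈⟨ +-cong (*-congʳ (-‿inverseˡ _)) (*-congˡ d≈0) ⟩
        0# * u + q s * 0#                       ≈⟨ +-cong (zeroˡ u) (zeroʳ _) ⟩
        0# + 0#                                 ≈⟨ +-identityˡ 0# ⟩
        0# ∎

      no-rail : ∀ {s d u v} → d + h * u ≈ 0# → v ≈ 0# → (0# * u + p s * d) + h * (p s * u) ≈ 0# × p s * v ≈ 0#
      no-rail {s} {d} {u} eq v≈0 = (begin
        (0# * u + p s * d) + h * (p s * u)   ≈⟨ +-congʳ (trans (+-congʳ (zeroˡ u)) (+-identityˡ _)) ⟩
        p s * d + h * (p s * u)              ≈⟨ solve 4 (λ p d h u → p :* d :+ h :* (p :* u) := p :* (d :+ h :* u)) refl _ _ _ _ ⟩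
        p s * (d + h * u)                    ≈⟨ trans (*-congˡ eq) (zeroʳ _) ⟩
        0# ∎) , trans (*-congˡ v≈0) (zeroʳ _)

      split-rails : ∀ {s d u} → d + h * u ≈ 0# →
        (- (h * q s) * u + q s * d) + (h * (q s * u) + h * (q s * u)) ≈ 0#
      split-rails {s} {d} {u} eq = begin
        (- (h * q s) * u + q s * d) + (h * (q s * u) + h * (q s * u))
          ≈⟨ solve 5 (λ n h q u d → (n :* u :+ q :* d) :+ (h :* (q :* u) :+ h :* (q :* u)) := (n :+ h :* q) :* u :+ q :* (d :+ h :* u))
               refl (- (h * q s)) h (q s) u d ⟩
        (- (h * q s) + h * q s) * u + q s * (d + h * u)   ≈⟨ +-cong (*-congʳ (-‿inverseˡ _)) (*-congˡ eq) ⟩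
        0# * u + q s * 0#                       ≈⟨ +-cong (zeroˡ u) (zeroʳ _) ⟩
        0# + 0#                                 ≈⟨ +-identityˡ 0# ⟩
        0# ∎

      both-rails : ∀ {s d u v} → d ≈ 0# → v ≈ u →
        ((g s - (h * f s + h * f s)) * u + f s * d) + (h * (f s * u) + h * (f s * u)) ≈ g s * v
      both-rails {s} {d} {u} {v} d≈0 v≈u = begin
        ((g s - (h * f s + h * f s)) * u + f s * d) + (h * (f s * u) + h * (f s * u))
          ≈⟨ solve 6 (λ g n h f u d → ((g :+ n) :* u :+ f :* d) :+ (h :* (f :* u) :+ h :* (f :* u)) :=
               (g :+ (n :+ (h :* f :+ h :* f))) :* u :+ f :* d) refl (g s) (- (h * f s + h * f s)) h (f s) u d ⟩
        (g s + (- (h * f s + h * f s) + (h * f s + h * f s))) * u + f s * d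
          ≈⟨ +-cong (*-congʳ (trans (+-congˡ (-‿inverseˡ _)) (+-identityʳ _))) (trans (*-congˡ d≈0) (zeroʳ _)) ⟩
        g s * u + 0#                ≈⟨ +-identityʳ _ ⟩
        g s * u                     ≈⟨ *-congˡ v≈u ⟨
        g s * v ∎

      claim-∷ : ∀ {x α′ α y β′ β} s {u v d} → Share x α′ α → Share y β′ β → Claim α′ β′ u v d →
        Claim α β (table p q q f x y s * u) (table p (λ _ → 0#) (λ _ → 0#) g x y s * v)
          (deviation x y s * u + table p q q f x y s * d)
      claim-∷ s neither   neither   (d≈0 , v≈u) = trans (+-cong (zeroˡ _) (trans (*-congˡ d≈0) (zeroʳ _))) (+-identityˡ 0#) , *-congˡ v≈u
      claim-∷ s ours  neither   (d≈0 , v≈u) = one-rail d≈0 , zeroˡ _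
      claim-∷ s neither   ours  (d≈0 , v≈u) = one-rail d≈0 , zeroˡ _
      claim-∷ s ours  ours  (d≈0 , v≈u) = both-rails d≈0 v≈u
      claim-∷ s theirs neither   (eq , v≈0)  = no-rail eq v≈0
      claim-∷ s neither   theirs (eq , v≈0)  = no-rail eq v≈0
      claim-∷ s ours  theirs (eq , v≈0)  = trans (split-rails eq) (sym (zeroˡ _))
      claim-∷ s theirs ours  (eq , v≈0)  = trans (split-rails eq) (sym (zeroˡ _))
      claim-∷ s theirs theirs eq          = begin
        (0# * _ + p s * _) + (h * (p s * _) + h * (p s * _))
          ≈⟨ trans (+-congʳ (trans (+-congʳ (zeroˡ _)) (+-identityˡ _)))
               (solve 4 (λ p d h u → p :* d :+ (h :* (p :* u) :+ h :* (p :* u)) := p :* (d :+ (h :* u :+ h :* u))) refl (p s) _ h _) ⟩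
        p s * (_ + (h * _ + h * _))  ≈⟨ *-congˡ eq ⟩
        p s * _ ∎

      claim : ∀ Ps α β → count (count uppers) Ps ≡ bit α → count (count lowers) Ps ≡ bit β →
        Claim α β (Π old Ps) (Π new Ps) (Δ old δ Ps)
      claim [] false false _ _ = refl , refl
      claim (P ∷ Ps) α β eq₁ eq₂
        with α′ , eq₁′ , s₁ ← share (count uppers P) α eq₁ | β′ , eq₂′ , s₂ ← share (count lowers P) β eq₂ =
        claim-∷ (count parallels P) s₁ s₂ (claim Ps α′ β′ eq₁′ eq₂′)

    -- Pulling out the chord replaces every product by its deviation, and the multiples of `h`
    -- complete this to the product of `new` values, splitting by splitting.
    splitTotal-parallel : ∀ x xs → count uppers (x ∷ xs) ≡ 1 → count lowers (x ∷ xs) ≡ 1 →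
      splitTotal (weighted μ old) (parallel ∷ x ∷ xs) +
        (h * splitTotal (weighted μ old) (x ∷ xs) + h * splitTotal (weighted μ old) (x ∷ xs)) ≈
      splitTotal (weighted μ new) (x ∷ xs)
    splitTotal-parallel x xs eq₁ eq₂ = begin
      splitTotal (weighted μ old) (parallel ∷ x ∷ xs) + (h * S + h * S)
        ≈⟨ +-cong (splitTotal-derivation {μ = μ} μ-suc {v = old} {δ} {ω} {parallel} (trans (p-suc 0) (trans (*-congˡ p-zero) (*-identityʳ ω)))
             (λ P → rule (count uppers P) (count lowers P) (count parallels P)) x xs)
             (+-cong (sym (total-* h (weighted μ old) (splittings (x ∷ xs)))) (sym (total-* h (weighted μ old) (splittings (x ∷ xs))))) ⟩
      splitTotal (λ Ps → μ (length Ps) * Δ old δ Ps) (x ∷ xs) +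
        (splitTotal (λ Ps → h * weighted μ old Ps) (x ∷ xs) + splitTotal (λ Ps → h * weighted μ old Ps) (x ∷ xs))
        ≈⟨ trans (+-congˡ (sym (total-+ _ _ (splittings (x ∷ xs))))) (sym (total-+ _ _ (splittings (x ∷ xs)))) ⟩
      splitTotal (λ Ps → μ (length Ps) * Δ old δ Ps + (h * weighted μ old Ps + h * weighted μ old Ps)) (x ∷ xs)
        ≈⟨ total-cong (splittings (x ∷ xs)) (λ {Ps} Ps∈ → trans
             (solve 4 (λ m d h u → m :* d :+ (h :* (m :* u) :+ h :* (m :* u)) := m :* (d :+ (h :* u :+ h :* u))) refl _ _ h _)
             (*-congˡ (claim Ps true true (≡.trans (count-splittings uppers (x ∷ xs) Ps∈) eq₁)
               (≡.trans (count-splittings lowers (x ∷ xs) Ps∈) eq₂)))) ⟩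
      splitTotal (weighted μ new) (x ∷ xs) ∎
      where S = splitTotal (weighted μ old) (x ∷ xs)

    private
      Glue : Bool → (Πnew Πglued Δnew : Carrier) → Set ℓ
      Glue false u v d = v ≈ u × d ≈ 0#
      Glue true  u v d = d ≈ v

      -- The block containing the lower rail is the one that receives the upper.
      glue : ∀ Ps β → count (count uppers) Ps ≡ 0 → count (count lowers) Ps ≡ bit β →
        Glue β (Π new Ps) (Π glued Ps) (Δ new (new ∘ (upper ∷_)) Ps)
      glue []       false _ _ = refl , refl
      glue (P ∷ Ps) β eq₁ eq₂
        with count uppers P | count lowers P | share (count uppers P) false eq₁ | share (count lowers P) β eq₂
      ... | _ | _ | _ , eq₁′ , neither | false , eq₂′ , neither =
        let v≈u , d≈0 = glue Ps false eq₁′ eq₂′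
        in *-congˡ v≈u , trans (+-cong (zeroˡ _) (trans (*-congˡ d≈0) (zeroʳ _))) (+-identityˡ 0#)
      ... | _ | _ | _ , eq₁′ , neither | true , eq₂′ , theirs =
        trans (+-cong (zeroˡ _) (*-congˡ (glue Ps true eq₁′ eq₂′))) (+-identityˡ _)
      ... | _ | _ | _ , eq₁′ , neither | false , eq₂′ , ours =
        trans (+-cong (*-congˡ (sym (proj₁ (glue Ps false eq₁′ eq₂′)))) (zeroˡ _)) (+-identityʳ _)

      glue-insert : ∀ Ps → count (count uppers) Ps ≡ 0 → count (count lowers) Ps ≡ 0 →
        Π glued Ps ≈ Π new Ps × Δ glued (glued ∘ (lower ∷_)) Ps ≈ Δ new (new ∘ (rails ∷_)) Ps
      glue-insert []       _ _ = refl , refl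
      glue-insert (P ∷ Ps) eq₁ eq₂
        with count uppers P | count lowers P | share (count uppers P) false eq₁ | share (count lowers P) false eq₂
      ... | _ | _ | _ , eq₁′ , neither | _ , eq₂′ , neither =
        let v≈u , d≈d′ = glue-insert Ps eq₁′ eq₂′
        in *-congˡ v≈u , +-cong (*-congˡ v≈u) (*-congˡ d≈d′)

    -- `new` vanishes unless `upper` and `lower` share a part, and such splittings correspond to
    -- those in which the pair is a single element `rails`.
    splitTotal-glue : ∀ xs → count uppers xs ≡ 0 → count lowers xs ≡ 0 →
      splitTotal (weighted μ new) (upper ∷ lower ∷ xs) ≈ splitTotal (weighted μ new) (rails ∷ xs)
    splitTotal-glue xs eq₁ eq₂ = begin
      splitTotal (weighted μ new) (upper ∷ lower ∷ xs)
        ≈⟨ splitTotal-∷ _ upper (lower ∷ xs) ⟩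
      splitTotal (added upper (weighted μ new)) (lower ∷ xs)
        ≈⟨ total-cong (splittings (lower ∷ xs)) (λ {Qs} Qs∈ → trans
             (+-cong (trans (*-congˡ (zeroˡ _)) (zeroʳ _)) (trans (inserted-weighted μ new upper Qs)
               (*-congˡ (glue Qs true (≡.trans (count-splittings uppers (lower ∷ xs) Qs∈) eq₁)
                 (≡.trans (count-splittings lowers (lower ∷ xs) Qs∈) (≡.cong suc eq₂))))))
             (+-identityˡ _)) ⟩
      splitTotal (weighted μ glued) (lower ∷ xs)
        ≈⟨ splitTotal-∷ _ lower xs ⟩
      splitTotal (added lower (weighted μ glued)) xs
        ≈⟨ total-cong (splittings xs) (λ {Ps} Ps∈ →
             let v≈u , d≈d′ = glue-insert Ps (≡.trans (count-splittings uppers xs Ps∈) eq₁)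
                                             (≡.trans (count-splittings lowers xs Ps∈) eq₂)
             in +-cong (*-congˡ (*-congˡ v≈u))
                  (trans (inserted-weighted μ glued lower Ps) (trans (*-congˡ d≈d′) (sym (inserted-weighted μ new rails Ps))))) ⟩
      splitTotal (added rails (weighted μ new)) xs
        ≈⟨ splitTotal-∷ _ rails xs ⟨
      splitTotal (weighted μ new) (rails ∷ xs) ∎

    private
      chords : ℕ → List Kind
      chords j = replicate j parallel

      old-respectful : Respectful (weighted μ old)
      old-respectful = weighted-respectful μ (blockValue-↭ (table p q q f))

    splitTotal-ladder : ∀ j →
      splitTotal (weighted μ old) (rails ∷ chords (suc j)) +
        (h * splitTotal (weighted μ old) (rails ∷ chords j) + h * splitTotal (weighted μ old) (rails ∷ chords j)) ≈
      splitTotal (weighted μ new) (rails ∷ chords j)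
    splitTotal-ladder j = trans (+-congʳ (splitTotal-↭ {xs = rails ∷ chords (suc j)} {parallel ∷ rails ∷ chords j} old-respectful (↭.swap rails parallel ↭-refl)))
      (splitTotal-parallel rails (chords j) (≡.cong suc (count-none uppers ≡.refl j)) (≡.cong suc (count-none lowers ≡.refl j)))

    -- The case without rungs on the left, where the rails are two components; on the right the
    -- first rung has joined them.
    splitTotal-chords : ∀ j →
      splitTotal (weighted μ old) (upper ∷ lower ∷ chords (suc j)) +
        (h * splitTotal (weighted μ old) (upper ∷ lower ∷ chords j) + h * splitTotal (weighted μ old) (upper ∷ lower ∷ chords j)) ≈
      splitTotal (weighted μ new) (rails ∷ chords j)
    splitTotal-chords j = trans (+-congʳ (splitTotal-↭ {xs = upper ∷ lower ∷ chords (suc j)} {parallel ∷ upper ∷ lower ∷ chords j} old-respectful (shift parallel (upper ∷ lower ∷ []) (chords j))))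
      (trans (splitTotal-parallel upper (lower ∷ chords j) (≡.cong suc (count-none uppers ≡.refl j)) (≡.cong suc (count-none lowers ≡.refl j)))
             (splitTotal-glue (chords j) (count-none uppers ≡.refl j) (count-none lowers ≡.refl j)))

-- Subdiagrams of J i j

module _ where

  open ≡ using (refl; sym; trans)

  module _ {a p} {A : Set a} {Q : Pred A p} (Q? : Decidable Q) where

    filter-reverse : ∀ xs → filter Q? (reverse xs) ≡ reverse (filter Q? xs)
    filter-reverse []       = refl
    filter-reverse (x ∷ xs) = trans (cong (filter Q?) (unfold-reverse x xs))
      (trans (filter-++ Q? (reverse xs) (x ∷ [])) (trans (cong (_++ filter Q? (x ∷ [])) (filter-reverse xs)) last))
      where
      last : reverse (filter Q? xs) ++ filter Q? (x ∷ []) ≡ reverse (filter Q? (x ∷ xs))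
      last with Q? x
      ... | yes _ = sym (unfold-reverse x (filter Q? xs))
      ... | no _  = ++-identityʳ _

    filter-sublist : ∀ {ys xs} → Unique xs → ys ⊆ xs → (∀ {e} → e ∈ xs → Q e → e ∈ ys) → (∀ {e} → e ∈ ys → Q e) →
      filter Q? xs ≡ ys
    filter-sublist []       []        only kept = refl
    filter-sublist (x≢ ∷ u) (x ∷ʳ p)  only kept =
      trans (filter-reject Q? (λ q → All.lookup x≢ (Sublist.lookup p (only (here refl) q)) refl))
        (filter-sublist u p (only ∘ there) kept)
    filter-sublist (x≢ ∷ u) (refl ∷ p) only kept =
      trans (filter-accept Q? (kept (here refl))) (cong₂ _∷_ refl (filter-sublist u p only′ (kept ∘ there)))
      where
      only′ : ∀ {e} → _ → Q e → _
      only′ e∈ q with only (there e∈) q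
      ... | here refl = ⊥-elim (All.lookup x≢ e∈ refl)
      ... | there e∈′ = e∈′

  deduplicate-unique : ∀ {xs : List Edge} → Unique xs → deduplicate _≟ᵉ_ xs ≡ xs
  deduplicate-unique []       = refl
  deduplicate-unique {x ∷ xs} (x≢ ∷ u) = cong (x ∷_)
    (trans (cong (filter (¬? ∘ (x ≟ᵉ_))) (deduplicate-unique u)) (filter-all (¬? ∘ (x ≟ᵉ_)) x≢))

  deduplicate-replicate : ∀ n x {ys} → Unique (x ∷ ys) → deduplicate _≟ᵉ_ (replicate (suc n) x ++ ys) ≡ x ∷ ys
  deduplicate-replicate zero    x u = deduplicate-unique u
  deduplicate-replicate (suc n) x {ys} u@(x≢ ∷ _) = cong (x ∷_)
    (trans (cong (filter (¬? ∘ (x ≟ᵉ_))) (deduplicate-replicate n x u))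
      (trans (filter-reject (¬? ∘ (x ≟ᵉ_)) (λ ¬eq → ¬eq refl)) (filter-all (¬? ∘ (x ≟ᵉ_)) x≢)))

  map-constant : ∀ {a b} {A : Set a} {B : Set b} (f : A → B) {y} xs → (∀ {x} → x ∈ xs → f x ≡ y) → map f xs ≡ replicate (length xs) y
  map-constant f []       p = refl
  map-constant f (x ∷ xs) p = cong₂ _∷_ (p (here refl)) (map-constant f xs (p ∘ there))

  -- Parts inherit the order of the list, so the form of a subdiagram can be found by matching on
  -- the sublist relation.
  splittings-sublists : ∀ {a} {A : Set a} (xs : List A) {Ps} → Ps ∈ splittings xs → All (_⊆ xs) Ps
  splittings-sublists = splittings-induction (λ xs Ps → All (_⊆ xs) Ps) []
    (λ x ps → (refl ∷ Sublist.minimum _) ∷ All.map (x ∷ʳ_) ps)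
    (λ x {xs} {Ps} ps Rs∈ → insertions-induction (λ Ps Rs → All (_⊆ xs) Ps → All (_⊆ (x ∷ xs)) Rs)
      (λ { P Ps (p ∷ ps) → (refl ∷ p) ∷ All.map (x ∷ʳ_) ps })
      (λ { P rec (p ∷ ps) → (x ∷ʳ p) ∷ rec ps }) Ps Rs∈ ps)

  module _ {a b} {A : Set a} {B : Set b} (f : A → B) where

    insertions-map : ∀ x Ps → insertions (f x) (map (map f) Ps) ≡ map (map (map f)) (insertions x Ps)
    insertions-map x []       = refl
    insertions-map x (P ∷ Ps) = cong₂ _∷_ refl (trans (cong (map (map f P ∷_)) (insertions-map x Ps))
      (trans (sym (map-∘ (insertions x Ps))) (map-∘ (insertions x Ps))))

    splittings-map : ∀ xs → splittings (map f xs) ≡ map (map (map f)) (splittings xs)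
    splittings-map []       = refl
    splittings-map (x ∷ xs) = trans (cong (concatMap _) (splittings-map xs))
      (trans (concatMap-map _ (map (map f)) (splittings xs))
        (trans (concatMap-cong (λ Ps → cong₂ _∷_ refl (insertions-map x Ps)) (splittings xs))
          (sym (map-concatMap (map (map f)) _ (splittings xs)))))

  relabel : List Edge → List Edge → Edge → Edge
  relabel (x ∷ X) (y ∷ Y) e = if does (e ≟ᵉ x) then y else relabel X Y e
  relabel _       _       e = e

  relabel-fixed : ∀ X Y {e} → e ∉ X → relabel X Y e ≡ e
  relabel-fixed []      _       e∉ = refl
  relabel-fixed (x ∷ X) []      e∉ = refl
  relabel-fixed (x ∷ X) (y ∷ Y) {e} e∉ rewrite dec-false (e ≟ᵉ x) (e∉ ∘ here) = relabel-fixed X Y (e∉ ∘ there)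

  relabel-map : ∀ {X Y} → Unique X → length X ≡ length Y → map (relabel X Y) X ≡ Y
  relabel-map {[]}    {[]}    u eq = refl
  relabel-map {x ∷ X} {y ∷ Y} (x≢ ∷ u) eq = cong₂ _∷_ first
    (trans (map-cong-local (All.tabulate other)) (relabel-map u (ℕ.suc-injective eq)))
    where
    first : relabel (x ∷ X) (y ∷ Y) x ≡ y
    first rewrite dec-true (x ≟ᵉ x) refl = refl
    other : ∀ {e} → e ∈ X → relabel (x ∷ X) (y ∷ Y) e ≡ relabel X Y e
    other {e} e∈ rewrite dec-false (e ≟ᵉ x) (λ { refl → All.lookup x≢ e∈ refl }) = refl

  -- The possible names of chords crossing `ladder k`: an original chord, or `rung k`, the rung that
  -- `ladder-step` turns into a chord. Neither occurs in `ladder k`, whose rungs have numbers below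
  -- `k`.
  data Fresh (k : ℕ) : Edge → Set where
    isChord  : ∀ {t} → Fresh k (chord t)
    nextRung : Fresh k (rung k)

  -- The word of J k j, with the chords named by X.
  openWord : ℕ → List Edge → List Edge
  openWord k X = up k ∷ X ++ up 0 ∷ low 0 ∷ reverse X ++ low k ∷ []

  chords-reversed : ∀ j → map chord (downFrom j) ≡ reverse (map chord (upTo j))
  chords-reversed j = trans (cong (map chord) (sym (reverse-upTo j))) (reverse-map chord (upTo j))

  wordJ-open : ∀ k j → wordJ k j ≡ openWord k (map chord (upTo j))
  wordJ-open k j = cong (λ B → up k ∷ map chord (upTo j) ++ up 0 ∷ low 0 ∷ B ++ low k ∷ []) (chords-reversed j)

  openWord-rotated : ∀ k X → openWord k X ≡ (up k ∷ X ++ up 0 ∷ []) ++ low 0 ∷ reverse X ++ low k ∷ []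
  openWord-rotated k X = cong (up k ∷_) (sym (++-assoc X _ _))

  ladderWord-rotated : ∀ k X → ladderWord k X ≡ (low 0 ∷ reverse X ++ low k ∷ []) ++ up k ∷ X ++ up 0 ∷ []
  ladderWord-rotated k X = cong (low 0 ∷_) (sym (++-assoc (reverse X) _ _))

  chords-unique : ∀ j → Unique (map chord (downFrom j))
  chords-unique j = Unique.map⁺ (∷-injectiveˡ ∘ ∷-injectiveʳ) (Unique.downFrom⁺ j)

  ladder-relabel : ∀ k X Y → All (Fresh k) X → ladder k ≡ map (mapᵛ (relabel X Y)) (ladder k)
  ladder-relabel k X Y fresh = go k ℕ.≤-refl
    where
    rail : ∀ {e} → ¬ Fresh k e → e ≡ relabel X Y e
    rail ¬f = sym (relabel-fixed X Y (¬f ∘ All.lookup fresh))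
    go : ∀ t → t ℕ.≤ k → ladder t ≡ map (mapᵛ (relabel X Y)) (ladder t)
    go zero    _   = refl
    go (suc t) t<k = cong₂ _∷_ (cong₂ _,_ (rail (λ ())) (cong₂ _,_ (rail (λ ())) r))
      (cong₂ _∷_ (cong₂ _,_ r (cong₂ _,_ (rail (λ ())) (rail (λ ())))) (go t (ℕ.<⇒≤ t<k)))
      where
      r : rung t ≡ relabel X Y (rung t)
      r = rail (λ { nextRung → ℕ.<-irrefl refl t<k })

  rename-chords : ∀ k X D → Unique X → All (Fresh k) X → word D ≡ openWord k X → vertices D ≡ ladder k → D ≅ J k (length X)
  rename-chords k X D unique fresh word-D vertices-D = record
    { rename        = ρ
    ; before        = []
    ; after         = word D
    ; word-split    = refl
    ; word-rotated  = trans (wordJ-open k (length X)) (sym (trans (cong (map ρ) (trans (++-identityʳ _) word-D)) relabelled))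
    ; same-vertices = ↭⇒↻ (↭-reflexive (trans (cong (map (mapᵛ ρ)) vertices-D) (sym (ladder-relabel k X A fresh)))) }
    where
    A = map chord (upTo (length X))
    ρ = relabel X A
    chords : map ρ X ≡ A
    chords = relabel-map unique (sym (trans (length-map chord (upTo (length X))) (length-upTo (length X))))
    fixed : ∀ {e} → ¬ Fresh k e → ρ e ≡ e
    fixed ¬f = relabel-fixed X A (¬f ∘ All.lookup fresh)
    relabelled : map ρ (openWord k X) ≡ openWord k A
    relabelled = cong₂ _∷_ (fixed (λ ())) (trans (map-++ ρ X _) (cong₂ _++_ chords
      (cong₂ _∷_ (fixed (λ ())) (cong₂ _∷_ (fixed (λ ())) (trans (map-++ ρ (reverse X) _)
        (cong₂ _++_ (trans (reverse-map ρ X) (cong reverse chords)) (cong (_∷ []) (fixed (λ ())))))))))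

  -- The head of an edge is its type: 0 and 1 for the rails, 2 for rungs, 3 for parallel chords.
  -- Without rungs the rails are separate components; with rungs everything but type 3 belongs to
  -- the ladder.
  chordKind ladderKind : Edge → Kind
  chordKind (0 ∷ _)  = upper
  chordKind (1 ∷ _)  = lower
  chordKind _        = parallel
  ladderKind (3 ∷ _) = parallel
  ladderKind _       = rails

  kind : ℕ → Edge → Kind
  kind zero    = chordKind
  kind (suc _) = ladderKind

  kind-chord : ∀ k t → kind k (chord t) ≡ parallel
  kind-chord zero    t = refl
  kind-chord (suc k) t = refl

  ladder-rails : ∀ k → All (λ v → All (λ e → ladderKind e ≡ rails) (halves v)) (ladder k)
  ladder-rails zero    = []
  ladder-rails (suc k) = (refl ∷ refl ∷ refl ∷ []) ∷ (refl ∷ refl ∷ refl ∷ []) ∷ ladder-rails k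

  meet-rails : ∀ k {e e′} → Meet (ladder k) e e′ → ladderKind e ≡ rails × ladderKind e′ ≡ rails
  meet-rails k m with v , v∈ , e∈ , e′∈ ← find m =
    All.lookup (All.lookup (ladder-rails k) v∈) e∈ , All.lookup (All.lookup (ladder-rails k) v∈) e′∈

  linked-rails : ∀ k {e e′} → Linked (ladder k) e e′ → ladderKind e ≡ rails → ladderKind e′ ≡ rails
  linked-rails k ε           r = r
  linked-rails k (fwd m ◅ p) r = linked-rails k p (proj₂ (meet-rails k m))
  linked-rails k (bwd m ◅ p) r = linked-rails k p (proj₁ (meet-rails k m))

  rep-chord : ∀ k t → rep (ladder k) (chord t) ≡ chord t
  rep-chord k t = sym (isolated (rep-linked (ladder k) (chord t)))
    where
    isolated : ∀ {e} → Linked (ladder k) (chord t) e → chord t ≡ e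
    isolated ε           = refl
    isolated (fwd m ◅ _) with () ← proj₁ (meet-rails k m)
    isolated (bwd m ◅ _) with () ← proj₂ (meet-rails k m)

  -- Which edge `rep` picks for the ladder is never computed; it is enough that this edge is linked
  -- to `up 0` and hence is not a chord.
  root : ℕ → Edge
  root k = rep (ladder (suc k)) (up 0)

  root-rails : ∀ k → ladderKind (root k) ≡ rails
  root-rails k = linked-rails (suc k) (rep-linked (ladder (suc k)) (up 0)) refl

  root-fresh : ∀ k j → root k ∉ map chord (downFrom j)
  root-fresh k j r∈ with ∈-map⁻ chord r∈
  ... | t , _ , eq with () ← trans (sym (root-rails k)) (cong (ladderKind) eq)

  rails-linked : ∀ k {e} → e ∈ railEdges (suc k) → Linked (ladder (suc k)) e (up 0)
  rails-linked k e∈ with ∈-++⁻ (map up (downFrom (suc (suc k)))) e∈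
  ... | inj₁ u∈ with _ , t∈ , refl ← ∈-map⁻ up u∈ = up-linked (suc k) t∈
  ... | inj₂ e∈′ with ∈-++⁻ (map low (downFrom (suc (suc k)))) e∈′
  ...   | inj₁ l∈ with _ , t∈ , refl ← ∈-map⁻ low l∈ =
    -- The lower rail reaches the upper one through the last rung.
    low-linked (suc k) t∈ ◅◅ EqClosure.symmetric _ (low-linked (suc k) (here refl))
    ◅◅ fwd (there (here (there (there (here refl)) , here refl))) ◅ rung-linked (suc k) (here refl)
  ...   | inj₂ r∈ with _ , t∈ , refl ← ∈-map⁻ rung r∈ = rung-linked (suc k) t∈

  rep-rails : ∀ k {e} → e ∈ railEdges (suc k) → rep (ladder (suc k)) e ≡ root k
  rep-rails k = linked⇒rep ∘ rails-linked k

  edgesJ-split : ∀ k j → edgesJ k j ≡ railEdges k ++ map chord (downFrom j)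
  edgesJ-split k j = sym (trans (++-assoc V (L ++ N) C) (cong (V ++_) (++-assoc L N C)))
    where
    V = map up (downFrom (suc k))
    L = map low (downFrom (suc k))
    N = map rung (downFrom k)
    C = map chord (downFrom j)

  components-zero : ∀ j → components (J 0 j) ≡ up 0 ∷ low 0 ∷ map chord (downFrom j)
  components-zero j = trans (cong (deduplicate _≟ᵉ_) (map-id (edgesJ 0 j))) (deduplicate-unique (uniqueJ 0 j))

  components-suc : ∀ k j → components (J (suc k) j) ≡ root k ∷ map chord (downFrom j)
  components-suc k j = trans (cong (deduplicate _≟ᵉ_) (trans (cong (map ρ) (edgesJ-split (suc k) j))
      (trans (map-++ ρ (railEdges (suc k)) C) (cong₂ _++_ (map-constant ρ (railEdges (suc k)) (rep-rails k))
        (map-id-local (All.map⁺ (All.tabulate λ {t} _ → rep-chord (suc k) t)))))))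
    (deduplicate-replicate (length (map up (downFrom (suc k)) ++ map low (downFrom (suc (suc k))) ++ map rung (downFrom (suc k)))) (root k) (All.tabulate (λ e∈ → λ { refl → root-fresh k j e∈ }) ∷ chords-unique j))
    where
    ρ = rep (ladder (suc k))
    C = map chord (downFrom j)

  ChordList : List Edge → Set
  ChordList P = Unique P × All (λ e → ∃ λ t → e ≡ chord t) P

  -- The subdiagrams of J k j, with the parallel chords P and ks the kinds of
  -- the components.
  data Shape (D : Diagram) (ks : List Kind) : ℕ → Set where
    noRails   : ∀ {k} P → ChordList P → ks ≡ replicate (length P) parallel →
      vertices D ≡ [] → word D ≡ reverse P ++ P → Shape D ks k
    upperRail : ∀ P → ChordList P → ks ≡ upper ∷ replicate (length P) parallel →
      vertices D ≡ [] → word D ≡ up 0 ∷ reverse P ++ up 0 ∷ P → Shape D ks 0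
    lowerRail : ∀ P → ChordList P → ks ≡ lower ∷ replicate (length P) parallel →
      vertices D ≡ [] → word D ≡ reverse P ++ low 0 ∷ P ++ low 0 ∷ [] → Shape D ks 0
    bothRails : ∀ {k} P → ChordList P → count uppers ks ≡ 1 → count lowers ks ≡ 1 → count parallels ks ≡ length P →
      vertices D ≡ ladder k → word D ≡ openWord k (reverse P) → Shape D ks k

  chordList : ∀ {j P} → P ⊆ map chord (downFrom j) → ChordList P
  chordList {j} p = unique-⊆ p (chords-unique j) , All.tabulate (λ e∈ →
    let t , _ , eq = ∈-map⁻ chord (Sublist.lookup p e∈) in t , eq)
    where
    unique-⊆ : ∀ {xs ys : List Edge} → xs ⊆ ys → Unique ys → Unique xs
    unique-⊆ []         u        = []
    unique-⊆ (y ∷ʳ p)   (_ ∷ u)  = unique-⊆ p u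
    unique-⊆ (refl ∷ p) (x≢ ∷ u) = All.tabulate (All.lookup x≢ ∘ Sublist.lookup p) ∷ unique-⊆ p u

  kinds-chords : ∀ k {P} → ChordList P → map (kind k) P ≡ replicate (length P) parallel
  kinds-chords k {P} (_ , c) = map-constant (kind k) P (λ e∈ → let t , eq = All.lookup c e∈ in trans (cong (kind k) eq) (kind-chord k t))

  module _ {p} {Q : Pred Edge p} (Q? : Decidable Q) where

    private
      pick : Edge → List Edge
      pick e = filter Q? (e ∷ [])

    -- Components list the chords in the order of the lower arc, which is opposite to that of the
    -- upper arc; hence the chosen chords appear first as `reverse Y` and then as `Y`.
    filter-wordJ : ∀ k j {Y} → filter Q? (map chord (downFrom j)) ≡ Y →
      filter Q? (wordJ k j) ≡ pick (up k) ++ reverse Y ++ pick (up 0) ++ pick (low 0) ++ Y ++ pick (low k)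
    filter-wordJ k j {Y} eq = trans (filter-++ Q? (up k ∷ []) _) (cong (pick (up k) ++_)
      (trans (filter-++ Q? (map chord (upTo j)) _) (cong₂ _++_ ascending
        (trans (filter-++ Q? (up 0 ∷ []) _) (cong (pick (up 0) ++_)
          (trans (filter-++ Q? (low 0 ∷ []) _) (cong (pick (low 0) ++_)
            (trans (filter-++ Q? (map chord (downFrom j)) _) (cong (_++ pick (low k)) eq)))))))))
      where
      ascending : filter Q? (map chord (upTo j)) ≡ reverse Y
      ascending = trans (cong (filter Q?) (sym (trans (cong reverse (chords-reversed j)) (reverse-involutive (map chord (upTo j))))))
        (trans (filter-reverse Q? (map chord (downFrom j))) (cong reverse eq))

  module _ (k j : ℕ) where

    private
      C = map chord (downFrom j)

      ¬rail∈ : ∀ {e P} → ladderKind e ≡ rails → P ⊆ C → e ∉ P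
      ¬rail∈ r p e∈ with t , _ , refl ← ∈-map⁻ chord (Sublist.lookup p e∈) with () ← r

      on-rails : ∀ {e} → ladderKind e ≡ rails → e ∈ railEdges (suc k) ⊎ e ∈ C → e ∈ railEdges (suc k)
      on-rails r (inj₁ e∈) = e∈
      on-rails r (inj₂ e∈) with t , _ , refl ← ∈-map⁻ chord e∈ with () ← r

      rep-vertex : ∀ {v} → v ∈ ladder (suc k) → rep (ladder (suc k)) (proj₁ v) ≡ root k
      rep-vertex {v} v∈ = rep-rails k (on-rails (All.lookup (All.lookup (ladder-rails (suc k)) v∈) (here refl))
        (∈-++⁻ (railEdges (suc k)) (subst (proj₁ v ∈_) (edgesJ-split (suc k) j) edge)))
        where
        edge : proj₁ v ∈ edgesJ (suc k) j
        edge = reduce (∈-++⁻ (edgesJ (suc k) j) (∈-resp-↭ (twoEndsJ (suc k) j)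
          (∈-++⁺ʳ (wordJ (suc k) j) (∈-concatMap⁺ halves (lose v∈ (here refl))))))

      up₀ : up 0 ∈ railEdges (suc k)
      up₀ = ∈-++⁺ˡ (∈-map⁺ up (∈-downFrom⁺ (ℕ.s≤s ℕ.z≤n)))

      low₀ : low 0 ∈ railEdges (suc k)
      low₀ = ∈-++⁺ʳ (map up (downFrom (suc (suc k)))) (∈-++⁺ˡ (∈-map⁺ low (∈-downFrom⁺ (ℕ.s≤s ℕ.z≤n))))

      up₊ : up (suc k) ∈ railEdges (suc k)
      up₊ = here refl

      low₊ : low (suc k) ∈ railEdges (suc k)
      low₊ = ∈-++⁺ʳ (map up (downFrom (suc (suc k)))) (here refl)

    -- All vertices of the ladder have the representative `root k`, so they are all dropped if `P`
    -- omits it and all kept if `P` contains it.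
    shape-suc : ∀ {P} → P ⊆ root k ∷ C → Shape (sub (J (suc k) j) P) (map (kind (suc k)) P) (suc k)
    shape-suc {P} (_ ∷ʳ p) = noRails P (chordList p) (kinds-chords (suc k) (chordList p))
      (filter-none (keptᵛ? (J (suc k) j) P) (All.tabulate λ v∈ → ¬kept (rep-vertex v∈)))
      (trans (filter-wordJ (kept? (J (suc k) j) P) (suc k) j (filter-sublist (kept? (J (suc k) j) P) (chords-unique j) p only kept))
        (trans (cong₂ _++_ (drop up₊)
          (cong (reverse P ++_) (cong₂ _++_ (drop up₀) (cong₂ _++_ (drop low₀) (cong (P ++_) (drop low₊))))))
          (cong (reverse P ++_) (++-identityʳ P))))
      where
      ρ = rep (ladder (suc k))
      ¬kept : ∀ {e} → ρ e ≡ root k → ρ e ∉ P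
      ¬kept eq r∈ = ¬rail∈ (root-rails k) p (subst (_∈ P) eq r∈)
      drop : ∀ {e} → e ∈ railEdges (suc k) → filter (kept? (J (suc k) j) P) (e ∷ []) ≡ []
      drop e∈ = filter-reject (kept? (J (suc k) j) P) (¬kept (rep-rails k e∈))
      only : ∀ {e} → e ∈ C → ρ e ∈ P → e ∈ P
      only e∈ r∈ with t , _ , refl ← ∈-map⁻ chord e∈ = subst (_∈ P) (rep-chord (suc k) t) r∈
      kept : ∀ {e} → e ∈ P → ρ e ∈ P
      kept e∈ with t , _ , refl ← ∈-map⁻ chord (Sublist.lookup p e∈) = subst (_∈ P) (sym (rep-chord (suc k) t)) e∈
    shape-suc {_ ∷ P} (refl ∷ p) = bothRails P (chordList p) (cong₂ ℕ._+_ (cong uppers kind-root) (counts uppers refl))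
      (cong₂ ℕ._+_ (cong lowers kind-root) (counts lowers refl)) (cong₂ ℕ._+_ (cong parallels kind-root) parallel-count)
      (filter-all (keptᵛ? (J (suc k) j) (root k ∷ P)) (All.tabulate λ v∈ → here (rep-vertex v∈)))
      (trans (filter-wordJ Q? (suc k) j (filter-sublist Q? (chords-unique j) p only kept))
        (cong₂ _++_ (keep up₊)
          (cong (reverse P ++_) (cong₂ _++_ (keep up₀) (cong₂ _++_ (keep low₀) (cong₂ _++_ (sym (reverse-involutive P)) (keep low₊)))))))
      where
      Q? = kept? (J (suc k) j) (root k ∷ P)
      ρ = rep (ladder (suc k))
      kind-root : kind (suc k) (root k) ≡ rails
      kind-root = root-rails k
      counts : ∀ n → n parallel ≡ 0 → count n (map (kind (suc k)) P) ≡ 0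
      counts n eq = trans (cong (count n) (kinds-chords (suc k) (chordList p))) (count-none n eq (length P))
      parallel-count : count parallels (map (kind (suc k)) P) ≡ length P
      parallel-count = trans (cong (count parallels) (kinds-chords (suc k) (chordList p))) (count-parallels (length P))
      keep : ∀ {e} → e ∈ railEdges (suc k) → filter Q? (e ∷ []) ≡ e ∷ []
      keep e∈ = filter-accept Q? (here (rep-rails k e∈))
      only : ∀ {e} → e ∈ C → ρ e ∈ root k ∷ P → e ∈ P
      only e∈ r∈ with t , _ , refl ← ∈-map⁻ chord e∈ with subst (_∈ root k ∷ P) (rep-chord (suc k) t) r∈
      ... | here eq   = ⊥-elim (root-fresh k j (subst (_∈ C) eq e∈))
      ... | there e∈′ = e∈′
      kept : ∀ {e} → e ∈ P → ρ e ∈ root k ∷ P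
      kept e∈ with t , _ , refl ← ∈-map⁻ chord (Sublist.lookup p e∈) = there (subst (_∈ P) (sym (rep-chord (suc k) t)) e∈)

  module _ (j : ℕ) where

    private
      C = map chord (downFrom j)

      chord-only : ∀ {e P} → P ⊆ C → e ∈ P → ∃ λ t → e ≡ chord t
      chord-only p e∈ with t , _ , eq ← ∈-map⁻ chord (Sublist.lookup p e∈) = t , eq

      chords-in : ∀ {P Q} → P ⊆ C → (∀ {e} → e ∈ P → e ∈ Q) → (∀ {t} → chord t ∈ Q → chord t ∈ P) →
        filter (kept? (J 0 j) Q) C ≡ P
      chords-in {P} {Q} p P⊆Q back = filter-sublist (kept? (J 0 j) Q) (chords-unique j) p only P⊆Q
        where
        only : ∀ {e} → e ∈ C → e ∈ Q → e ∈ P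
        only e∈ q with t , _ , refl ← ∈-map⁻ chord e∈ = back q

      keep : ∀ e Q → e ∈ Q → filter (kept? (J 0 j) Q) (e ∷ []) ≡ e ∷ []
      keep e Q = filter-accept (kept? (J 0 j) Q)

      drop : ∀ e Q → e ∉ Q → filter (kept? (J 0 j) Q) (e ∷ []) ≡ []
      drop e Q = filter-reject (kept? (J 0 j) Q)

      kinds : ∀ {P} → P ⊆ C → map chordKind P ≡ replicate (length P) parallel
      kinds p = kinds-chords 0 (chordList p)

      counts : ∀ {P} → P ⊆ C → ∀ n → n parallel ≡ 0 → count n (map chordKind P) ≡ 0
      counts {P} p n eq = trans (cong (count n) (kinds p)) (count-none n eq (length P))

    -- Without vertices `rep` is the identity, so an edge is kept exactly when it is in `P`; the
    -- four clauses are the choices among the two rails.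
    shape-zero : ∀ {P} → P ⊆ up 0 ∷ low 0 ∷ C → Shape (sub (J 0 j) P) (map (kind 0) P) 0
    shape-zero {P} (_ ∷ʳ (_ ∷ʳ p)) = noRails P (chordList p) (kinds p) refl
      (trans (filter-wordJ (kept? (J 0 j) P) 0 j (chords-in p id id))
        (trans (cong₂ _++_ (drop (up 0) P no-up) (cong (reverse P ++_) (cong₂ _++_ (drop (up 0) P no-up) (cong₂ _++_ (drop (low 0) P no-low) (cong (P ++_) (drop (low 0) P no-low))))))
          (cong (reverse P ++_) (++-identityʳ P))))
      where
      no-up : up 0 ∉ P
      no-up e∈ with _ , () ← chord-only p e∈
      no-low : low 0 ∉ P
      no-low e∈ with _ , () ← chord-only p e∈
    shape-zero {_ ∷ P} (refl ∷ (_ ∷ʳ p)) = upperRail P (chordList p) (cong (upper ∷_) (kinds p)) refl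
      (trans (filter-wordJ (kept? (J 0 j) (up 0 ∷ P)) 0 j (chords-in p there λ { (there q) → q }))
        (cong₂ _++_ (keep (up 0) (up 0 ∷ P) (here refl)) (cong (reverse P ++_) (cong₂ _++_ (keep (up 0) (up 0 ∷ P) (here refl)) (cong₂ _++_ (drop (low 0) (up 0 ∷ P) no-low)
          (trans (cong (P ++_) (drop (low 0) (up 0 ∷ P) no-low)) (++-identityʳ P)))))))
      where
      no-low : low 0 ∉ up 0 ∷ P
      no-low (there e∈) with _ , () ← chord-only p e∈
    shape-zero {_ ∷ P} (_ ∷ʳ (refl ∷ p)) = lowerRail P (chordList p) (cong (lower ∷_) (kinds p)) refl
      (trans (filter-wordJ (kept? (J 0 j) (low 0 ∷ P)) 0 j (chords-in p there λ { (there q) → q }))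
        (cong₂ _++_ (drop (up 0) (low 0 ∷ P) no-up) (cong (reverse P ++_) (cong₂ _++_ (drop (up 0) (low 0 ∷ P) no-up) (cong₂ _++_ (keep (low 0) (low 0 ∷ P) (here refl))
          (cong (P ++_) (keep (low 0) (low 0 ∷ P) (here refl))))))))
      where
      no-up : up 0 ∉ low 0 ∷ P
      no-up (there e∈) with _ , () ← chord-only p e∈
    shape-zero {_ ∷ _ ∷ P} (refl ∷ (refl ∷ p)) = bothRails P (chordList p)
      (cong suc (counts p uppers refl)) (cong suc (counts p lowers refl))
      (trans (cong (count parallels) (kinds p)) (count-parallels (length P))) refl
      (trans (filter-wordJ (kept? (J 0 j) (up 0 ∷ low 0 ∷ P)) 0 j (chords-in p (there ∘ there) λ { (there (there q)) → q }))
        (cong₂ _++_ (keep (up 0) (up 0 ∷ low 0 ∷ P) (here refl)) (cong (reverse P ++_) (cong₂ _++_ (keep (up 0) (up 0 ∷ low 0 ∷ P) (here refl)) (cong₂ _++_ (keep (low 0) (up 0 ∷ low 0 ∷ P) (there (here refl)))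
          (cong₂ _++_ (sym (reverse-involutive P)) (keep (low 0) (up 0 ∷ low 0 ∷ P) (there (here refl)))))))))

-- The recursion

module _ {c ℓ m ℓm} {R : CommutativeRing c ℓ} (𝔤 : LieAlgebra R m ℓm) where

  private module R = CommutativeRing R
  open Ring (U-ring 𝔤)
  open RingProperties (U-ring 𝔤) using (-‿distribˡ-*; -‿distribʳ-*)

  -- Products over the parts of a splitting are rearranged freely, which `U 𝔤` does not permit;
  -- weights are central, so the sums are formed here, where equality ignores the proofs of
  -- centrality.
  center : CommutativeRing (c ⊔ ℓ ⊔ m ⊔ ℓm) (c ⊔ ℓ ⊔ m ⊔ ℓm)
  center = record
    { Carrier = Σ (U 𝔤) (Central 𝔤)
    ; _≈_ = λ x y → proj₁ x ≈ proj₁ y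
    ; _+_ = λ (x , p) (y , q) → x + y , λ u → trans (distribʳ u x y) (trans (+-cong (p u) (q u)) (sym (distribˡ u x y)))
    ; _*_ = λ (x , p) (y , q) → x * y , λ u →
        trans (*-assoc x y u) (trans (*-congˡ (q u)) (trans (sym (*-assoc x u y)) (trans (*-congʳ (p u)) (*-assoc u x y))))
    ; -_ = λ (x , p) → - x , λ u → trans (sym (-‿distribˡ-* x u)) (trans (-‿cong (p u)) (-‿distribʳ-* u x))
    ; 0# = 0# , scalar-comm R.0#
    ; 1# = 1# , scalar-comm R.1#
    ; isCommutativeRing = record
      { isRing = record
        { +-isAbelianGroup = record
          { isGroup = record
            { isMonoid = record
              { isSemigroup = record
                { isMagma = record
                  { isEquivalence = record { refl = refl ; sym = sym ; trans = trans }
                  ; ∙-cong = +-cong }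
                ; assoc = λ x y z → +-assoc _ _ _ }
              ; identity = (λ x → +-identityˡ _) , λ x → +-identityʳ _ }
            ; inverse = (λ x → -‿inverseˡ _) , λ x → -‿inverseʳ _
            ; ⁻¹-cong = -‿cong }
          ; comm = λ x y → +-comm _ _ }
        ; *-cong = *-cong
        ; *-assoc = λ x y z → *-assoc _ _ _
        ; *-identity = (λ x → *-identityˡ _) , λ x → *-identityʳ _
        ; distrib = (λ x y z → distribˡ _ _ _) , λ x y z → distribʳ _ _ _ }
      ; *-comm = λ (x , p) (y , _) → p y } }

-- Coefficients of the projection as a sum over all splittings

module Coefficients {c ℓ} (R : CommutativeRing c ℓ) where

  open CommutativeRing R
  open SetoidReasoning (CommutativeRing.setoid R)
  open RingProperties ring using (-‿distribˡ-*; -1*x≈-x)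
  open AbelianGroupProperties +-abelianGroup using () renaming (⁻¹-involutive to neg-involutive)
  open RawSemiringDefs (Semiring.rawSemiring semiring) using (_^_) renaming (_×_ to _⋆_)
  open SemiringMult semiring using (×-comm-*; ×-congʳ; ×-assocˡ)

  open CommutativeMonoidMult +-commutativeMonoid using (×-distrib-+)

  -- (-1)^(i-1) (i-1)!, the Möbius function of the partition lattice. The sign in front of the sum
  -- in `π` is absorbed, so that `mu 1` = 1 also accounts for the leading term.
  mu : ℕ → Carrier
  mu i = - coefficient R i

  mu-one : mu 1 ≈ 1#
  mu-one = begin
    - ((- 1# * 1#) * (1# + 0#))   ≈⟨ -‿cong (trans (*-congˡ (+-identityʳ 1#)) (trans (*-identityʳ _) (*-identityʳ _))) ⟩
    - - 1#                        ≈⟨ neg-involutive 1# ⟩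
    1# ∎

  ⋆-inverse : ∀ n x → n ⋆ x + n ⋆ (- x) ≈ 0#
  ⋆-inverse n x = trans (sym (×-distrib-+ x (- x) n)) (trans (×-congʳ n (-‿inverseʳ x)) (zeros n))
    where
    zeros : ∀ n → n ⋆ 0# ≈ 0#
    zeros zero    = refl
    zeros (suc n) = trans (+-identityˡ _) (zeros n)

  mu-suc : ∀ q → mu (suc (suc q)) + suc q ⋆ mu (suc q) ≈ 0#
  mu-suc q = trans (+-congʳ expand) (⋆-inverse (suc q) (a * b))
    where
    a = (- 1#) ^ suc q
    b = (q !) ⋆ 1#
    expand : mu (suc (suc q)) ≈ suc q ⋆ (a * b)
    expand = begin
      - ((- 1# * a) * ((suc q ℕ.* q !) ⋆ 1#))   ≈⟨ -‿cong (*-cong (-1*x≈-x a) (sym (×-assocˡ 1# (suc q) (q !)))) ⟩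
      - (- a * (suc q ⋆ b))                     ≈⟨ -‿cong (sym (-‿distribˡ-* a _)) ⟩
      - - (a * (suc q ⋆ b))                     ≈⟨ neg-involutive _ ⟩
      a * (suc q ⋆ b)                           ≈⟨ ×-comm-* (suc q) a b ⟩
      suc q ⋆ (a * b) ∎

module SplittingLengths {a ℓ} (A : CommutativeRing a ℓ) where

  open CommutativeRing A
  open Splittings A
  open SetoidReasoning (CommutativeRing.setoid A)

  total-filter : ∀ {x p} {X : Set x} {Q : Pred X p} (Q? : Decidable Q) (G : X → Carrier) xs →
    total G xs ≈ total G (filter Q? xs) + total (λ x → if does (Q? x) then 0# else G x) xs
  total-filter Q? G []       = sym (+-identityˡ 0#)
  total-filter Q? G (x ∷ xs) with Q? x
  ... | yes _ = trans (+-congˡ (total-filter Q? G xs)) (trans (sym (+-assoc _ _ _)) (+-congˡ (sym (+-identityˡ _))))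
  ... | no _  = trans (+-congˡ (total-filter Q? G xs)) (trans (sym (+-assoc _ _ _)) (trans (+-congʳ (+-comm _ _)) (+-assoc _ _ _)))

  module _ {x} {X : Set x} where

    insertions-length : ∀ (x : X) Ps {Rs} → Rs ∈ insertions x Ps → length Rs ≡ length Ps
    insertions-length x = insertions-induction (λ Ps Rs → length Rs ≡ length Ps) (λ _ _ → ≡.refl) (λ _ → cong suc)

    -- Vanishing on two or more parts passes from `H` to `added x H`, since an insertion keeps the
    -- number of parts. The induction thus changes `H` and ends with the splitting into one part.
    splitTotal-single : ∀ (H : List (List X) → Carrier) → (∀ Ps → 2 ℕ.≤ length Ps → H Ps ≈ 0#) → ∀ x xs →
      splitTotal H (x ∷ xs) ≈ H ((x ∷ xs) ∷ [])
    splitTotal-single H vanish x []       = +-identityʳ _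
    splitTotal-single H vanish x (y ∷ ys) = begin
      splitTotal H (x ∷ y ∷ ys)           ≈⟨ splitTotal-∷ H x (y ∷ ys) ⟩
      splitTotal (added x H) (y ∷ ys)     ≈⟨ splitTotal-single (added x H) vanish′ y ys ⟩
      H ((x ∷ []) ∷ (y ∷ ys) ∷ []) + (H ((x ∷ y ∷ ys) ∷ []) + 0#)
        ≈⟨ +-cong (vanish _ (ℕ.s≤s (ℕ.s≤s ℕ.z≤n))) (+-identityʳ _) ⟩
      0# + H ((x ∷ y ∷ ys) ∷ [])          ≈⟨ +-identityˡ _ ⟩
      H ((x ∷ y ∷ ys) ∷ []) ∎
      where
      vanish′ : ∀ Ps → 2 ℕ.≤ length Ps → added x H Ps ≈ 0#
      vanish′ Ps 2≤ = trans (+-cong (vanish _ (ℕ.m≤n⇒m≤1+n 2≤))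
        (total-0 (insertions x Ps) (λ Rs∈ → vanish _ (subst (2 ℕ.≤_) (≡.sym (insertions-length x Ps Rs∈)) 2≤))))
        (+-identityˡ 0#)

    splitTotal-proper : ∀ (G : List (List X) → Carrier) x xs →
      splitTotal G (x ∷ xs) ≈ total G (filter (λ Ps → 2 ℕ.≤? length Ps) (splittings (x ∷ xs))) + G ((x ∷ xs) ∷ [])
    splitTotal-proper G x xs = trans (total-filter 2≤? G (splittings (x ∷ xs))) (+-congˡ (splitTotal-single H vanish x xs))
      where
      2≤? : Decidable (λ Ps → 2 ℕ.≤ length Ps)
      2≤? Ps = 2 ℕ.≤? length Ps
      H : List (List X) → Carrier
      H Ps = if does (2≤? Ps) then 0# else G Ps
      vanish : ∀ Ps → 2 ℕ.≤ length Ps → H Ps ≈ 0#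
      vanish Ps 2≤ = reflexive (cong (λ b → if b then 0# else G Ps) (dec-true (2≤? Ps) 2≤))

-- Values of the composite weight on the diagrams J

module Evaluation {c ℓ m ℓm} {R : CommutativeRing c ℓ} (𝔤 : LieAlgebra R m ℓm)
  {n} (e e* : Fin n → LieAlgebra.Carrierᴹ 𝔤)
  (w : 𝒞 R → U 𝔤) (isWeightSystem : IsWeightSystem 𝔤 e e* w) where

  open ChordValues 𝔤 e e*
  open WeightSystem 𝔤 e e* w isWeightSystem
  open LadderRelations 𝔤 e e* w isWeightSystem
  open Coefficients R
  private
    module R = CommutativeRing R
    module Z = CommutativeRing (center 𝔤)
  open Splittings (center 𝔤)
  open SplittingLengths (center 𝔤)
  open Ring (U-ring 𝔤)
  open RingProperties (U-ring 𝔤) using (-‿distribˡ-*)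
  open RawSemiringDefs (Semiring.rawSemiring R.semiring) using () renaming (_×_ to _⋆ᴿ_)
  open RawSemiringDefs (Semiring.rawSemiring Z.semiring) using () renaming (_×_ to _⋆ᶻ_)
  open SetoidReasoning (Ring.setoid (U-ring 𝔤))

  Zᶜ : Set _
  Zᶜ = Z.Carrier

  Wᶻ : Diagram → Zᶜ
  Wᶻ D = W D , central ⟦ D ⟧

  scalarᶻ : R.Carrier → Zᶜ
  scalarᶻ a = scalar a , scalar-comm a

  module _ {D : Diagram} {x xs} (components-D : components D ≡ x ∷ xs) where

    private
      v : List Edge → Zᶜ
      v P = Wᶻ (sub D P)

      product-weight : ∀ Ps → W (product (map (sub D) Ps)) ≈ proj₁ (Π v Ps)
      product-weight []       = W-∅
      product-weight (P ∷ Ps) = trans (W-∙ (sub D P) _) (*-congˡ (product-weight Ps))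

      sum-weight : ∀ {t : List (List Edge) → 𝒞 R} (z : List (List Edge) → Zᶜ) → (∀ Ps → - w (t Ps) ≈ proj₁ (z Ps)) → ∀ Ls →
        - w (sumᶜ R (map t Ls)) ≈ proj₁ (total z Ls)
      sum-weight z p []       = trans (-‿cong 0ᴹ-homo) (trans (sym (+-identityˡ _)) (-‿inverseʳ 0#))
      sum-weight z p (L ∷ Ls) = trans (-‿cong (+ᴹ-homo _ _)) (trans (sym (neg-+ _ _)) (+-cong (p L) (sum-weight z p Ls)))
        where open AbelianGroupProperties +-abelianGroup using () renaming (⁻¹-∙-comm to neg-+)

      whole : W (sub D (x ∷ xs)) ≈ W D
      whole = W-≡ (filter-all (kept? D J′) (All.tabulate (λ {a} a∈ → kept (word⇒edge a∈))))
        (filter-all (keptᵛ? D J′) (All.tabulate (λ {u} u∈ → kept (vertex⇒edge u∈))))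
        where
        J′ = x ∷ xs
        kept : ∀ {a} → a ∈ edges D → rep (vertices D) a ∈ J′
        kept {a} a∈ = subst (rep (vertices D) a ∈_) components-D (∈-deduplicate⁺ _≟ᵉ_ (∈-map⁺ (rep (vertices D)) a∈))
        word⇒edge : ∀ {a} → a ∈ word D → a ∈ edges D
        word⇒edge a∈ = reduce (∈-++⁻ (edges D) (∈-resp-↭ (twoEnds D) (∈-++⁺ˡ a∈)))
        vertex⇒edge : ∀ {u} → u ∈ vertices D → proj₁ u ∈ edges D
        vertex⇒edge u∈ = reduce (∈-++⁻ (edges D) (∈-resp-↭ (twoEnds D)
          (∈-++⁺ʳ (word D) (∈-concatMap⁺ halves (lose u∈ (here ≡.refl))))))

    -- The leading term of `π` is the splitting into one part; together with multiplicativity this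
    -- makes the composite a single weighted sum over splittings of the nonempty set of components.
    weight-π : w (π R D) ≈ proj₁ (splitTotal (weighted (scalarᶻ ∘ mu) v) (components D))
    weight-π = begin
      w (π R D)
        ≈⟨ trans (+ᴹ-homo _ _) (+-congˡ (*ₗ-homo _ _)) ⟩
      W D - w (sumᶜ R (map _ proper))
        ≈⟨ +-cong (sym single) (sum-weight (weighted (scalarᶻ ∘ mu) v) term-weight proper) ⟩
      proj₁ (weighted (scalarᶻ ∘ mu) v ((x ∷ xs) ∷ [])) + proj₁ (total (weighted (scalarᶻ ∘ mu) v) proper)
        ≈⟨ +-comm _ _ ⟩
      proj₁ (total (weighted (scalarᶻ ∘ mu) v) proper) + proj₁ (weighted (scalarᶻ ∘ mu) v ((x ∷ xs) ∷ []))
        ≡⟨ cong (λ Ls → proj₁ (total (weighted (scalarᶻ ∘ mu) v) (filter 2≤? (splittings Ls))) +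
             proj₁ (weighted (scalarᶻ ∘ mu) v ((x ∷ xs) ∷ []))) components-D ⟩
      proj₁ (total (weighted (scalarᶻ ∘ mu) v) (filter 2≤? (splittings (x ∷ xs)))) + proj₁ (weighted (scalarᶻ ∘ mu) v ((x ∷ xs) ∷ []))
        ≈⟨ splitTotal-proper (weighted (scalarᶻ ∘ mu) v) x xs ⟨
      proj₁ (splitTotal (weighted (scalarᶻ ∘ mu) v) (x ∷ xs))
        ≡⟨ cong (λ Ls → proj₁ (splitTotal (weighted (scalarᶻ ∘ mu) v) Ls)) components-D ⟨
      proj₁ (splitTotal (weighted (scalarᶻ ∘ mu) v) (components D)) ∎
      where
      2≤? : Decidable (λ (Ps : List (List Edge)) → 2 ℕ.≤ length Ps)
      2≤? Ps = 2 ℕ.≤? length Ps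
      proper = filter 2≤? (splittings (components D))
      single : proj₁ (weighted (scalarᶻ ∘ mu) v ((x ∷ xs) ∷ [])) ≈ W D
      single = trans (*-cong (scalar-cong mu-one) (*-identityʳ _)) (trans (*-identityˡ _) whole)
      term-weight : ∀ Ps → - w (coefficient R (length Ps) ·ᶜ ⟦ product (map (sub D) Ps) ⟧) ≈ proj₁ (weighted (scalarᶻ ∘ mu) v Ps)
      term-weight Ps = trans (-‿cong (*ₗ-homo _ _)) (trans (-‿distribˡ-* _ _) (*-cong neg-scalar (product-weight Ps)))
        where
        neg-scalar : - scalar (coefficient R (length Ps)) ≈ scalar (mu (length Ps))
        neg-scalar = trans (sym (scalar-* _ _)) (scalar-cong (RingProperties.-1*x≈-x R.ring _))

  powers : Zᶜ → Zᶜ → ℕ → Zᶜ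
  powers t z zero    = z
  powers t z (suc k) = t Z.* powers t z k

  ωᶻ : Zᶜ
  ωᶻ = Ω , Ω-central

  private
    none : Index
    none _ = nothing

    -- The chords of `X` are nested around `M` with the head of `X` innermost; removing it gives the
    -- factor `t` and leaves a configuration of the same form.
    value-nested : ∀ (t : Zᶜ) M →
      (∀ {σ c} Q → c ∉ M ++ Q → σ c ≡ nothing → value σ (c ∷ M ++ c ∷ Q) ≈ proj₁ t * value σ (M ++ Q)) →
      ∀ X Q z → Unique X → (∀ {c} → c ∈ X → c ∉ M ++ Q) → value none (M ++ Q) ≈ proj₁ z →
      value none (reverse X ++ M ++ X ++ Q) ≈ proj₁ (powers t z (length X))
    value-nested t M local []      Q z u apart eq = eq
    value-nested t M local (c ∷ X) Q z (c≢ ∷ u) apart eq = begin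
      value none (reverse (c ∷ X) ++ M ++ c ∷ X ++ Q)
        ≡⟨ cong (value none) (≡.trans (cong (_++ M ++ c ∷ X ++ Q) (unfold-reverse c X)) (++-assoc (reverse X) (c ∷ []) _)) ⟩
      value none (reverse X ++ c ∷ M ++ c ∷ X ++ Q)
        ≈⟨ value-prefix (proj₂ t) (λ {σ} σc → local (X ++ Q) absent σc) (reverse X) (c∉X ∘ ∈-resp-↭ (↭-reverse X)) ≡.refl ⟩
      proj₁ t * value none (reverse X ++ M ++ X ++ Q)
        ≈⟨ *-congˡ (value-nested t M local X Q z u (apart ∘ there) eq) ⟩
      proj₁ t * proj₁ (powers t z (length X)) ∎
      where
      c∉X : c ∉ X
      c∉X c∈ = All.lookup c≢ c∈ ≡.refl
      absent : c ∉ M ++ X ++ Q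
      absent c∈ with ∈-++⁻ M c∈
      ... | inj₁ c∈M = apart (here ≡.refl) (∈-++⁺ˡ c∈M)
      ... | inj₂ c∈′ with ∈-++⁻ X c∈′
      ...   | inj₁ c∈X = c∉X c∈X
      ...   | inj₂ c∈Q = apart (here ≡.refl) (∈-++⁺ʳ M c∈Q)

  p : ℕ → Zᶜ
  p = powers ωᶻ Z.1#

  W-noRails : ∀ D P → ChordList P → vertices D ≡ [] → word D ≡ reverse P ++ P → W D ≈ proj₁ (p (length P))
  W-noRails D P (u , _) vertices-D word-D = begin
    W D                                   ≈⟨ chords D vertices-D ⟩
    value none (word D)                   ≡⟨ cong (value none) (≡.trans word-D (cong (reverse P ++_) (≡.sym (++-identityʳ P)))) ⟩
    value none (reverse P ++ P ++ [])
      ≈⟨ value-nested ωᶻ [] (λ {σ} Q c∉ σc → value-isolated {σ} Q c∉ σc) P [] Z.1# u (λ _ ()) refl ⟩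
    proj₁ (p (length P)) ∎

  W-openWord : ∀ k X D → Unique X → All (Fresh k) X → word D ≡ openWord k X → vertices D ≡ ladder k →
    W D ≈ W (J k (length X))
  W-openWord k X D u fresh word-D vertices-D = W-≅ (rename-chords k X D u fresh word-D vertices-D)

  W-ladderWord : ∀ k X D → Unique X → All (Fresh k) X → word D ≡ ladderWord k X → vertices D ≡ ladder k →
    W D ≈ W (J k (length X))
  W-ladderWord k X D u fresh word-D vertices-D =
    trans (W-≅ (rotate-≅ D (low 0 ∷ reverse X ++ low k ∷ []) _ split))
      (W-openWord k X (rotate D (low 0 ∷ reverse X ++ low k ∷ []) _ split) u fresh (≡.sym (openWord-rotated k X)) vertices-D)
    where split = ≡.trans word-D (ladderWord-rotated k X)

  module _ (s : R.Carrier)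
    (sandwich : ∀ x → ΣU.∑ (λ i → ι (e i) * (ι x * ι (e* i))) ≈ (Ω - scalar s) * ι x) where

    τᶻ : Zᶜ
    τᶻ = τ s sandwich , τ-central s sandwich

    -- A rail that no chord crosses is an isolated chord, so the sequence starts at Ω; each crossing
    -- chord then contributes Ω - s.
    q : ℕ → Zᶜ
    q = powers τᶻ ωᶻ

    q-suc : ∀ k → q (suc k) Z.+ scalarᶻ s Z.* q k Z.≈ ωᶻ Z.* q k
    q-suc k = trans (sym (distribʳ _ _ _)) (*-congʳ (trans (+-assoc _ _ _) (trans (+-congˡ (-‿inverseˡ _)) (+-identityʳ _))))

    W-oneRail : ∀ r D P → ChordList P → r ∉ P → vertices D ≡ [] → word D ≡ reverse P ++ r ∷ P ++ r ∷ [] →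
      W D ≈ proj₁ (q (length P))
    W-oneRail r D P (u , _) r∉ vertices-D word-D = begin
      W D                                         ≈⟨ chords D vertices-D ⟩
      value none (word D)                         ≡⟨ cong (value none) word-D ⟩
      value none (reverse P ++ r ∷ P ++ r ∷ [])
        ≈⟨ value-nested τᶻ (r ∷ []) (λ {σ} Q c∉ σc → value-sandwich sandwich {σ} Q (c∉ ∘ here) (c∉ ∘ there) σc)
             P (r ∷ []) ωᶻ u (λ { c∈ (here ≡.refl) → r∉ c∈ ; c∈ (there (here ≡.refl)) → r∉ c∈ })
             (trans (value-isolated {none} {r} [] (λ ()) ≡.refl) (*-identityʳ _)) ⟩
      proj₁ (q (length P)) ∎

    f : ℕ → ℕ → Zᶜ
    f k j = Wᶻ (J k j)

    -- Rotating the loop and renaming chords identifies the diagrams of `ladder-step` with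
    -- `J (suc k) j`, `J k j` and `J k (suc j)`, the former rung being the additional chord.
    f-suc : ∀ k j → f k (suc j) Z.+ (scalarᶻ s Z.* f k j Z.+ scalarᶻ s Z.* f k j) Z.≈ f (suc k) j Z.+ ωᶻ Z.* f k j
    f-suc k j = conclude (ladder-step s sandwich k X (turned (suc k)) (turned k)
      (≡.sym (reassociate (suc k))) ≡.refl (≡.sym (reassociate k)) ≡.refl)
      where
      X = map chord (upTo j)
      length-X : length X ≡ j
      length-X = ≡.trans (length-map chord (upTo j)) (length-upTo j)
      unique-X : Unique X
      unique-X = Unique.map⁺ (∷-injectiveˡ ∘ ∷-injectiveʳ) (Unique.upTo⁺ j)
      All-fresh : All (Fresh k) X
      All-fresh = All.map⁺ (All.tabulate (λ _ → isChord))
      fresh : All (rung k ≢_) X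
      fresh = All.map⁺ (All.tabulate (λ _ ()))
      split : ∀ k → wordJ k j ≡ (up k ∷ X ++ up 0 ∷ []) ++ low 0 ∷ reverse X ++ low k ∷ []
      split k = ≡.trans (wordJ-open k j) (openWord-rotated k X)
      turned : ℕ → Diagram
      turned k = rotate (J k j) (up k ∷ X ++ up 0 ∷ []) _ (split k)
      turn : ∀ k → J k j ≅ turned k
      turn k = rotate-≅ (J k j) (up k ∷ X ++ up 0 ∷ []) _ (split k)
      reassociate : ∀ k → ladderWord k X ≡ (low 0 ∷ reverse X ++ low k ∷ []) ++ up k ∷ X ++ up 0 ∷ []
      reassociate k = ladderWord-rotated k X
      conclude : (∃ λ D₁ → word D₁ ≡ ladderWord k (rung k ∷ X) × vertices D₁ ≡ ladder k ×
        W (turned (suc k)) + Ω * W (turned k) ≈ W D₁ + (scalar s * W (turned k) + scalar s * W (turned k))) →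
        f k (suc j) Z.+ (scalarᶻ s Z.* f k j Z.+ scalarᶻ s Z.* f k j) Z.≈ f (suc k) j Z.+ ωᶻ Z.* f k j
      conclude (D₁ , word-D₁ , vertices-D₁ , eq) = begin
        W (J k (suc j)) + (scalar s * W (J k j) + scalar s * W (J k j))
          ≈⟨ +-cong (sym (trans (W-ladderWord k (rung k ∷ X) D₁ (fresh ∷ unique-X) (nextRung ∷ All-fresh) word-D₁ vertices-D₁) (reflexive (cong (λ i → W (J k (suc i))) length-X))))
               (+-cong (*-congˡ (W-≅ (turn k))) (*-congˡ (W-≅ (turn k)))) ⟩
        W D₁ + (scalar s * W (turned k) + scalar s * W (turned k))
          ≈⟨ eq ⟨
        W (turned (suc k)) + Ω * W (turned k)
          ≈⟨ +-cong (W-≅ (turn (suc k))) (*-congˡ (W-≅ (turn k))) ⟨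
        W (J (suc k) j) + Ω * W (J k j) ∎

    private
      blockValue-≡ : ∀ z {ks x y k} → count uppers ks ≡ x → count lowers ks ≡ y → count parallels ks ≡ k →
        blockValue (center 𝔤) z ks ≡ z x y k
      blockValue-≡ z ≡.refl ≡.refl ≡.refl = ≡.refl

      value-noRails : ∀ z {ks} k → ks ≡ replicate k parallel → blockValue (center 𝔤) z ks ≡ z 0 0 k
      value-noRails z k ≡.refl = blockValue-≡ z {replicate k parallel} (count-none uppers ≡.refl k) (count-none lowers ≡.refl k) (count-parallels k)

      W-bothRails : ∀ k D P → ChordList P → vertices D ≡ ladder k → word D ≡ openWord k (reverse P) → W D ≈ W (J k (length P))
      W-bothRails k D P (u , c) vertices-D word-D = trans
        (W-openWord k (reverse P) D
          (SetoidPermutation.Unique-resp-↭ (≡.setoid Edge) (↭⇒↭ₛ (↭-sym (↭-reverse P))) u)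
          (All-resp-↭ (↭-sym (↭-reverse P)) (All.map (λ { (_ , ≡.refl) → isChord }) c)) word-D vertices-D)
        (reflexive (cong (λ i → W (J k i)) (length-reverse P)))

      rail∉ : ∀ {r P} → (∀ t → r ≢ chord t) → ChordList P → r ∉ P
      rail∉ r≢ (_ , c) r∈ = let t , eq = All.lookup c r∈ in r≢ t eq

    W-shape-zero : ∀ {D ks} → Shape D ks 0 → W D ≈ proj₁ (blockValue (center 𝔤) (table (center 𝔤) p q q (f 0)) ks)
    W-shape-zero {D} {ks} (noRails P c eq vertices-D word-D) = trans (W-noRails D P c vertices-D word-D)
      (reflexive (cong proj₁ (≡.sym (value-noRails (table (center 𝔤) p q q (f 0)) (length P) eq))))
    W-shape-zero {D} (upperRail P c ≡.refl vertices-D word-D) = trans (W-≅ (rotate-≅ D (up 0 ∷ []) _ word-D))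
      (trans (W-oneRail (up 0) (rotate D (up 0 ∷ []) _ word-D) P c (rail∉ (λ t ()) c) vertices-D (++-assoc (reverse P) (up 0 ∷ P) _))
        (reflexive (cong proj₁ (≡.sym (blockValue-≡ (table (center 𝔤) p q q (f 0)) {upper ∷ replicate (length P) parallel}
          (cong suc (count-none uppers ≡.refl (length P))) (count-none lowers ≡.refl (length P)) (count-parallels (length P)))))))
    W-shape-zero {D} (lowerRail P c ≡.refl vertices-D word-D) =
      trans (W-oneRail (low 0) D P c (rail∉ (λ t ()) c) vertices-D word-D)
        (reflexive (cong proj₁ (≡.sym (blockValue-≡ (table (center 𝔤) p q q (f 0)) {lower ∷ replicate (length P) parallel}
          (count-none uppers ≡.refl (length P)) (cong suc (count-none lowers ≡.refl (length P))) (count-parallels (length P))))))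
    W-shape-zero {D} {ks} (bothRails P c eq₁ eq₂ eq₃ vertices-D word-D) = trans (W-bothRails 0 D P c vertices-D word-D)
      (reflexive (cong proj₁ (≡.sym (blockValue-≡ (table (center 𝔤) p q q (f 0)) {ks} eq₁ eq₂ eq₃))))

    -- Once there is a rung no block holds a single rail, so the table entry `z` is free:
    -- `ladder-recursion` takes `q` for the diagrams before a rung is added and 0 for the result.
    W-shape-suc : ∀ k z {D ks} → Shape D ks (suc k) → W D ≈ proj₁ (blockValue (center 𝔤) (table (center 𝔤) p z z (f (suc k))) ks)
    W-shape-suc k z {D} (noRails P c eq vertices-D word-D) = trans (W-noRails D P c vertices-D word-D)
      (reflexive (cong proj₁ (≡.sym (value-noRails (table (center 𝔤) p z z (f (suc k))) (length P) eq))))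
    W-shape-suc k z {D} {ks} (bothRails P c eq₁ eq₂ eq₃ vertices-D word-D) = trans (W-bothRails (suc k) D P c vertices-D word-D)
      (reflexive (cong proj₁ (≡.sym (blockValue-≡ (table (center 𝔤) p z z (f (suc k))) {ks} eq₁ eq₂ eq₃))))

    private
      μ : ℕ → Zᶜ
      μ = scalarᶻ ∘ mu

      -- The weight of a subdiagram depends only on the kinds of its components, and `splittings`
      -- commutes with maps, so the sum can be taken over splittings of the list of kinds.
      by-kinds : ∀ D (κ : Edge → Kind) (z : ℕ → ℕ → ℕ → Zᶜ) →
        (∀ {P} → P ⊆ components D → W (sub D P) ≈ proj₁ (blockValue (center 𝔤) z (map κ P))) →
        splitTotal (weighted μ (λ P → Wᶻ (sub D P))) (components D) Z.≈
        splitTotal (weighted μ (blockValue (center 𝔤) z)) (map κ (components D))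
      by-kinds D κ z eq = begin
        proj₁ (total G (splittings (components D)))
          ≈⟨ total-cong {f = G} {G′ ∘ map (map κ)} (splittings (components D)) (λ {Ps} Ps∈ →
               *-cong (reflexive (cong (proj₁ ∘ μ) (≡.sym (length-map (map κ) Ps)))) (Π-map Ps (splittings-sublists (components D) Ps∈))) ⟩
        proj₁ (total (G′ ∘ map (map κ)) (splittings (components D)))
          ≡⟨ cong proj₁ (total-map G′ (map (map κ)) (splittings (components D))) ⟨
        proj₁ (total G′ (map (map (map κ)) (splittings (components D))))
          ≡⟨ cong (proj₁ ∘ total G′) (splittings-map κ (components D)) ⟨
        proj₁ (total G′ (splittings (map κ (components D)))) ∎
        where
        G  = weighted μ (λ P → Wᶻ (sub D P))
        G′ = weighted μ (blockValue (center 𝔤) z)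
        Π-map : ∀ Ps → All (_⊆ components D) Ps → Π (λ P → Wᶻ (sub D P)) Ps Z.≈ Π (blockValue (center 𝔤) z) (map (map κ) Ps)
        Π-map []       []       = refl
        Π-map (P ∷ Ps) (p ∷ ps) = *-cong (eq p) (Π-map Ps ps)

      kinds-list : ∀ k j → map (kind k) (map chord (downFrom j)) ≡ replicate j parallel
      kinds-list k j = ≡.trans (kinds-chords k (chordList {j} Sublist.⊆-refl))
        (cong (λ i → replicate i parallel) (≡.trans (length-map chord (downFrom j)) (length-downFrom j)))

    weight-J-zero : ∀ j → w (π R (J 0 j)) ≈
      proj₁ (splitTotal (weighted μ (blockValue (center 𝔤) (table (center 𝔤) p q q (f 0)))) (upper ∷ lower ∷ replicate j parallel))
    weight-J-zero j = trans (weight-π (components-zero j)) (trans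
      (by-kinds (J 0 j) (kind 0) (table (center 𝔤) p q q (f 0)) (λ {P} P⊆ → W-shape-zero (shape-zero j (subst (P ⊆_) (components-zero j) P⊆))))
      (reflexive (cong (λ ks → proj₁ (splitTotal (weighted μ (blockValue (center 𝔤) (table (center 𝔤) p q q (f 0)))) ks))
        (≡.trans (cong (map (kind 0)) (components-zero j)) (cong (λ ks → upper ∷ lower ∷ ks) (kinds-list 0 j))))))

    weight-J-suc : ∀ k z j → w (π R (J (suc k) j)) ≈
      proj₁ (splitTotal (weighted μ (blockValue (center 𝔤) (table (center 𝔤) p z z (f (suc k))))) (rails ∷ replicate j parallel))
    weight-J-suc k z j = trans (weight-π (components-suc k j)) (trans
      (by-kinds (J (suc k) j) (kind (suc k)) (table (center 𝔤) p z z (f (suc k)))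
        (λ {P} P⊆ → W-shape-suc k z (shape-suc k j (subst (P ⊆_) (components-suc k j) P⊆))))
      (reflexive (cong (λ ks → proj₁ (splitTotal (weighted μ (blockValue (center 𝔤) (table (center 𝔤) p z z (f (suc k))))) ks))
        (≡.trans (cong (map (kind (suc k))) (components-suc k j)) (cong₂ _∷_ (root-rails k) (kinds-list (suc k) j))))))

    private
      ⋆ᶻ-scalar : ∀ k a → scalarᶻ (k ⋆ᴿ a) Z.≈ k ⋆ᶻ scalarᶻ a
      ⋆ᶻ-scalar zero    a = refl
      ⋆ᶻ-scalar (suc k) a = trans (scalar-+ a (k ⋆ᴿ a)) (+-congˡ (⋆ᶻ-scalar k a))

      μ-suc : ∀ k → μ (suc (suc k)) Z.+ suc k ⋆ᶻ μ (suc k) Z.≈ Z.0#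
      μ-suc k = trans (+-congˡ (sym (⋆ᶻ-scalar (suc k) (mu (suc k))))) (trans (sym (scalar-+ _ _)) (scalar-cong (mu-suc k)))

    ladder-recursion : ∀ k j → w (π R (J k (suc j))) + (scalar s * w (π R (J k j)) + scalar s * w (π R (J k j))) ≈ w (π R (J (suc k) j))
    ladder-recursion zero    j = trans
      (+-cong (weight-J-zero (suc j)) (+-cong (*-congˡ (weight-J-zero j)) (*-congˡ (weight-J-zero j))))
      (trans (splitTotal-chords (center 𝔤) {μ} μ-suc p q (f 0) (f 1) {ωᶻ} {scalarᶻ s} refl (λ _ → refl) q-suc (f-suc 0) j)
        (sym (weight-J-suc 0 (λ _ → Z.0#) j)))
    ladder-recursion (suc k) j = trans
      (+-cong (weight-J-suc k q (suc j)) (+-cong (*-congˡ (weight-J-suc k q j)) (*-congˡ (weight-J-suc k q j))))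
      (trans (splitTotal-ladder (center 𝔤) {μ} μ-suc p q (f (suc k)) (f (suc (suc k))) {ωᶻ} {scalarᶻ s} refl (λ _ → refl) q-suc (f-suc (suc k)) j)
        (sym (weight-J-suc (suc k) (λ _ → Z.0#) j)))

theorem1 : ∀ {c ℓ₁ ℓ₂ m ℓm} (K : HeytingField c ℓ₁ ℓ₂) → CharacteristicZero K →
    (𝔤 : LieAlgebra (ringOf K) m ℓm) → IsSimple 𝔤 →
    let open HeytingField K
        open LieAlgebra 𝔤 using (Carrierᴹ)
    in
    ∀ {n} (e e* : Fin n → Carrierᴹ) (basis : IsBasis 𝔤 e) →
    (lam : Carrier) (lam#0 : lam # 0#) →
    IsDual 𝔤 (λ x y → lam * killing 𝔤 basis x y) e e* →
    (w : 𝒞 (ringOf K) → U 𝔤) → IsWeightSystem 𝔤 e e* w →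
    let w̄ : Diagram → U 𝔤
        w̄ D = w (π (ringOf K) D)
        _≋_ = _≈ᵁ_ 𝔤
    in
    ∀ (i j : ℕ) →
    w̄ (J (suc i) j) ≋ (w̄ (J i (suc j)) +ᵁ scalar (reciprocal K lam#0) *ᵁ w̄ (J i j))
theorem1 K characteristic-zero 𝔤 _ e e* basis lam lam#0 dual w isWeightSystem i j = begin
  w̄ (J (suc i) j)
    ≈⟨ ladder-recursion h sandwich i j ⟨
  w̄ (J i (suc j)) + (scalar h * w̄ (J i j) + scalar h * w̄ (J i j))
    ≈⟨ +-congˡ (trans (sym (distribʳ _ _ _)) (*-congʳ (trans (sym (scalar-+ h h)) (scalar-cong h-double)))) ⟩
  w̄ (J i (suc j)) + scalar (reciprocal K lam#0) * w̄ (J i j) ∎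
  where
  module K = CommutativeRing (ringOf K)
  half : K.Carrier
  -- `CharacteristicZero` speaks of n + 1, so the argument 1 inverts 2.
  half = reciprocal K (characteristic-zero 1)
  half-double : half K.+ half K.≈ K.1#
  half-double = K.trans (K.sym (K.trans (K.distribˡ _ _ _)
    (K.+-cong (K.*-identityʳ half) (K.trans (K.*-congˡ (K.+-identityʳ K.1#)) (K.*-identityʳ half)))))
    (reciprocal-inverse K (characteristic-zero 1))
  open Sandwich 𝔤 e e* basis lam dual (reciprocal K lam#0) half (reciprocal-inverse K lam#0) half-double
    using (h; h-double; sandwich)
  open Evaluation 𝔤 e e* w isWeightSystem using (ladder-recursion)
  open Ring (U-ring 𝔤)
  open SetoidReasoning (Ring.setoid (U-ring 𝔤))
  w̄ : Diagram → U 𝔤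
  w̄ D = w (π (ringOf K) D)
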